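{- Let $W$ be an irreducible $T$-module with endpoint $r$ and diameter $d=D-2r$. Then the following hold. (i) For a nonzero $u\in E_rW$, each of the two sequences $$E^*_ru,\,E^*_{r+1}u,\ldots,E^*_{r+d}u;\qquad\qquad E^{\varepsilon}_ru,\,E^{\varepsilon}_{r+1}u,\ldots,E^{\varepsilon}_{r+d}u$$ is a basis for $W$. (ii) For a nonzero $u^*\in E^*_rW$, each of the two sequences $$E^{\varepsilon}_ru^*,\,E^{\varepsilon}_{r+1}u^*,\ldots,E^{\varepsilon}_{r+d}u^*;\qquad\qquad E_ru^*,\,E_{r+1}u^*,\ldots,E_{r+d}u^*$$ is a basis for $W$. (iii) For a nonzero $u^{\varepsilon}\in E^{\varepsilon}_rW$, each of the two sequences $$E_ru^{\varepsilon},\,E_{r+1}u^{\varepsilon},\ldots,E_{r+d}u^{\varepsilon};\qquad\qquad E^*_ru^{\varepsilon},\,E^*_{r+1}u^{\varepsilon},\ldots,E^*_{r+d}u^{\varepsilon}$$ is a basis for $W$.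
   Context: Let $D$ be a positive integer and let $Q_D$ be the $D$-cube: the graph with vertex set $X=\{0,1\}^D$, two vertices being adjacent iff they differ in exactly one coordinate; $\partial$ denotes path-length distance. $\mathrm{Mat}_X(\mathbb{C})$ is the algebra of complex matrices with rows and columns indexed by $X$, acting on $V=\mathbb{C}^X$ (column vectors) by left multiplication. Write $\mathbf{i}^2=-1$. Let $A$ be the adjacency matrix of $Q_D$. Fix $x=(0,0,\ldots,0)\in X$. Let $A^*$ be the diagonal matrix in $\mathrm{Mat}_X(\mathbb{C})$ with $(y,y)$-entry $D-2\partial(x,y)$ for $y\in X$, and let $A^{\varepsilon}=-\mathbf{i}(AA^*-A^*A)/2$. Let $T$ be the subalgebra of $\mathrm{Mat}_X(\mathbb{C})$ generated by $A$ and $A^*$. The eigenvalues of $A$ are $\theta_i=D-2i$ $(0\le i\le D)$. For $0\le i\le D$: $E_i=\prod_{0\le j\le D,\,j\ne i}\frac{A-\theta_jI}{\theta_i-\theta_j}$ is the primitive idempotent of $A$ for $\theta_i$ (the orthogonal projection onto the $\theta_i$-eigenspace of $A$); $E_i^*$ is the diagonal matrix with $(y,y)$-entry $1$ if $\partial(x,y)=i$ and $0$ otherwise; and $E_i^{\varepsilon}=P^{ -1}E_iP$, where $P=P_1^{\otimes D}$ (Kronecker power, $P_{yz}=\prod_{k=1}^D(P_1)_{y_kz_k}$, invertible) with $P_1=\begin{pmatrix}1&1\\-\mathbf{i}&\mathbf{i}\end{pmatrix}$, rows and columns indexed by $0,1$ in that order. ($E_i^*$ and $E_i^{\varepsilon}$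 are the primitive idempotents of $A^*$ and $A^{\varepsilon}$ for the eigenvalue $D-2i$.) A $T$-module is a subspace $W\subseteq V$ with $BW\subseteq W$ for all $B\in T$; it is irreducible if $W\ne0$ and it contains no $T$-modules other than $0$ and $W$. The endpoint of an irreducible $T$-module $W$ is $r=\min\{i\mid 0\le i\le D,\ E_i^*W\neq0\}$ (it is known that also $r=\min\{i\mid E_iW\ne0\}$), and its diameter is $d=|\{i\mid 0\le i\le D,\ E_i^*W\ne0\}|-1$; it is known that $d=D-2r$ and $0\le r\le D/2$. -}

module Defs where

open import Level using (0ℓ)
open import Algebra.Bundles using (CommutativeRing)
open import Algebra.Structures using (IsCommutativeRing)
open import Data.Fin.Base using (Fin; zero; suc; toℕ)
open import Data.Fin.Patterns using (0F; 1F)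
import Data.Fin.Properties as Fin
open import Data.Fin.Subset as Subset using (Subset; ∣_∣)
open import Data.Integer.Base as ℤ using (ℤ; +_)
import Data.Integer.Properties as ℤ
open import Data.List.Base using (foldr; upTo)
open import Data.Nat.Base as ℕ using (ℕ; zero; suc)
import Data.Nat.Properties as ℕ
open import Data.Product.Base using (∃; ∃-syntax; _×_; _,_; proj₁; proj₂)
open import Data.Rational.Base as ℚ using (ℚ; 0ℚ; 1ℚ; ½)
open import Data.Rational.Literals using (fromℤ)
import Data.Rational.Properties as ℚ
open import Data.Rational.Solver using (module +-*-Solver)
open import Data.Sum.Base using (_⊎_; inj₁; inj₂)
open import Data.Vec.Base using (Vec; []; _∷_; lookup; replicate)
open import Data.Vec.Properties using (≡-dec)
open import Function.Base using (_∘_)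
open import Function.Bundles using (_⇔_)
open import Relation.Binary.PropositionalEquality using
  (_≡_; _≢_; refl; sym; trans; cong; cong₂; subst)
open import Relation.Nullary using (¬_; Dec; yes; no; contradiction; does)
open import Relation.Nullary.Decidable using (¬?; _×-dec_; _→-dec_)
open import Relation.Unary using (Pred; _∈_; _⊆_)
open import Data.Bool.Base using (if_then_else_)

------------------------------------------------------------------------
-- Real numbers: Cauchy sequences of rationals, equal when their
-- difference is a null sequence.

Null : (ℕ → ℚ) → Set
Null s = ∀ ε → 0ℚ ℚ.< ε → ∃[ N ] ∀ n → N ℕ.≤ n → ℚ.∣ s n ∣ ℚ.< ε

Cauchy : (ℕ → ℚ) → Set
Cauchy s = ∀ ε → 0ℚ ℚ.< ε →
  ∃[ N ] ∀ m n → N ℕ.≤ m → N ℕ.≤ n → ℚ.∣ s m ℚ.- s n ∣ ℚ.< ε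

module Sequences where

  Small : (ℕ → ℕ → ℚ) → Set
  Small f = ∀ ε → 0ℚ ℚ.< ε →
    ∃[ N ] ∀ m n → N ℕ.≤ m → N ℕ.≤ n → ℚ.∣ f m n ∣ ℚ.< ε

  Bounded : (ℕ → ℕ → ℚ) → Set
  Bounded f = ∃[ B ] 0ℚ ℚ.< B ×
    ∃[ N ] ∀ m n → N ℕ.≤ m → N ℕ.≤ n → ℚ.∣ f m n ∣ ℚ.≤ B

  null⇒small : ∀ {s} → Null s → Small (λ m n → s n)
  null⇒small h ε 0<ε = let N , p = h ε 0<ε in N , λ _ n _ → p n

  small⇒null : ∀ {s} → Small (λ m n → s n) → Null s
  small⇒null h ε 0<ε = let N , p = h ε 0<ε in N , λ n N≤n → p n n N≤n N≤n

  small-resp : ∀ {f g} → (∀ m n → f m n ≡ g m n) → Small f → Small g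
  small-resp f≡g h ε 0<ε = let N , p = h ε 0<ε in
    N , λ m n a b → subst (λ q → ℚ.∣ q ∣ ℚ.< ε) (f≡g m n) (p m n a b)

  small-0 : Small (λ _ _ → 0ℚ)
  small-0 ε 0<ε = 0 , λ _ _ _ _ → 0<ε

  small-neg : ∀ {f} → Small f → Small (λ m n → ℚ.- f m n)
  small-neg {f} h ε 0<ε = let N , p = h ε 0<ε in
    N , λ m n a b → subst (ℚ._< ε) (sym (ℚ.∣-p∣≡∣p∣ (f m n))) (p m n a b)

  half : ∀ ε → ½ ℚ.* ε ℚ.+ ½ ℚ.* ε ≡ ε
  half ε = trans (sym (ℚ.*-distribʳ-+ ε ½ ½)) (ℚ.*-identityˡ ε)

  0<half : ∀ {ε} → 0ℚ ℚ.< ε → 0ℚ ℚ.< ½ ℚ.* ε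
  0<half 0<ε = ℚ.*-monoʳ-<-pos ½ 0<ε

  small-+ : ∀ {f g} → Small f → Small g → Small (λ m n → f m n ℚ.+ g m n)
  small-+ {f} {g} hf hg ε 0<ε =
    let N , p = hf (½ ℚ.* ε) (0<half 0<ε)
        M , q = hg (½ ℚ.* ε) (0<half 0<ε)
    in N ℕ.⊔ M , λ m n a b → subst (_ ℚ.<_) (half ε)
      (ℚ.≤-<-trans (ℚ.∣p+q∣≤∣p∣+∣q∣ (f m n) (g m n))
        (ℚ.+-mono-<
          (p m n (ℕ.m⊔n≤o⇒m≤o N M a) (ℕ.m⊔n≤o⇒m≤o N M b))
          (q m n (ℕ.m⊔n≤o⇒n≤o N M a) (ℕ.m⊔n≤o⇒n≤o N M b))))

  small-* : ∀ {f g} → Bounded f → Small g → Small (λ m n → f m n ℚ.* g m n)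
  small-* {f} {g} (B , 0<B , N , p) hg ε 0<ε = N ℕ.⊔ M , bound
    where
    instance
      posB : ℚ.Positive B
      posB = ℚ.positive 0<B
      nzB : ℚ.NonZero B
      nzB = ℚ.pos⇒nonZero B
      posB⁻¹ : ℚ.Positive (ℚ.1/ B)
      posB⁻¹ = ℚ.1/pos⇒pos B
    δ = ℚ.1/ B ℚ.* ε
    0<δ : 0ℚ ℚ.< δ
    0<δ = subst (ℚ._< δ) (ℚ.*-zeroʳ (ℚ.1/ B)) (ℚ.*-monoʳ-<-pos (ℚ.1/ B) 0<ε)
    M = proj₁ (hg δ 0<δ)
    q = proj₂ (hg δ 0<δ)
    B*δ≡ε : B ℚ.* δ ≡ ε
    B*δ≡ε = trans (sym (ℚ.*-assoc B (ℚ.1/ B) ε))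
      (trans (cong (ℚ._* ε) (ℚ.*-inverseʳ B)) (ℚ.*-identityˡ ε))
    bound : ∀ m n → N ℕ.⊔ M ℕ.≤ m → N ℕ.⊔ M ℕ.≤ n → ℚ.∣ f m n ℚ.* g m n ∣ ℚ.< ε
    bound m n a b = begin-strict
      ℚ.∣ f m n ℚ.* g m n ∣         ≡⟨ ℚ.∣p*q∣≡∣p∣*∣q∣ (f m n) (g m n) ⟩
      ℚ.∣ f m n ∣ ℚ.* ℚ.∣ g m n ∣   ≤⟨ ℚ.*-monoʳ-≤-nonNeg ℚ.∣ g m n ∣ {{ℚ.∣-∣-nonNeg (g m n)}}
                                      (p m n (ℕ.m⊔n≤o⇒m≤o N M a) (ℕ.m⊔n≤o⇒m≤o N M b)) ⟩
      B ℚ.* ℚ.∣ g m n ∣             <⟨ ℚ.*-monoʳ-<-pos B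
                                      (q m n (ℕ.m⊔n≤o⇒n≤o N M a) (ℕ.m⊔n≤o⇒n≤o N M b)) ⟩
      B ℚ.* δ                       ≡⟨ B*δ≡ε ⟩
      ε                             ∎
      where open ℚ.≤-Reasoning

  cauchy⇒bounded : ∀ {s} → Cauchy s →
    ∃[ B ] 0ℚ ℚ.< B × ∃[ N ] ∀ n → N ℕ.≤ n → ℚ.∣ s n ∣ ℚ.≤ B
  cauchy⇒bounded {s} h = B , 0<B , N , bound
    where
    N = proj₁ (h 1ℚ (ℚ.positive⁻¹ 1ℚ))
    p = proj₂ (h 1ℚ (ℚ.positive⁻¹ 1ℚ))
    B = 1ℚ ℚ.+ ℚ.∣ s N ∣
    0<B : 0ℚ ℚ.< B
    0<B = ℚ.+-mono-<-≤ {0ℚ} {1ℚ} {0ℚ} (ℚ.positive⁻¹ 1ℚ) (ℚ.0≤∣p∣ (s N))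
    split : ∀ a b → (a ℚ.- b) ℚ.+ b ≡ a
    split = solve 2 (λ a b → (a :- b) :+ b := a) refl
      where open +-*-Solver
    bound : ∀ n → N ℕ.≤ n → ℚ.∣ s n ∣ ℚ.≤ B
    bound n N≤n = begin
      ℚ.∣ s n ∣                          ≡⟨ cong ℚ.∣_∣ (split (s n) (s N)) ⟨
      ℚ.∣ (s n ℚ.- s N) ℚ.+ s N ∣        ≤⟨ ℚ.∣p+q∣≤∣p∣+∣q∣ (s n ℚ.- s N) (s N) ⟩
      ℚ.∣ s n ℚ.- s N ∣ ℚ.+ ℚ.∣ s N ∣    ≤⟨ ℚ.+-monoˡ-≤ ℚ.∣ s N ∣ (ℚ.<⇒≤ (p n N N≤n ℕ.≤-refl)) ⟩
      B                                  ∎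
      where open ℚ.≤-Reasoning

  boundedˡ : ∀ s → Cauchy s → Bounded (λ m n → s m)
  boundedˡ s h = let B , 0<B , N , p = cauchy⇒bounded {s} h in
    B , 0<B , N , λ m n a b → p m a

  boundedʳ : ∀ s → Cauchy s → Bounded (λ m n → s n)
  boundedʳ s h = let B , 0<B , N , p = cauchy⇒bounded {s} h in
    B , 0<B , N , λ m n a b → p n b

  small-+-difference : ∀ (a b c d : ℕ → ℕ → ℚ) →
    Small (λ m n → a m n ℚ.- c m n) → Small (λ m n → b m n ℚ.- d m n) →
    Small (λ m n → (a m n ℚ.+ b m n) ℚ.- (c m n ℚ.+ d m n))
  small-+-difference a b c d p q = small-resp
    {λ m n → (a m n ℚ.- c m n) ℚ.+ (b m n ℚ.- d m n)}
    (λ m n → identity (a m n) (b m n) (c m n) (d m n))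
    (small-+ {λ m n → a m n ℚ.- c m n} {λ m n → b m n ℚ.- d m n} p q)
    where
    open +-*-Solver
    identity : ∀ a b c d → (a ℚ.- c) ℚ.+ (b ℚ.- d) ≡ (a ℚ.+ b) ℚ.- (c ℚ.+ d)
    identity = solve 4 (λ a b c d →
      (a :- c) :+ (b :- d) := (a :+ b) :- (c :+ d)) refl

  small-neg-difference : ∀ (a b : ℕ → ℕ → ℚ) →
    Small (λ m n → a m n ℚ.- b m n) → Small (λ m n → (ℚ.- a m n) ℚ.- (ℚ.- b m n))
  small-neg-difference a b p = small-resp
    {λ m n → ℚ.- (a m n ℚ.- b m n)}
    (λ m n → identity (a m n) (b m n))
    (small-neg {λ m n → a m n ℚ.- b m n} p)
    where
    open +-*-Solver
    identity : ∀ a b → ℚ.- (a ℚ.- b) ≡ (ℚ.- a) ℚ.- (ℚ.- b)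
    identity = solve 2 (λ a b → :- (a :- b) := (:- a) :- (:- b)) refl

  small-*-difference : ∀ (a b c d : ℕ → ℕ → ℚ) → Bounded a → Bounded d →
    Small (λ m n → a m n ℚ.- c m n) → Small (λ m n → b m n ℚ.- d m n) →
    Small (λ m n → a m n ℚ.* b m n ℚ.- c m n ℚ.* d m n)
  small-*-difference a b c d a-bounded d-bounded p q = small-resp
    {λ m n → a m n ℚ.* (b m n ℚ.- d m n) ℚ.+ d m n ℚ.* (a m n ℚ.- c m n)}
    (λ m n → identity (a m n) (b m n) (c m n) (d m n))
    (small-+ {λ m n → a m n ℚ.* (b m n ℚ.- d m n)} {λ m n → d m n ℚ.* (a m n ℚ.- c m n)}
      (small-* {a} {λ m n → b m n ℚ.- d m n} a-bounded q)
      (small-* {d} {λ m n → a m n ℚ.- c m n} d-bounded p))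
    where
    open +-*-Solver
    identity : ∀ a b c d → a ℚ.* (b ℚ.- d) ℚ.+ d ℚ.* (a ℚ.- c) ≡ a ℚ.* b ℚ.- c ℚ.* d
    identity = solve 4 (λ a b c d →
      a :* (b :- d) :+ d :* (a :- c) := a :* b :- c :* d) refl

open Sequences

record ℝ : Set where
  constructor mkℝ
  field
    seq    : ℕ → ℚ
    cauchy : Cauchy seq
open ℝ public

module Real where

  infix  4 _≈_ _#_
  infixl 6 _+_
  infixl 7 _*_
  infix  8 -_

  _≈_ : ℝ → ℝ → Set
  x ≈ y = Null (λ n → seq x n ℚ.- seq y n)

  -- Apartness is the positive form of x ≠ y: by #⇒≉ and #-tight below it is
  -- classically equivalent to ¬ x ≈ y.
  _#_ : ℝ → ℝ → Set
  x # y = ∃[ ε ] 0ℚ ℚ.< ε ×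
    ∃[ N ] ∀ n → N ℕ.≤ n → ε ℚ.≤ ℚ.∣ seq x n ℚ.- seq y n ∣

  fromℚ : ℚ → ℝ
  fromℚ q = mkℝ (λ _ → q)
    (small-resp {λ _ _ → 0ℚ} (λ _ _ → sym (ℚ.+-inverseʳ q)) small-0)

  _+_ : ℝ → ℝ → ℝ
  x + y = mkℝ (λ n → seq x n ℚ.+ seq y n)
    (small-+-difference (λ m _ → seq x m) (λ m _ → seq y m) (λ _ n → seq x n) (λ _ n → seq y n)
      (cauchy x) (cauchy y))

  -_ : ℝ → ℝ
  - x = mkℝ (λ n → ℚ.- seq x n)
    (small-neg-difference (λ m _ → seq x m) (λ _ n → seq x n) (cauchy x))

  _*_ : ℝ → ℝ → ℝ
  x * y = mkℝ (λ n → seq x n ℚ.* seq y n)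
    (small-*-difference (λ m _ → seq x m) (λ m _ → seq y m) (λ _ n → seq x n) (λ _ n → seq y n)
      (boundedˡ (seq x) (cauchy x)) (boundedʳ (seq y) (cauchy y)) (cauchy x) (cauchy y))

  private
    ⟦_⟧ : ℝ → ℕ → ℕ → ℚ
    ⟦ x ⟧ _ n = seq x n

    difference : ℝ → ℝ → ℕ → ℚ
    difference x y n = seq x n ℚ.- seq y n

  pointwise : ∀ {x y} → (∀ n → seq x n ≡ seq y n) → x ≈ y
  pointwise {x} {y} eq ε 0<ε = 0 , λ n _ → subst (λ q → ℚ.∣ q ∣ ℚ.< ε)
    (sym (trans (cong (λ q → q ℚ.- seq y n) (eq n)) (ℚ.+-inverseʳ (seq y n)))) 0<ε

  ≈-refl : ∀ {x} → x ≈ x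
  ≈-refl {x} = pointwise {x} {x} (λ _ → refl)

  ≈-sym : ∀ {x y} → x ≈ y → y ≈ x
  ≈-sym {x} {y} x≈y = small⇒null {difference y x} (small-resp
    {λ _ n → ℚ.- difference x y n}
    (λ _ n → flip (seq x n) (seq y n))
    (small-neg {λ _ n → difference x y n} (null⇒small {difference x y} x≈y)))
    where
    open +-*-Solver
    flip : ∀ a b → ℚ.- (a ℚ.- b) ≡ b ℚ.- a
    flip = solve 2 (λ a b → :- (a :- b) := b :- a) refl

  ≈-trans : ∀ {x y z} → x ≈ y → y ≈ z → x ≈ z
  ≈-trans {x} {y} {z} x≈y y≈z = small⇒null {difference x z} (small-resp
    {λ _ n → difference x y n ℚ.+ difference y z n}
    (λ _ n → join (seq x n) (seq y n) (seq z n))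
    (small-+ {λ _ n → difference x y n} {λ _ n → difference y z n}
      (null⇒small {difference x y} x≈y) (null⇒small {difference y z} y≈z)))
    where
    open +-*-Solver
    join : ∀ a b c → (a ℚ.- b) ℚ.+ (b ℚ.- c) ≡ a ℚ.- c
    join = solve 3 (λ a b c → (a :- b) :+ (b :- c) := a :- c) refl

  +-cong : ∀ {x x′ y y′} → x ≈ x′ → y ≈ y′ → x + y ≈ x′ + y′
  +-cong {x} {x′} {y} {y′} p q = small⇒null {difference (x + y) (x′ + y′)}
    (small-+-difference ⟦ x ⟧ ⟦ y ⟧ ⟦ x′ ⟧ ⟦ y′ ⟧
      (null⇒small {difference x x′} p) (null⇒small {difference y y′} q))

  -‿cong : ∀ {x y} → x ≈ y → - x ≈ - y
  -‿cong {x} {y} p = small⇒null {difference (- x) (- y)}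
    (small-neg-difference ⟦ x ⟧ ⟦ y ⟧ (null⇒small {difference x y} p))

  *-cong : ∀ {x x′ y y′} → x ≈ x′ → y ≈ y′ → x * y ≈ x′ * y′
  *-cong {x} {x′} {y} {y′} p q = small⇒null {difference (x * y) (x′ * y′)}
    (small-*-difference ⟦ x ⟧ ⟦ y ⟧ ⟦ x′ ⟧ ⟦ y′ ⟧
      (boundedʳ (seq x) (cauchy x)) (boundedʳ (seq y′) (cauchy y′))
      (null⇒small {difference x x′} p) (null⇒small {difference y y′} q))

  #⇒≉ : ∀ {x y} → x # y → ¬ x ≈ y
  #⇒≉ (ε , 0<ε , N , far) x≈y =
    let M , near = x≈y ε 0<ε
        k = N ℕ.⊔ M
    in ℚ.<-irrefl refl (ℚ.<-≤-trans (near k (ℕ.m≤n⊔m N M)) (far k (ℕ.m≤m⊔n N M)))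

  #-tight : ∀ {x y} → ¬ x # y → x ≈ y
  #-tight {x} {y} ¬x#y ε 0<ε = N , near
    where
    d : ℕ → ℚ
    d n = seq x n ℚ.- seq y n
    η = ½ ℚ.* ε
    0<η : 0ℚ ℚ.< η
    0<η = 0<half 0<ε
    close : Cauchy d
    close = cauchy (x + (- y))
    N = proj₁ (close η 0<η)
    p = proj₂ (close η 0<η)
    split : ∀ a b → (a ℚ.- b) ℚ.+ b ≡ a
    split = solve 2 (λ a b → (a :- b) :+ b := a) refl
      where open +-*-Solver
    step : ∀ m n → N ℕ.≤ m → N ℕ.≤ n → ℚ.∣ d m ∣ ℚ.< η ℚ.+ ℚ.∣ d n ∣
    step m n a b = ℚ.≤-<-trans
      (subst (λ q → ℚ.∣ q ∣ ℚ.≤ ℚ.∣ d m ℚ.- d n ∣ ℚ.+ ℚ.∣ d n ∣) (split (d m) (d n))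
        (ℚ.∣p+q∣≤∣p∣+∣q∣ (d m ℚ.- d n) (d n)))
      (ℚ.+-monoˡ-< ℚ.∣ d n ∣ (p m n a b))
    near : ∀ n → N ℕ.≤ n → ℚ.∣ d n ∣ ℚ.< ε
    near n N≤n with ℚ.∣ d n ∣ ℚ.<? ε
    ... | yes small = small
    ... | no large = contradiction (η , 0<η , N , far) ¬x#y
      where
      far : ∀ m → N ℕ.≤ m → η ℚ.≤ ℚ.∣ d m ∣
      far m N≤m with ℚ.∣ d m ∣ ℚ.<? η
      ... | no η≤ = ℚ.≮⇒≥ η≤
      ... | yes d<η = contradiction
        (ℚ.<-trans (step n m N≤n N≤m)
          (subst (η ℚ.+ ℚ.∣ d m ∣ ℚ.<_) (half ε) (ℚ.+-monoʳ-< η d<η)))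
        large

------------------------------------------------------------------------

infix 5 _+i_

record ℂ : Set where
  constructor _+i_
  field
    re im : ℝ
open ℂ public

module Complex where

  infix  4 _≈_ _#_
  infixl 6 _+_
  infixl 7 _*_
  infix  8 -_

  -- Opaque so that type inference does not unfold operations down to ℚ.
  opaque
    _≈_ : ℂ → ℂ → Set
    z ≈ w = re z Real.≈ re w × im z Real.≈ im w

    _#_ : ℂ → ℂ → Set
    z # w = re z Real.# re w ⊎ im z Real.# im w

    fromℚ : ℚ → ℂ
    fromℚ q = Real.fromℚ q +i Real.fromℚ 0ℚ

    𝐢 : ℂ
    𝐢 = Real.fromℚ 0ℚ +i Real.fromℚ 1ℚ

    _+_ : ℂ → ℂ → ℂ
    z + w = (re z Real.+ re w) +i (im z Real.+ im w)

    -_ : ℂ → ℂ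
    - z = (Real.- re z) +i (Real.- im z)

    _*_ : ℂ → ℂ → ℂ
    z * w = (re z Real.* re w Real.+ Real.- (im z Real.* im w))
         +i (re z Real.* im w Real.+ im z Real.* re w)

  0ℂ 1ℂ : ℂ
  0ℂ = fromℚ 0ℚ
  1ℂ = fromℚ 1ℚ

  opaque
    unfolding _≈_

    #⇒≉ : ∀ {z w} → z # w → ¬ z ≈ w
    #⇒≉ {z} {w} (inj₁ p) (q , _) = Real.#⇒≉ {re z} {re w} p q
    #⇒≉ {z} {w} (inj₂ p) (_ , q) = Real.#⇒≉ {im z} {im w} p q

    #-tight : ∀ {z w} → ¬ z # w → z ≈ w
    #-tight {z} {w} ¬p =
      Real.#-tight {re z} {re w} (¬p ∘ inj₁) , Real.#-tight {im z} {im w} (¬p ∘ inj₂)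

    pointwise : ∀ {z w} → (∀ n → seq (re z) n ≡ seq (re w) n) →
                (∀ n → seq (im z) n ≡ seq (im w) n) → z ≈ w
    pointwise {z} {w} p q =
      Real.pointwise {re z} {re w} p , Real.pointwise {im z} {im w} q

    ℂ-isCommutativeRing : IsCommutativeRing _≈_ _+_ _*_ -_ 0ℂ 1ℂ
    ℂ-isCommutativeRing = record
      { isRing = record
        { +-isAbelianGroup = record
          { isGroup = record
            { isMonoid = record
              { isSemigroup = record
                { isMagma = record
                  { isEquivalence = record
                    { refl  = λ {z} → pointwise {z} {z} (λ _ → refl) (λ _ → refl)
                    ; sym   = λ {z} {w} (p , q) →
                        Real.≈-sym {re z} {re w} p , Real.≈-sym {im z} {im w} q
                    ; trans = λ {z} {w} {v} (p , q) (p′ , q′) →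
                        Real.≈-trans {re z} {re w} {re v} p p′ ,
                        Real.≈-trans {im z} {im w} {im v} q q′
                    }
                  ; ∙-cong = λ {z} {z′} {w} {w′} (p , q) (p′ , q′) →
                      Real.+-cong {re z} {re z′} {re w} {re w′} p p′ ,
                      Real.+-cong {im z} {im z′} {im w} {im w′} q q′
                  }
                ; assoc = λ z w v → pointwise {(z + w) + v} {z + (w + v)}
                    (λ n → ℚ.+-assoc (seq (re z) n) (seq (re w) n) (seq (re v) n))
                    (λ n → ℚ.+-assoc (seq (im z) n) (seq (im w) n) (seq (im v) n))
                }
              ; identity =
                  (λ z → pointwise {0ℂ + z} {z}
                    (λ n → ℚ.+-identityˡ (seq (re z) n)) (λ n → ℚ.+-identityˡ (seq (im z) n))) ,
                  (λ z → pointwise {z + 0ℂ} {z}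
                    (λ n → ℚ.+-identityʳ (seq (re z) n)) (λ n → ℚ.+-identityʳ (seq (im z) n)))
              }
            ; inverse =
                (λ z → pointwise {(- z) + z} {0ℂ}
                  (λ n → ℚ.+-inverseˡ (seq (re z) n)) (λ n → ℚ.+-inverseˡ (seq (im z) n))) ,
                (λ z → pointwise {z + (- z)} {0ℂ}
                  (λ n → ℚ.+-inverseʳ (seq (re z) n)) (λ n → ℚ.+-inverseʳ (seq (im z) n)))
            ; ⁻¹-cong = λ {z} {w} (p , q) →
                Real.-‿cong {re z} {re w} p , Real.-‿cong {im z} {im w} q
            }
          ; comm = λ z w → pointwise {z + w} {w + z}
              (λ n → ℚ.+-comm (seq (re z) n) (seq (re w) n))
              (λ n → ℚ.+-comm (seq (im z) n) (seq (im w) n))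
          }
        ; *-cong = λ {z} {z′} {w} {w′} → *-cong {z} {z′} {w} {w′}
        ; *-assoc = λ z w v → pointwise {(z * w) * v} {z * (w * v)}
            (λ n → assoc-re (seq (re z) n) (seq (im z) n) (seq (re w) n)
                            (seq (im w) n) (seq (re v) n) (seq (im v) n))
            (λ n → assoc-im (seq (re z) n) (seq (im z) n) (seq (re w) n)
                            (seq (im w) n) (seq (re v) n) (seq (im v) n))
        ; *-identity =
            (λ z → pointwise {1ℂ * z} {z}
              (λ n → idˡ-re (seq (re z) n) (seq (im z) n))
              (λ n → idˡ-im (seq (re z) n) (seq (im z) n))) ,
            (λ z → pointwise {z * 1ℂ} {z}
              (λ n → idʳ-re (seq (re z) n) (seq (im z) n))
              (λ n → idʳ-im (seq (re z) n) (seq (im z) n)))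
        ; distrib =
            (λ z w v → pointwise {z * (w + v)} {z * w + z * v}
              (λ n → distˡ-re (seq (re z) n) (seq (im z) n) (seq (re w) n)
                              (seq (im w) n) (seq (re v) n) (seq (im v) n))
              (λ n → distˡ-im (seq (re z) n) (seq (im z) n) (seq (re w) n)
                              (seq (im w) n) (seq (re v) n) (seq (im v) n))) ,
            (λ z w v → pointwise {(w + v) * z} {w * z + v * z}
              (λ n → distʳ-re (seq (re z) n) (seq (im z) n) (seq (re w) n)
                              (seq (im w) n) (seq (re v) n) (seq (im v) n))
              (λ n → distʳ-im (seq (re z) n) (seq (im z) n) (seq (re w) n)
                              (seq (im w) n) (seq (re v) n) (seq (im v) n)))
        }
      ; *-comm = λ z w → pointwise {z * w} {w * z}
          (λ n → comm-re (seq (re z) n) (seq (im z) n) (seq (re w) n) (seq (im w) n))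
          (λ n → comm-im (seq (re z) n) (seq (im z) n) (seq (re w) n) (seq (im w) n))
      }
      where
      open +-*-Solver

      *-cong : ∀ {z z′ w w′} → z ≈ z′ → w ≈ w′ → z * w ≈ z′ * w′
      *-cong {z} {z′} {w} {w′} (p , q) (p′ , q′) =
        Real.+-cong {re z Real.* re w} {re z′ Real.* re w′}
                    {Real.- (im z Real.* im w)} {Real.- (im z′ Real.* im w′)}
          (Real.*-cong {re z} {re z′} {re w} {re w′} p p′)
          (Real.-‿cong {im z Real.* im w} {im z′ Real.* im w′}
            (Real.*-cong {im z} {im z′} {im w} {im w′} q q′)) ,
        Real.+-cong {re z Real.* im w} {re z′ Real.* im w′}
                    {im z Real.* re w} {im z′ Real.* re w′}
          (Real.*-cong {re z} {re z′} {im w} {im w′} p q′)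
          (Real.*-cong {im z} {im z′} {re w} {re w′} q p′)

      mulRe mulIm : ℚ → ℚ → ℚ → ℚ → ℚ
      mulRe a b c d = a ℚ.* c ℚ.+ ℚ.- (b ℚ.* d)
      mulIm a b c d = a ℚ.* d ℚ.+ b ℚ.* c

      :re :im : ∀ {n} → Polynomial n → Polynomial n → Polynomial n → Polynomial n → Polynomial n
      :re a b c d = a :* c :+ :- (b :* d)
      :im a b c d = a :* d :+ b :* c

      assoc-re : ∀ a b c d e f → mulRe (mulRe a b c d) (mulIm a b c d) e f
                               ≡ mulRe a b (mulRe c d e f) (mulIm c d e f)
      assoc-re = solve 6 (λ a b c d e f → :re (:re a b c d) (:im a b c d) e f
                                       := :re a b (:re c d e f) (:im c d e f)) refl
      assoc-im : ∀ a b c d e f → mulIm (mulRe a b c d) (mulIm a b c d) e f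
                               ≡ mulIm a b (mulRe c d e f) (mulIm c d e f)
      assoc-im = solve 6 (λ a b c d e f → :im (:re a b c d) (:im a b c d) e f
                                       := :im a b (:re c d e f) (:im c d e f)) refl
      idˡ-re : ∀ a b → mulRe 1ℚ 0ℚ a b ≡ a
      idˡ-re = solve 2 (λ a b → :re (con 1ℚ) (con 0ℚ) a b := a) refl
      idˡ-im : ∀ a b → mulIm 1ℚ 0ℚ a b ≡ b
      idˡ-im = solve 2 (λ a b → :im (con 1ℚ) (con 0ℚ) a b := b) refl
      idʳ-re : ∀ a b → mulRe a b 1ℚ 0ℚ ≡ a
      idʳ-re = solve 2 (λ a b → :re a b (con 1ℚ) (con 0ℚ) := a) refl
      idʳ-im : ∀ a b → mulIm a b 1ℚ 0ℚ ≡ b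
      idʳ-im = solve 2 (λ a b → :im a b (con 1ℚ) (con 0ℚ) := b) refl
      distˡ-re : ∀ a b c d e f →
        mulRe a b (c ℚ.+ e) (d ℚ.+ f) ≡ mulRe a b c d ℚ.+ mulRe a b e f
      distˡ-re = solve 6 (λ a b c d e f →
        :re a b (c :+ e) (d :+ f) := :re a b c d :+ :re a b e f) refl
      distˡ-im : ∀ a b c d e f →
        mulIm a b (c ℚ.+ e) (d ℚ.+ f) ≡ mulIm a b c d ℚ.+ mulIm a b e f
      distˡ-im = solve 6 (λ a b c d e f →
        :im a b (c :+ e) (d :+ f) := :im a b c d :+ :im a b e f) refl
      distʳ-re : ∀ a b c d e f →
        mulRe (c ℚ.+ e) (d ℚ.+ f) a b ≡ mulRe c d a b ℚ.+ mulRe e f a b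
      distʳ-re = solve 6 (λ a b c d e f →
        :re (c :+ e) (d :+ f) a b := :re c d a b :+ :re e f a b) refl
      distʳ-im : ∀ a b c d e f →
        mulIm (c ℚ.+ e) (d ℚ.+ f) a b ≡ mulIm c d a b ℚ.+ mulIm e f a b
      distʳ-im = solve 6 (λ a b c d e f →
        :im (c :+ e) (d :+ f) a b := :im c d a b :+ :im e f a b) refl
      comm-re : ∀ a b c d → mulRe a b c d ≡ mulRe c d a b
      comm-re = solve 4 (λ a b c d → :re a b c d := :re c d a b) refl
      comm-im : ∀ a b c d → mulIm a b c d ≡ mulIm c d a b
      comm-im = solve 4 (λ a b c d → :im a b c d := :im c d a b) refl

  ℂ-commutativeRing : CommutativeRing 0ℓ 0ℓ
  ℂ-commutativeRing = record { isCommutativeRing = ℂ-isCommutativeRing }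

open Complex
open import Algebra.Definitions.RawMonoid (CommutativeRing.+-rawMonoid ℂ-commutativeRing)
  using (sum)

------------------------------------------------------------------------

X : ℕ → Set
X D = Vec (Fin 2) D

Adjacent : ∀ {D} → X D → X D → Set
Adjacent {D} y z = ∃[ k ] lookup y k ≢ lookup z k ×
  (∀ (j : Fin D) → j ≢ k → lookup y j ≡ lookup z j)

adjacent? : ∀ {D} (y z : X D) → Dec (Adjacent y z)
adjacent? y z = Fin.any? λ k →
  ¬? (lookup y k Fin.≟ lookup z k) ×-dec
  Fin.all? λ j → ¬? (j Fin.≟ k) →-dec (lookup y j Fin.≟ lookup z j)

data Walk {D} : X D → X D → ℕ → Set where
  []  : ∀ {y} → Walk y y 0
  _∷_ : ∀ {y w z n} → Adjacent y w → Walk w z n → Walk y z (suc n)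

IsPathDistance : ∀ {D} → X D → X D → ℕ → Set
IsPathDistance y z n = Walk y z n × (∀ m → Walk y z m → n ℕ.≤ m)

module Hamming where

  hamming : ∀ {D} → X D → X D → ℕ
  hamming [] [] = 0
  hamming (a ∷ y) (b ∷ z) with a Fin.≟ b
  ... | yes _ = hamming y z
  ... | no  _ = suc (hamming y z)

  prefix : ∀ {D} a {y z : X D} {n} → Walk y z n → Walk (a ∷ y) (a ∷ z) n
  prefix a [] = []
  prefix a ((k , differ , agree) ∷ w) = (suc k , differ , agree′) ∷ prefix a w
    where
    agree′ : ∀ j → j ≢ suc k → _
    agree′ zero    _   = refl
    agree′ (suc j) j≢k = agree j (j≢k ∘ cong suc)

  shortest : ∀ {D} (y z : X D) → Walk y z (hamming y z)
  shortest [] [] = []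
  shortest (a ∷ y) (b ∷ z) with a Fin.≟ b
  ... | yes refl = prefix a (shortest y z)
  ... | no  a≢b  = (zero , a≢b , agree) ∷ prefix b (shortest y z)
    where
    agree : ∀ j → j ≢ zero → _
    agree zero    j≢0 = contradiction refl j≢0
    agree (suc j) _   = refl

  lookup-ext : ∀ {D} (y z : X D) → (∀ j → lookup y j ≡ lookup z j) → y ≡ z
  lookup-ext [] [] _ = refl
  lookup-ext (a ∷ y) (b ∷ z) eq = cong₂ _∷_ (eq zero) (lookup-ext y z (eq ∘ suc))

  hamming-step : ∀ {D} (y w z : X D) → Adjacent y w → hamming y z ℕ.≤ suc (hamming w z)
  hamming-step (a ∷ y) (b ∷ w) (c ∷ z) (zero , _ , agree)
    with refl ← lookup-ext y w (λ j → agree (suc j) λ ())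
    with a Fin.≟ c | b Fin.≟ c
  ... | yes _ | yes _ = ℕ.n≤1+n _
  ... | yes _ | no  _ = ℕ.m≤n⇒m≤1+n (ℕ.n≤1+n _)
  ... | no  _ | yes _ = ℕ.≤-refl
  ... | no  _ | no  _ = ℕ.n≤1+n _
  hamming-step (a ∷ y) (b ∷ w) (c ∷ z) (suc k , differ , agree)
    with refl ← agree zero (λ ())
    with a Fin.≟ c | hamming-step y w z
           (k , differ , λ j j≢k → agree (suc j) (j≢k ∘ Fin.suc-injective))
  ... | yes _ | p = p
  ... | no  _ | p = ℕ.s≤s p

  hamming-refl : ∀ {D} (y : X D) → hamming y y ≡ 0
  hamming-refl [] = refl
  hamming-refl (a ∷ y) with a Fin.≟ a
  ... | yes _ = hamming-refl y
  ... | no a≢a = contradiction refl a≢a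

  minimal : ∀ {D} {y z : X D} m → Walk y z m → hamming y z ℕ.≤ m
  minimal _ ([] {y}) = ℕ.≤-reflexive (hamming-refl y)
  minimal (suc m) (_∷_ {y} {w} {z} e p) =
    ℕ.≤-trans (hamming-step y w z e) (ℕ.s≤s (minimal m p))

open Hamming

-- The distance is computed as the number of coordinates that differ.
distance : ∀ {D} (y z : X D) → ∃ (IsPathDistance y z)
distance y z = hamming y z , shortest y z , minimal

∂ : ∀ {D} → X D → X D → ℕ
∂ y z = proj₁ (distance y z)

------------------------------------------------------------------------

V : ℕ → Set
V D = X D → ℂ

Mat : ℕ → Set
Mat D = X D → X D → ℂ

sumX : ∀ {D} → (X D → ℂ) → ℂ
sumX {zero}  f = f []
sumX {suc D} f = sum λ (a : Fin 2) → sumX λ y → f (a ∷ y)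

infix  4 _≈ᵥ_ _≈ₘ_
infixl 6 _+ᵥ_ _+ₘ_ _-ₘ_
infixr 7 _•ᵥ_ _•ₘ_ _*ᵥ_
infixl 7 _*ₘ_

_≈ᵥ_ : ∀ {D} → V D → V D → Set
u ≈ᵥ v = ∀ y → u y ≈ v y

Nonzero : ∀ {D} → V D → Set
Nonzero u = ∃[ y ] u y # 0ℂ

0ᵥ : ∀ {D} → V D
0ᵥ y = 0ℂ

_+ᵥ_ : ∀ {D} → V D → V D → V D
(u +ᵥ v) y = u y + v y

_•ᵥ_ : ∀ {D} → ℂ → V D → V D
(c •ᵥ v) y = c * v y

_≈ₘ_ : ∀ {D} → Mat D → Mat D → Set
M ≈ₘ N = ∀ y z → M y z ≈ N y z

I : ∀ {D} → Mat D
I y z = if does (≡-dec Fin._≟_ y z) then 1ℂ else 0ℂ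

_+ₘ_ : ∀ {D} → Mat D → Mat D → Mat D
(M +ₘ N) y z = M y z + N y z

_•ₘ_ : ∀ {D} → ℂ → Mat D → Mat D
(c •ₘ M) y z = c * M y z

_-ₘ_ : ∀ {D} → Mat D → Mat D → Mat D
(M -ₘ N) y z = M y z + - N y z

_*ₘ_ : ∀ {D} → Mat D → Mat D → Mat D
(M *ₘ N) y z = sumX λ w → M y w * N w z

_*ᵥ_ : ∀ {D} → Mat D → V D → V D
(M *ᵥ v) y = sumX λ z → M y z * v z

------------------------------------------------------------------------
-- The idempotents below are indexed by ℕ for convenience; only the indices
-- 0 ≤ i ≤ D are meaningful.

A : ∀ {D} → Mat D
A y z = if does (adjacent? y z) then 1ℂ else 0ℂ

origin : ∀ {D} → X D
origin = replicate _ 0F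

θℤ : ℕ → ℕ → ℤ
θℤ D i = + D ℤ.- + (2 ℕ.* i)

θ : ℕ → ℕ → ℚ
θ D i = fromℤ (θℤ D i)

A* : ∀ {D} → Mat D
A* {D} y z = if does (≡-dec Fin._≟_ y z) then fromℚ (θ D (∂ origin y)) else 0ℂ

data _∈T {D} : Mat D → Set where
  A∈T  : A ∈T
  A*∈T : A* ∈T
  I∈T  : I ∈T
  +∈T  : ∀ {M N} → M ∈T → N ∈T → (M +ₘ N) ∈T
  •∈T  : ∀ c {M} → M ∈T → (c •ₘ M) ∈T
  *∈T  : ∀ {M N} → M ∈T → N ∈T → (M *ₘ N) ∈T
  ≈∈T  : ∀ {M N} → M ≈ₘ N → M ∈T → N ∈T

θ-injective : ∀ D {i j} → θ D i ≡ θ D j → i ≡ j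
θ-injective D {i} {j} eq = ℕ.*-cancelˡ-≡ i j 2 (ℤ.+-injective (ℤ.neg-injective
  (∙-cancelˡ (+ D) (ℤ.- + (2 ℕ.* i)) (ℤ.- + (2 ℕ.* j)) (proj₁ (ℚ.mkℚ-injective eq)))))
  where open import Algebra.Properties.Group (CommutativeRing.+-group ℤ.+-*-commutativeRing)

θ-distinct : ∀ D {i j} → j ≢ i → ℚ.NonZero (θ D i ℚ.- θ D j)
θ-distinct D {i} {j} j≢i = ℚ.≢-nonZero λ eq →
  j≢i (sym (θ-injective D (x∙y⁻¹≈ε⇒x≈y (θ D i) (θ D j) eq)))
  where open import Algebra.Properties.Group (CommutativeRing.+-group ℚ.+-*-commutativeRing)

-- (A - θⱼ I) / (θᵢ - θⱼ), and I in the omitted position j = i of the product.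
factor : ∀ {D} → ℕ → ℕ → Mat D
factor {D} i j with j ℕ.≟ i
... | yes _  = I
... | no j≢i =
  fromℚ ((ℚ.1/ (θ D i ℚ.- θ D j)) {{θ-distinct D j≢i}}) •ₘ (A -ₘ (fromℚ (θ D j) •ₘ I))

E : ∀ {D} → ℕ → Mat D
E {D} i = foldr (λ j M → factor i j *ₘ M) I (upTo (suc D))

E* : ∀ {D} → ℕ → Mat D
E* i y z = if does (≡-dec Fin._≟_ y z) then
  (if does (∂ origin y ℕ.≟ i) then 1ℂ else 0ℂ) else 0ℂ

kroneckerPower : ∀ {D} → (Fin 2 → Fin 2 → ℂ) → Mat D
kroneckerPower M []      []      = 1ℂ
kroneckerPower M (a ∷ y) (b ∷ z) = M a b * kroneckerPower M y z

P₁ : Fin 2 → Fin 2 → ℂ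
P₁ 0F 0F = 1ℂ
P₁ 0F 1F = 1ℂ
P₁ 1F 0F = - 𝐢
P₁ 1F 1F = 𝐢

P₁⁻¹ : Fin 2 → Fin 2 → ℂ
P₁⁻¹ 0F 0F = fromℚ ½
P₁⁻¹ 0F 1F = fromℚ ½ * 𝐢
P₁⁻¹ 1F 0F = fromℚ ½
P₁⁻¹ 1F 1F = fromℚ ½ * - 𝐢

P P⁻¹ : ∀ {D} → Mat D
P   = kroneckerPower P₁
P⁻¹ = kroneckerPower P₁⁻¹

module KroneckerPower where
  open CommutativeRing ℂ-commutativeRing using
    (setoid; +-cong; *-cong; *-assoc; *-comm; *-congˡ; *-congʳ; distribˡ; distribʳ; zeroˡ; zeroʳ;
     *-identityˡ; +-identityʳ)
    renaming (refl to ≈-refl; sym to ≈-sym; trans to ≈-trans)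
  open import Relation.Binary.Reasoning.Setoid setoid
  open import Algebra.Properties.CommutativeSemigroup
    (CommutativeRing.*-commutativeSemigroup ℂ-commutativeRing) using (interchange)

  sumX-cong : ∀ {D} {f g : X D → ℂ} → (∀ y → f y ≈ g y) → sumX f ≈ sumX g
  sumX-cong {zero}  eq = eq []
  sumX-cong {suc D} eq = +-cong (sumX-cong λ y → eq (0F ∷ y))
    (+-cong (sumX-cong λ y → eq (1F ∷ y)) ≈-refl)

  *-sumX : ∀ {D} c (f : X D → ℂ) → sumX (λ y → c * f y) ≈ c * sumX f
  *-sumX {zero}  c f = ≈-refl
  *-sumX {suc D} c f = begin
    sumX (λ y → c * f (0F ∷ y)) + (sumX (λ y → c * f (1F ∷ y)) + 0ℂ)
      ≈⟨ +-cong (*-sumX c (f ∘ (0F ∷_)))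
           (+-cong (*-sumX c (f ∘ (1F ∷_))) (≈-sym (zeroʳ c))) ⟩
    c * s₀ + (c * s₁ + c * 0ℂ)
      ≈⟨ +-cong ≈-refl (≈-sym (distribˡ c s₁ 0ℂ)) ⟩
    c * s₀ + c * (s₁ + 0ℂ)
      ≈⟨ ≈-sym (distribˡ c s₀ (s₁ + 0ℂ)) ⟩
    c * (s₀ + (s₁ + 0ℂ)) ∎
    where
    s₀ = sumX (f ∘ (0F ∷_))
    s₁ = sumX (f ∘ (1F ∷_))

  δ : Fin 2 → Fin 2 → ℂ
  δ a b = if does (a Fin.≟ b) then 1ℂ else 0ℂ

  kronecker-inverse : ∀ {D} (M N : Fin 2 → Fin 2 → ℂ) →
    (∀ a b → sum (λ c → M a c * N c b) ≈ δ a b) →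
    kroneckerPower {D} M *ₘ kroneckerPower N ≈ₘ I
  kronecker-inverse M N MN≈δ [] [] = *-identityˡ 1ℂ
  kronecker-inverse {suc D} M N MN≈δ (a ∷ y) (b ∷ z) = begin
    sumX (λ w → (M a 0F * K w) * (N 0F b * L w)) +
      (sumX (λ w → (M a 1F * K w) * (N 1F b * L w)) + 0ℂ)
      ≈⟨ +-cong (term 0F) (+-cong (term 1F) (≈-sym (zeroˡ S))) ⟩
    m₀ * S + (m₁ * S + 0ℂ * S)
      ≈⟨ +-cong ≈-refl (≈-sym (distribʳ S m₁ 0ℂ)) ⟩
    m₀ * S + (m₁ + 0ℂ) * S
      ≈⟨ ≈-sym (distribʳ S m₀ (m₁ + 0ℂ)) ⟩
    (m₀ + (m₁ + 0ℂ)) * S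
      ≈⟨ *-cong (MN≈δ a b) (kronecker-inverse M N MN≈δ y z) ⟩
    δ a b * I y z
      ≈⟨ δ*I ⟩
    I (a ∷ y) (b ∷ z) ∎
    where
    K L : X D → ℂ
    K w = kroneckerPower M y w
    L w = kroneckerPower N w z
    S = sumX λ w → K w * L w
    m₀ = M a 0F * N 0F b
    m₁ = M a 1F * N 1F b
    term : ∀ c → sumX (λ w → (M a c * K w) * (N c b * L w)) ≈ (M a c * N c b) * S
    term c = ≈-trans (sumX-cong λ w → interchange (M a c) (K w) (N c b) (L w))
      (*-sumX (M a c * N c b) (λ w → K w * L w))
    δ*I : δ a b * I y z ≈ I (a ∷ y) (b ∷ z)
    δ*I with a Fin.≟ b | ≡-dec Fin._≟_ y z
    ... | yes _ | yes _ = *-identityˡ 1ℂ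
    ... | yes _ | no  _ = *-identityˡ 0ℂ
    ... | no  _ | yes _ = zeroˡ 1ℂ
    ... | no  _ | no  _ = zeroˡ 0ℂ

  opaque
    unfolding _≈_

    P₁-inverseʳ : ∀ a b → sum (λ c → P₁ a c * P₁⁻¹ c b) ≈ δ a b
    P₁-inverseʳ 0F 0F = pointwise {sum (λ c → P₁ 0F c * P₁⁻¹ c 0F)} {δ 0F 0F} (λ _ → refl) (λ _ → refl)
    P₁-inverseʳ 0F 1F = pointwise {sum (λ c → P₁ 0F c * P₁⁻¹ c 1F)} {δ 0F 1F} (λ _ → refl) (λ _ → refl)
    P₁-inverseʳ 1F 0F = pointwise {sum (λ c → P₁ 1F c * P₁⁻¹ c 0F)} {δ 1F 0F} (λ _ → refl) (λ _ → refl)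
    P₁-inverseʳ 1F 1F = pointwise {sum (λ c → P₁ 1F c * P₁⁻¹ c 1F)} {δ 1F 1F} (λ _ → refl) (λ _ → refl)

    P₁-inverseˡ : ∀ a b → sum (λ c → P₁⁻¹ a c * P₁ c b) ≈ δ a b
    P₁-inverseˡ 0F 0F = pointwise {sum (λ c → P₁⁻¹ 0F c * P₁ c 0F)} {δ 0F 0F} (λ _ → refl) (λ _ → refl)
    P₁-inverseˡ 0F 1F = pointwise {sum (λ c → P₁⁻¹ 0F c * P₁ c 1F)} {δ 0F 1F} (λ _ → refl) (λ _ → refl)
    P₁-inverseˡ 1F 0F = pointwise {sum (λ c → P₁⁻¹ 1F c * P₁ c 0F)} {δ 1F 0F} (λ _ → refl) (λ _ → refl)
    P₁-inverseˡ 1F 1F = pointwise {sum (λ c → P₁⁻¹ 1F c * P₁ c 1F)} {δ 1F 1F} (λ _ → refl) (λ _ → refl)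

  P-inverseʳ : ∀ {D} → P {D} *ₘ P⁻¹ ≈ₘ I
  P-inverseʳ = kronecker-inverse P₁ P₁⁻¹ P₁-inverseʳ

  P-inverseˡ : ∀ {D} → P⁻¹ {D} *ₘ P ≈ₘ I
  P-inverseˡ = kronecker-inverse P₁⁻¹ P₁ P₁-inverseˡ

open KroneckerPower using (P-inverseʳ; P-inverseˡ)

Eᵋ : ∀ {D} → ℕ → Mat D
Eᵋ i = (P⁻¹ *ₘ E i) *ₘ P

------------------------------------------------------------------------

record IsSubspace {D} (W : Pred (V D) 0ℓ) : Set where
  field
    resp     : ∀ {u v} → u ≈ᵥ v → u ∈ W → v ∈ W
    0-closed : 0ᵥ ∈ W
    +-closed : ∀ {u v} → u ∈ W → v ∈ W → (u +ᵥ v) ∈ W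
    •-closed : ∀ c {v} → v ∈ W → (c •ᵥ v) ∈ W

record IsTModule {D} (W : Pred (V D) 0ℓ) : Set where
  field
    isSubspace : IsSubspace W
    invariant  : ∀ {B} → B ∈T → ∀ {w} → w ∈ W → (B *ᵥ w) ∈ W

NonzeroSpace : ∀ {D} → Pred (V D) 0ℓ → Set
NonzeroSpace W = ∃[ w ] w ∈ W × Nonzero w

-- W ≠ 0, and a T-module U ⊆ W that is not 0 is W; "not 0" is witnessed by a
-- vector with an entry apart from 0.
record IsIrreducible {D} (W : Pred (V D) 0ℓ) : Set₁ where
  field
    isTModule : IsTModule W
    nonzero   : NonzeroSpace W
    simple    : ∀ (U : Pred (V D) 0ℓ) → IsTModule U → U ⊆ W → NonzeroSpace U → W ⊆ U

infix 8 _⟪_⟫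

_⟪_⟫ : ∀ {D} → Mat D → Pred (V D) 0ℓ → Pred (V D) 0ℓ
(B ⟪ W ⟫) v = ∃[ w ] w ∈ W × v ≈ᵥ B *ᵥ w

record IsEndpoint {D} (W : Pred (V D) 0ℓ) (r : ℕ) : Set where
  field
    inRange : r ℕ.≤ D
    nonzero : NonzeroSpace (E* r ⟪ W ⟫)
    least   : ∀ i → i ℕ.≤ D → NonzeroSpace (E* i ⟪ W ⟫) → r ℕ.≤ i

IsDiameter : ∀ {D} → Pred (V D) 0ℓ → ℕ → Set
IsDiameter {D} W d = ∃ λ (S : Subset (suc D)) →
  (∀ (i : Fin (suc D)) → i Subset.∈ S ⇔ NonzeroSpace (E* (toℕ i) ⟪ W ⟫)) × ∣ S ∣ ≡ suc d

record IsBasis {D n} (W : Pred (V D) 0ℓ) (b : Fin n → V D) : Set where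
  field
    inside      : ∀ k → b k ∈ W
    independent : ∀ (c : Fin n → ℂ) → (∀ y → sum (λ k → c k * b k y) ≈ 0ℂ) → ∀ k → c k ≈ 0ℂ
    spanning    : ∀ {w} → w ∈ W → ∃ λ (c : Fin n → ℂ) → ∀ y → w y ≈ sum (λ k → c k * b k y)

{-# OPTIONS --safe #-}

-- A, A* and A^ε satisfy [A,A*] = 2i A^ε and its cyclic shifts. Let (X,Y,Z) be a
-- permutation of them, with [X,Y] = 2cZ, c = ±i, and let u ∈ W be a nonzero
-- vector of X-eigenvalue d. As Y + cZ raises X-eigenvalues by 2 and r is minimal,
-- (Y + cZ)u = 0, so that (X + scZ)u = du − sYu for s = ±1. The operator X + scZ
-- shifts Y-eigenvalues by −2s, and comparing components gives, for the projection
-- u_i of u to the Y-eigenvalue θ_i = D − 2i,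
--   (X + cZ) u_{i-1} = (d − θ_i) u_i   and   (X − cZ) u_{i+1} = (d + θ_i) u_i.
-- Hence u_i = 0 outside r ≤ i ≤ r + d, the span of the u_i is a T-module, so it is
-- W by irreducibility, and a scalar killing one of u_r, …, u_{r+d} kills u.
module Submission where

open import Defs
open import Algebra.Bundles using (CommutativeRing; RawRing)
import Algebra.Solver.Ring
open import Algebra.Solver.Ring.AlmostCommutativeRing using
  (AlmostCommutativeRing; fromCommutativeRing; _-Raw-AlmostCommutative⟶_)
open import Data.Bool.Base using (if_then_else_)
open import Data.Fin.Base using (Fin; zero; suc; toℕ; fromℕ<)
open import Data.Fin.Patterns using (0F; 1F)
import Data.Fin.Properties as Fin
open import Data.Integer.Base as ℤ using (+_)
import Data.Integer.Properties as ℤ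
open import Data.List.Base using (List; []; _∷_; foldr; upTo)
open import Data.List.Membership.Propositional using () renaming (_∈_ to _∈ₗ_)
open import Data.List.Membership.Propositional.Properties using (∈-upTo⁺)
open import Data.List.Relation.Unary.Any using (here; there)
open import Data.Maybe.Base using (Maybe; just; nothing)
open import Data.Nat.Base as ℕ using (ℕ; zero; suc)
import Data.Nat.Properties as ℕ
open import Data.Product.Base using (∃; ∃-syntax; _×_; _,_; proj₁; proj₂)
open import Data.Rational.Base as ℚ using (ℚ; 0ℚ; 1ℚ; ½)
open import Data.Rational.Literals using (fromℤ)
import Data.Rational.Properties as ℚ
open import Data.Rational.Solver using (module +-*-Solver)
import Data.Rational.Unnormalised.Base as ℚᵘ
import Data.Rational.Unnormalised.Properties as ℚᵘ
open import Data.Sum.Base using (inj₁; inj₂)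
open import Data.Vec.Base using ([]; _∷_)
open import Data.Vec.Properties using (≡-dec; ∷-injectiveʳ)
open import Function.Base using (_∘_)
open import Function.Bundles using (mk⇔)
open import Level using (0ℓ)
open import Relation.Binary.Bundles using (Setoid)
open import Relation.Binary.PropositionalEquality using
  (_≡_; _≢_; refl; sym; trans; cong; cong₂; subst)
import Relation.Binary.Reasoning.Setoid as SetoidReasoning
open import Relation.Nullary using (yes; no; contradiction; does)
open import Relation.Nullary.Decidable using (does-⇔; dec-true; dec-false)
open import Relation.Unary using (Pred; _∈_; _⊆_)

-- Minimality of r speaks of E* alone, whereas the argument for u in E_r W or in A^ε's eigenspace
-- needs the projections E_i, resp. E^ε_i, to vanish on W for i < r. Part (ii) therefore comes
-- before (i) and (iii): applied to one nonzero vector of E*_r W, it spans W by E-components, and by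
-- E^ε-components, of index at least r, which gives the missing vanishing. One argument serves all
-- six bases because the relations are invariant under cyclic shifts, and exchanging two operators
-- only replaces c by -c. The relations and the spectral decompositions come from 2 by 2 matrices:
-- A, A* and A^ε are the actions by derivations of Pauli matrices on the D-th tensor power of ℂ².
-- Scalars are pairs of Cauchy sequences, and equality with 0 is not decided. A nonzero coefficient
-- is therefore one that can be cancelled, and independence is obtained by carrying an annihilating
-- scalar along the chain of components instead of showing that each component has a nonzero entry.

-- Complex scalars: cancellation and integer arithmetic

module Scalars where
  open Complex
  open +-*-Solver using () renaming
    (solve to solveℚ; _:=_ to _:=ℚ_; _:+_ to _:+ℚ_; _:*_ to _:*ℚ_; :-_ to :-ℚ_; con to conℚ)
  open CommutativeRing ℂ-commutativeRing public using
      (setoid; +-cong; *-cong; *-assoc; *-comm; *-congˡ; *-congʳ; +-congˡ; +-congʳ;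
       distribˡ; distribʳ; zeroˡ; zeroʳ;
       *-identityˡ; *-identityʳ; +-identityʳ; +-identityˡ; -‿cong; -‿inverseʳ)
      renaming (refl to ≈-refl; sym to ≈-sym; trans to ≈-trans; reflexive to ≈-reflexive)

  opaque
    unfolding _≈_

    fromℚ-+ : ∀ p q → fromℚ (p ℚ.+ q) ≈ fromℚ p + fromℚ q
    fromℚ-+ p q = pointwise {fromℚ (p ℚ.+ q)} {fromℚ p + fromℚ q} (λ _ → refl) (λ _ → refl)

    fromℚ-* : ∀ p q → fromℚ (p ℚ.* q) ≈ fromℚ p * fromℚ q
    fromℚ-* p q = pointwise {fromℚ (p ℚ.* q)} {fromℚ p * fromℚ q}
      (λ _ → sym (ℚ.+-identityʳ (p ℚ.* q)))
      (λ _ → sym (cong₂ ℚ._+_ (ℚ.*-zeroʳ p) (ℚ.*-zeroˡ q)))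

    fromℚ-neg : ∀ p → fromℚ (ℚ.- p) ≈ - fromℚ p
    fromℚ-neg p = pointwise {fromℚ (ℚ.- p)} { - fromℚ p} (λ _ → refl) (λ _ → refl)

    𝐢*𝐢 : 𝐢 * 𝐢 ≈ - 1ℂ
    𝐢*𝐢 = pointwise {𝐢 * 𝐢} { - 1ℂ} (λ _ → refl) (λ _ → refl)

  ℂ-ring : AlmostCommutativeRing _ _
  ℂ-ring = fromCommutativeRing ℂ-commutativeRing

  ℚ-rawRing : RawRing _ _
  ℚ-rawRing = CommutativeRing.rawRing ℚ.+-*-commutativeRing

  fromℚ-morphism : ℚ-rawRing -Raw-AlmostCommutative⟶ ℂ-ring
  fromℚ-morphism = record
    { ⟦_⟧    = fromℚ
    ; +-homo = fromℚ-+
    ; *-homo = fromℚ-*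
    ; -‿homo = fromℚ-neg
    ; 0-homo = ≈-refl
    ; 1-homo = ≈-refl
    }

  -- Equality in ℂ has no decision procedure, so the ring solver takes rational coefficients and
  -- compares those; this also admits `½` in the identities.
  fromℚ-≟ : ∀ p q → Maybe (fromℚ p ≈ fromℚ q)
  fromℚ-≟ p q with p ℚ.≟ q
  ... | yes p≡q = just (≈-reflexive (cong fromℚ p≡q))
  ... | no  _   = nothing

  module ℂ-Solver = Algebra.Solver.Ring ℚ-rawRing ℂ-ring fromℚ-morphism fromℚ-≟

  open ℂ-Solver public using (solve; _:=_; _:+_; _:*_; _:-_; :-_; con)

  square≡∣∣² : ∀ p → p ℚ.* p ≡ ℚ.∣ p ∣ ℚ.* ℚ.∣ p ∣
  square≡∣∣² p with ℚ.∣p∣≡p∨∣p∣≡-p p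
  ... | inj₁ eq = sym (cong₂ ℚ._*_ eq eq)
  ... | inj₂ eq = trans (solveℚ 1 (λ p → p :*ℚ p :=ℚ (:-ℚ p) :*ℚ (:-ℚ p)) refl p) (sym (cong₂ ℚ._*_ eq eq))

  0≤square : ∀ p → 0ℚ ℚ.≤ p ℚ.* p
  0≤square p = subst (0ℚ ℚ.≤_) (sym (square≡∣∣² p))
    (ℚ.nonNegative⁻¹ _ {{ℚ.nonNeg*nonNeg⇒nonNeg ℚ.∣ p ∣ {{ℚ.∣-∣-nonNeg p}} ℚ.∣ p ∣ {{ℚ.∣-∣-nonNeg p}}}})

  square-mono : ∀ {δ p} → 0ℚ ℚ.< δ → δ ℚ.≤ ℚ.∣ p ∣ → δ ℚ.* δ ℚ.≤ p ℚ.* p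
  square-mono {δ} {p} 0<δ δ≤∣p∣ = subst (δ ℚ.* δ ℚ.≤_) (sym (square≡∣∣² p)) (ℚ.≤-trans
    (ℚ.*-monoˡ-≤-nonNeg δ {{ℚ.nonNegative (ℚ.<⇒≤ 0<δ)}} δ≤∣p∣)
    (ℚ.*-monoʳ-≤-nonNeg ℚ.∣ p ∣ {{ℚ.∣-∣-nonNeg p}} δ≤∣p∣))

  -- Eventually |s n| η ≤ |s n · t n|, so the tolerance ε η for the product gives ε for s. No
  -- reciprocal of the sequence t is formed.
  null-cancel : ∀ {s t : ℕ → ℚ} {η} → 0ℚ ℚ.< η → (∃[ N ] ∀ n → N ℕ.≤ n → η ℚ.≤ t n) →
    Null (λ n → s n ℚ.* t n) → Null s
  null-cancel {s} {t} {η} 0<η (N , η≤t) null ε 0<ε = N ℕ.⊔ M , small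
    where
    instance
      η-pos : ℚ.Positive η
      η-pos = ℚ.positive 0<η
    0<εη : 0ℚ ℚ.< ε ℚ.* η
    0<εη = subst (ℚ._< ε ℚ.* η) (ℚ.*-zeroˡ η) (ℚ.*-monoˡ-<-pos η 0<ε)
    M = proj₁ (null (ε ℚ.* η) 0<εη)
    small : ∀ n → N ℕ.⊔ M ℕ.≤ n → ℚ.∣ s n ∣ ℚ.< ε
    small n h = ℚ.*-cancelʳ-<-nonNeg η {{ℚ.pos⇒nonNeg η}} (begin-strict
      ℚ.∣ s n ∣ ℚ.* η            ≤⟨ ℚ.*-monoˡ-≤-nonNeg ℚ.∣ s n ∣ {{ℚ.∣-∣-nonNeg (s n)}}
                                     (η≤t n (ℕ.m⊔n≤o⇒m≤o N M h)) ⟩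
      ℚ.∣ s n ∣ ℚ.* t n          ≡⟨ cong (ℚ.∣ s n ∣ ℚ.*_) (ℚ.0≤p⇒∣p∣≡p (ℚ.≤-trans (ℚ.<⇒≤ 0<η)
                                     (η≤t n (ℕ.m⊔n≤o⇒m≤o N M h)))) ⟨
      ℚ.∣ s n ∣ ℚ.* ℚ.∣ t n ∣    ≡⟨ ℚ.∣p*q∣≡∣p∣*∣q∣ (s n) (t n) ⟨
      ℚ.∣ s n ℚ.* t n ∣          <⟨ proj₂ (null (ε ℚ.* η) 0<εη) n (ℕ.m⊔n≤o⇒n≤o N M h) ⟩
      ε ℚ.* η                    ∎)
      where open ℚ.≤-Reasoning

  -- Stands in for "x is nonzero": it follows from apartness, passes along `≈` and is all that is
  -- asked of a coefficient.
  Cancellable : ℂ → Set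
  Cancellable x = ∀ {c} → c * x ≈ 0ℂ → c ≈ 0ℂ

  opaque
    unfolding _≈_ _*_ _#_

    -- Multiplying c x by the conjugate of x turns the factor x into the real
    -- sequence |x|², which is bounded away from 0.
    #0⇒cancellable : ∀ {x} → x # 0ℂ → Cancellable x
    #0⇒cancellable {x} x#0 {c} cx≈0 =
      null-resp a (null-cancel {a} {N} 0<δ² far (λ ε 0<ε → let M , h = proj₁ prod ε 0<ε in
        M , λ n M≤n → subst (λ t → ℚ.∣ t ∣ ℚ.< ε) (re-identity (a n) (b n) (e n) (f n)) (h n M≤n))) ,
      null-resp b (null-cancel {b} {N} 0<δ² far (λ ε 0<ε → let M , h = proj₂ prod ε 0<ε in
        M , λ n M≤n → subst (λ t → ℚ.∣ t ∣ ℚ.< ε) (im-identity (a n) (b n) (e n) (f n)) (h n M≤n)))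
      where
      a b e f N : ℕ → ℚ
      a = seq (re c)
      b = seq (im c)
      e = seq (re x)
      f = seq (im x)
      N n = e n ℚ.* e n ℚ.+ f n ℚ.* f n
      conj : ℂ
      conj = re x +i (Real.- im x)
      prod : (c * x) * conj ≈ 0ℂ
      prod = ≈-trans {(c * x) * conj} {0ℂ * conj} {0ℂ} (*-congʳ {conj} {c * x} {0ℂ} cx≈0) (zeroˡ conj)
      null-resp : ∀ s → Null s → Null (λ n → s n ℚ.- 0ℚ)
      null-resp s h ε 0<ε = let M , p = h ε 0<ε in
        M , λ n M≤n → subst (λ t → ℚ.∣ t ∣ ℚ.< ε) (sym (ℚ.+-identityʳ (s n))) (p n M≤n)
      re-identity : ∀ a b e f →
        ((a ℚ.* e ℚ.+ ℚ.- (b ℚ.* f)) ℚ.* e ℚ.+ ℚ.- ((a ℚ.* f ℚ.+ b ℚ.* e) ℚ.* (ℚ.- f))) ℚ.- 0ℚ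
        ≡ a ℚ.* (e ℚ.* e ℚ.+ f ℚ.* f)
      re-identity = solveℚ 4 (λ a b e f →
        ((a :*ℚ e :+ℚ :-ℚ (b :*ℚ f)) :*ℚ e :+ℚ :-ℚ ((a :*ℚ f :+ℚ b :*ℚ e) :*ℚ (:-ℚ f))) :+ℚ :-ℚ conℚ 0ℚ
        :=ℚ a :*ℚ (e :*ℚ e :+ℚ f :*ℚ f)) refl
      im-identity : ∀ a b e f →
        ((a ℚ.* e ℚ.+ ℚ.- (b ℚ.* f)) ℚ.* (ℚ.- f) ℚ.+ (a ℚ.* f ℚ.+ b ℚ.* e) ℚ.* e) ℚ.- 0ℚ
        ≡ b ℚ.* (e ℚ.* e ℚ.+ f ℚ.* f)
      im-identity = solveℚ 4 (λ a b e f →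
        ((a :*ℚ e :+ℚ :-ℚ (b :*ℚ f)) :*ℚ (:-ℚ f) :+ℚ (a :*ℚ f :+ℚ b :*ℚ e) :*ℚ e) :+ℚ :-ℚ conℚ 0ℚ
        :=ℚ b :*ℚ (e :*ℚ e :+ℚ f :*ℚ f)) refl
      away : x # 0ℂ → ∃[ δ ] 0ℚ ℚ.< δ × ∃[ M ] ∀ n → M ℕ.≤ n → δ ℚ.* δ ℚ.≤ N n
      away (inj₁ (δ , 0<δ , M , h)) = δ , 0<δ , M , λ n M≤n →
        ℚ.≤-trans (square-mono 0<δ (subst (λ t → δ ℚ.≤ ℚ.∣ t ∣) (ℚ.+-identityʳ (e n)) (h n M≤n)))
          (subst (ℚ._≤ N n) (ℚ.+-identityʳ (e n ℚ.* e n)) (ℚ.+-monoʳ-≤ (e n ℚ.* e n) (0≤square (f n))))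
      away (inj₂ (δ , 0<δ , M , h)) = δ , 0<δ , M , λ n M≤n →
        ℚ.≤-trans (square-mono 0<δ (subst (λ t → δ ℚ.≤ ℚ.∣ t ∣) (ℚ.+-identityʳ (f n)) (h n M≤n)))
          (subst (ℚ._≤ N n) (ℚ.+-identityˡ (f n ℚ.* f n)) (ℚ.+-monoˡ-≤ (f n ℚ.* f n) (0≤square (e n))))
      δ : ℚ
      δ = proj₁ (away x#0)
      far : ∃[ M ] ∀ n → M ℕ.≤ n → δ ℚ.* δ ℚ.≤ N n
      far = proj₂ (proj₂ (away x#0))
      0<δ² : 0ℚ ℚ.< δ ℚ.* δ
      0<δ² = ℚ.positive⁻¹ (δ ℚ.* δ) {{ℚ.pos*pos⇒pos δ {{pos}} δ {{pos}}}}
        where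
        pos : ℚ.Positive δ
        pos = ℚ.positive (proj₁ (proj₂ (away x#0)))

  open import Relation.Binary.Reasoning.Setoid setoid

  fromℚ-cancel : ∀ q .{{_ : ℚ.NonZero q}} → Cancellable (fromℚ q)
  fromℚ-cancel q {c} cq≈0 = begin
    c                              ≈⟨ *-identityʳ c ⟨
    c * 1ℂ                         ≈⟨ *-congˡ (≈-reflexive (cong fromℚ (ℚ.*-inverseʳ q))) ⟨
    c * fromℚ (q ℚ.* ℚ.1/ q)       ≈⟨ *-congˡ (fromℚ-* q (ℚ.1/ q)) ⟩
    c * (fromℚ q * fromℚ (ℚ.1/ q)) ≈⟨ *-assoc c (fromℚ q) (fromℚ (ℚ.1/ q)) ⟨
    (c * fromℚ q) * fromℚ (ℚ.1/ q) ≈⟨ *-congʳ cq≈0 ⟩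
    0ℂ * fromℚ (ℚ.1/ q)            ≈⟨ zeroˡ (fromℚ (ℚ.1/ q)) ⟩
    0ℂ                             ∎

  -- Addition in ℚ normalises by a gcd and does not compute on variables; on unnormalised rationals
  -- both denominators are 1 and cross-multiplication remains.
  fromℤ-+ : ∀ a b → fromℤ (a ℤ.+ b) ≡ fromℤ a ℚ.+ fromℤ b
  fromℤ-+ a b = ℚ.toℚᵘ-injective (ℚᵘ.≃-trans
    (ℚᵘ.*≡* (cong (ℤ._* (+ 1)) (sym (cong₂ ℤ._+_ (ℤ.*-identityʳ a) (ℤ.*-identityʳ b)))))
    (ℚᵘ.≃-sym (ℚ.toℚᵘ-homo-+ (fromℤ a) (fromℤ b))))

  fromℤ-neg : ∀ a → fromℤ (ℤ.- a) ≡ ℚ.- fromℤ a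
  fromℤ-neg a = ℚ.toℚᵘ-injective (ℚᵘ.≃-sym (ℚ.toℚᵘ-homo‿- (fromℤ a)))

  nat : ℕ → ℂ
  nat n = fromℚ (fromℤ (+ n))

  nat-+ : ∀ m n → nat (m ℕ.+ n) ≈ nat m + nat n
  nat-+ m n = ≈-trans (≈-reflexive (cong fromℚ (fromℤ-+ (+ m) (+ n))))
    (fromℚ-+ (fromℤ (+ m)) (fromℤ (+ n)))

  nat-suc : ∀ n → nat (suc n) ≈ 1ℂ + nat n
  nat-suc = nat-+ 1

  nat-cancel : ∀ n → Cancellable (nat (suc n))
  nat-cancel n = fromℚ-cancel (fromℤ (+ suc n))

  θℂ : ℕ → ℕ → ℂ
  θℂ D i = fromℚ (θ D i)

  -- Makes eigenvalues polynomials in the atoms `nat D` and `nat i`, so that comparing them is left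
  -- to the ring solver.
  θℂ≈ : ∀ D i → θℂ D i ≈ nat D + - (nat i + nat i)
  θℂ≈ D i = begin
    fromℚ (fromℤ (+ D ℤ.- + (2 ℕ.* i)))
      ≡⟨ cong fromℚ (fromℤ-+ (+ D) (ℤ.- + (2 ℕ.* i))) ⟩
    fromℚ (fromℤ (+ D) ℚ.+ fromℤ (ℤ.- + (2 ℕ.* i)))
      ≈⟨ fromℚ-+ _ _ ⟩
    nat D + fromℚ (fromℤ (ℤ.- + (2 ℕ.* i)))
      ≈⟨ +-congˡ (≈-trans (≈-reflexive (cong fromℚ (fromℤ-neg (+ (2 ℕ.* i))))) (fromℚ-neg _)) ⟩
    nat D + - nat (i ℕ.+ (i ℕ.+ 0))
      ≈⟨ +-congˡ (-‿cong (≈-trans (nat-+ i (i ℕ.+ 0))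
           (+-congˡ (≈-reflexive (cong nat (ℕ.+-identityʳ i)))))) ⟩
    nat D + - (nat i + nat i) ∎

  θℂ-distinct : ∀ D {i j} → j ≢ i → Cancellable (θℂ D i + - θℂ D j)
  θℂ-distinct D {i} {j} j≢i {c} eq = fromℚ-cancel (θ D i ℚ.- θ D j) {{θ-distinct D j≢i}}
    (≈-trans (*-congˡ (≈-trans (fromℚ-+ (θ D i) (ℚ.- θ D j)) (+-congˡ (fromℚ-neg (θ D j))))) eq)

-- Sums, linear operators, invariant subspaces and spans

module LinearAlgebra where
  open Scalars
  open Complex
  open KroneckerPower using (sumX-cong; *-sumX)
  open import Relation.Binary.Reasoning.Setoid setoid
  open import Algebra.Properties.Semiring.Sum (CommutativeRing.semiring ℂ-commutativeRing) public
    using (sum; sum-cong-≋; sum-replicate-zero; ∑-distrib-+; *-distribˡ-sum)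

  sum-zero : ∀ {n} (f : Fin n → ℂ) → (∀ j → f j ≈ 0ℂ) → sum f ≈ 0ℂ
  sum-zero {n} f f≈0 = ≈-trans (sum-cong-≋ f≈0) (sum-replicate-zero n)

  sum-single : ∀ {n} (f : Fin n → ℂ) k → (∀ j → j ≢ k → f j ≈ 0ℂ) → sum f ≈ f k
  sum-single f zero f≈0 =
    ≈-trans (+-congˡ (sum-zero (f ∘ suc) λ j → f≈0 (suc j) λ ())) (+-identityʳ (f zero))
  sum-single f (suc k) f≈0 = ≈-trans
    (+-cong (f≈0 zero λ ()) (sum-single (f ∘ suc) k λ j j≢k → f≈0 (suc j) (j≢k ∘ Fin.suc-injective)))
    (+-identityˡ (f (suc k)))

  sumX-+ : ∀ {D} (f g : X D → ℂ) → sumX (λ y → f y + g y) ≈ sumX f + sumX g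
  sumX-+ {zero}  f g = ≈-refl
  sumX-+ {suc D} f g = ≈-trans
    (+-cong (sumX-+ (f ∘ (0F ∷_)) (g ∘ (0F ∷_))) (+-congʳ (sumX-+ (f ∘ (1F ∷_)) (g ∘ (1F ∷_)))))
    (solve 4 (λ a b c d → (a :+ b) :+ ((c :+ d) :+ con 0ℚ) :=
       (a :+ (c :+ con 0ℚ)) :+ (b :+ (d :+ con 0ℚ))) ≈-refl _ _ _ _)

  sumX-zero : ∀ {D} (f : X D → ℂ) → (∀ y → f y ≈ 0ℂ) → sumX f ≈ 0ℂ
  sumX-zero {zero}  f f≈0 = f≈0 []
  sumX-zero {suc D} f f≈0 = ≈-trans
    (+-cong (sumX-zero _ λ y → f≈0 (0F ∷ y)) (+-congʳ (sumX-zero _ λ y → f≈0 (1F ∷ y))))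
    (solve 0 (con 0ℚ :+ (con 0ℚ :+ con 0ℚ) := con 0ℚ) ≈-refl)

  sumX-single : ∀ {D} (f : X D → ℂ) y → (∀ z → z ≢ y → f z ≈ 0ℂ) → sumX f ≈ f y
  sumX-single f [] f≈0 = ≈-refl
  sumX-single f (0F ∷ y) f≈0 = ≈-trans
    (+-cong (sumX-single _ y λ z z≢y → f≈0 (0F ∷ z) (z≢y ∘ ∷-injectiveʳ))
            (+-congʳ (sumX-zero _ λ z → f≈0 (1F ∷ z) λ ())))
    (solve 1 (λ a → a :+ (con 0ℚ :+ con 0ℚ) := a) ≈-refl _)
  sumX-single f (1F ∷ y) f≈0 = ≈-trans
    (+-cong (sumX-zero _ λ z → f≈0 (0F ∷ z) λ ())
            (+-congʳ (sumX-single _ y λ z z≢y → f≈0 (1F ∷ z) (z≢y ∘ ∷-injectiveʳ))))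
    (solve 1 (λ a → con 0ℚ :+ (a :+ con 0ℚ) := a) ≈-refl _)

  sumX-comm : ∀ {D D′} (f : X D → X D′ → ℂ) →
    sumX (λ y → sumX (f y)) ≈ sumX (λ z → sumX (λ y → f y z))
  sumX-comm {zero}  f = ≈-refl
  sumX-comm {suc D} {D′} f = begin
    sumX (λ y → sumX (f (0F ∷ y))) + (sumX (λ y → sumX (f (1F ∷ y))) + 0ℂ)
      -- A sum over `Fin 2` ends in `0ℂ`; this summand too has to become a sum over the other index
      -- before the sums are merged.
      ≈⟨ +-cong (sumX-comm (f ∘ (0F ∷_)))
           (+-cong (sumX-comm (f ∘ (1F ∷_))) (≈-sym (sumX-zero {D′} _ λ _ → ≈-refl))) ⟩
    sumX g₀ + (sumX g₁ + sumX {D′} (λ _ → 0ℂ))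
      ≈⟨ +-congˡ (sumX-+ {D′} g₁ (λ _ → 0ℂ)) ⟨
    sumX g₀ + sumX (λ z → g₁ z + 0ℂ)
      ≈⟨ sumX-+ g₀ (λ z → g₁ z + 0ℂ) ⟨
    sumX (λ z → g₀ z + (g₁ z + 0ℂ)) ∎
    where
    g₀ g₁ : _ → ℂ
    g₀ z = sumX (λ y → f (0F ∷ y) z)
    g₁ z = sumX (λ y → f (1F ∷ y) z)

  ≈ᵥ-setoid : ℕ → Setoid 0ℓ 0ℓ
  ≈ᵥ-setoid D = record
    { Carrier       = V D
    ; _≈_           = _≈ᵥ_
    ; isEquivalence = record
      { refl  = λ _ → ≈-refl
      ; sym   = λ p y → ≈-sym (p y)
      ; trans = λ p q y → ≈-trans (p y) (q y)
      }
    }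

  module ≈ᵥ-Reasoning {D} = SetoidReasoning (≈ᵥ-setoid D)

  symᵥ : ∀ {D} {u v : V D} → u ≈ᵥ v → v ≈ᵥ u
  symᵥ p y = ≈-sym (p y)

  transᵥ : ∀ {D} {u v w : V D} → u ≈ᵥ v → v ≈ᵥ w → u ≈ᵥ w
  transᵥ p q y = ≈-trans (p y) (q y)

  -- Operators are functions rather than matrices, so that derivations, shifts and conjugated
  -- projections are on the same footing as matrix actions.
  record Linear {D} (f : V D → V D) : Set where
    field
      ᵥ-cong : ∀ {u v} → u ≈ᵥ v → f u ≈ᵥ f v
      +-hom  : ∀ u v → f (u +ᵥ v) ≈ᵥ f u +ᵥ f v
      •-hom  : ∀ c v → f (c •ᵥ v) ≈ᵥ c •ᵥ f v

    0-hom : f 0ᵥ ≈ᵥ 0ᵥ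
    0-hom y = ≈-trans (ᵥ-cong {0ᵥ} {0ℂ •ᵥ 0ᵥ} (λ z → ≈-sym (zeroˡ 0ℂ)) y)
      (≈-trans (•-hom 0ℂ 0ᵥ y) (zeroˡ (f 0ᵥ y)))

    zero-hom : ∀ {v} → v ≈ᵥ 0ᵥ → f v ≈ᵥ 0ᵥ
    zero-hom v≈0 y = ≈-trans (ᵥ-cong v≈0 y) (0-hom y)

    sum-hom : ∀ {n} (b : Fin n → V D) → f (λ y → sum λ k → b k y) ≈ᵥ λ y → sum λ k → f (b k) y
    sum-hom {zero}  b y = 0-hom y
    sum-hom {suc n} b y = ≈-trans (+-hom (b zero) (λ y → sum λ k → b (suc k) y) y)
      (+-congˡ (sum-hom (b ∘ suc) y))

  open Linear public

  module _ {D : ℕ} where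

    *ᵥ-linear : (M : Mat D) → Linear (M *ᵥ_)
    *ᵥ-linear M = record
      { ᵥ-cong = λ u≈v y → sumX-cong {D} λ z → *-congˡ (u≈v z)
      ; +-hom  = λ u v y → ≈-trans (sumX-cong {D} λ z → distribˡ (M y z) (u z) (v z)) (sumX-+ {D} _ _)
      ; •-hom  = λ c v y → ≈-trans
          (sumX-cong {D} λ z → solve 3 (λ m c v → m :* (c :* v) := c :* (m :* v)) ≈-refl (M y z) c (v z))
          (*-sumX {D} c _)
      }

    *ᵥ-congˡ : ∀ {M N : Mat D} → M ≈ₘ N → ∀ v → M *ᵥ v ≈ᵥ N *ᵥ v
    *ᵥ-congˡ M≈N v y = sumX-cong {D} λ z → *-congʳ (M≈N y z)

    +ₘ-*ᵥ : ∀ (M N : Mat D) v → (M +ₘ N) *ᵥ v ≈ᵥ M *ᵥ v +ᵥ N *ᵥ v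
    +ₘ-*ᵥ M N v y = ≈-trans (sumX-cong {D} λ z → distribʳ (v z) (M y z) (N y z)) (sumX-+ {D} _ _)

    •ₘ-*ᵥ : ∀ c (M : Mat D) v → (c •ₘ M) *ᵥ v ≈ᵥ c •ᵥ (M *ᵥ v)
    •ₘ-*ᵥ c M v y = ≈-trans (sumX-cong {D} λ z → *-assoc c (M y z) (v z)) (*-sumX {D} c _)

    -ₘ-*ᵥ : ∀ (M N : Mat D) v y → ((M -ₘ N) *ᵥ v) y ≈ (M *ᵥ v) y + - (N *ᵥ v) y
    -ₘ-*ᵥ M N v y = begin
      sumX (λ z → (M y z + - N y z) * v z)
        ≈⟨ sumX-cong {D} (λ z → solve 3 (λ m n v → (m :+ :- n) :* v := m :* v :+ con (ℚ.- 1ℚ) :* (n :* v))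
             ≈-refl (M y z) (N y z) (v z)) ⟩
      sumX (λ z → M y z * v z + fromℚ (ℚ.- 1ℚ) * (N y z * v z))
        ≈⟨ sumX-+ {D} _ _ ⟩
      (M *ᵥ v) y + sumX (λ z → fromℚ (ℚ.- 1ℚ) * (N y z * v z))
        ≈⟨ +-congˡ (*-sumX {D} _ _) ⟩
      (M *ᵥ v) y + fromℚ (ℚ.- 1ℚ) * (N *ᵥ v) y
        ≈⟨ solve 2 (λ a b → a :+ con (ℚ.- 1ℚ) :* b := a :+ :- b) ≈-refl _ _ ⟩
      (M *ᵥ v) y + - (N *ᵥ v) y ∎

    *ₘ-*ᵥ : ∀ (M N : Mat D) v → (M *ₘ N) *ᵥ v ≈ᵥ M *ᵥ (N *ᵥ v)
    *ₘ-*ᵥ M N v y = begin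
      sumX (λ z → sumX (λ w → M y w * N w z) * v z)
        ≈⟨ sumX-cong {D} (λ z → ≈-trans (*-comm _ (v z)) (≈-sym (*-sumX {D} (v z) _))) ⟩
      sumX (λ z → sumX (λ w → v z * (M y w * N w z)))
        ≈⟨ sumX-comm {D} {D} (λ z w → v z * (M y w * N w z)) ⟩
      sumX (λ w → sumX (λ z → v z * (M y w * N w z)))
        ≈⟨ sumX-cong {D} (λ w → ≈-trans
             (sumX-cong {D} λ z → solve 3 (λ v m n → v :* (m :* n) := m :* (n :* v)) ≈-refl
               (v z) (M y w) (N w z))
             (*-sumX {D} (M y w) _)) ⟩
      sumX (λ w → M y w * (N *ᵥ v) w) ∎

    diagonal-*ᵥ : ∀ (f : X D → ℂ) v y →
      ((λ y z → if does (≡-dec Fin._≟_ y z) then f y else 0ℂ) *ᵥ v) y ≈ f y * v y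
    diagonal-*ᵥ f v y = ≈-trans (sumX-single {D} _ y off) on
      where
      off : ∀ z → z ≢ y → (if does (≡-dec Fin._≟_ y z) then f y else 0ℂ) * v z ≈ 0ℂ
      off z z≢y with ≡-dec Fin._≟_ y z
      ... | yes y≡z = contradiction (sym y≡z) z≢y
      ... | no _    = zeroˡ (v z)
      on : (if does (≡-dec Fin._≟_ y y) then f y else 0ℂ) * v y ≈ f y * v y
      on with ≡-dec Fin._≟_ y y
      ... | yes _  = ≈-refl
      ... | no y≢y = contradiction refl y≢y

    I-*ᵥ : ∀ (v : V D) → I *ᵥ v ≈ᵥ v
    I-*ᵥ v y = ≈-trans (diagonal-*ᵥ (λ _ → 1ℂ) v y) (*-identityˡ (v y))

    Stable : Pred (V D) 0ℓ → (V D → V D) → Set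
    Stable W f = ∀ {w} → w ∈ W → f w ∈ W

    stable⇒TModule : ∀ {W : Pred (V D) 0ℓ} → IsSubspace W → Stable W (A *ᵥ_) → Stable W (A* *ᵥ_) →
      IsTModule W
    stable⇒TModule {W} sub stableA stableA* = record { isSubspace = sub ; invariant = invariant }
      where
      open IsSubspace sub
      invariant : ∀ {B} → B ∈T → ∀ {w} → w ∈ W → (B *ᵥ w) ∈ W
      invariant A∈T w∈W = stableA w∈W
      invariant A*∈T w∈W = stableA* w∈W
      invariant I∈T {w} w∈W = resp (λ y → ≈-sym (I-*ᵥ w y)) w∈W
      invariant (+∈T {M} {N} p q) {w} w∈W =
        resp (λ y → ≈-sym (+ₘ-*ᵥ M N w y)) (+-closed (invariant p w∈W) (invariant q w∈W))
      invariant (•∈T c {M} p) {w} w∈W =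
        resp (λ y → ≈-sym (•ₘ-*ᵥ c M w y)) (•-closed c (invariant p w∈W))
      invariant (*∈T {M} {N} p q) {w} w∈W =
        resp (λ y → ≈-sym (*ₘ-*ᵥ M N w y)) (invariant p (invariant q w∈W))
      invariant (≈∈T M≈N p) {w} w∈W = resp (*ᵥ-congˡ M≈N w) (invariant p w∈W)

    -- Has the shape of the field `spanning` of a basis, and lies in the level over which
    -- irreducibility quantifies.
    Span : ∀ {n} → (Fin n → V D) → Pred (V D) 0ℓ
    Span {n} b v = ∃ λ (c : Fin n → ℂ) → ∀ y → v y ≈ sum (λ k → c k * b k y)

    span-subspace : ∀ {n} (b : Fin n → V D) → IsSubspace (Span b)
    span-subspace b = record
      { resp     = λ { u≈v (c , eq) → c , λ y → ≈-trans (≈-sym (u≈v y)) (eq y) }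
      ; 0-closed = (λ _ → 0ℂ) , λ y → ≈-sym (sum-zero _ λ k → zeroˡ (b k y))
      ; +-closed = λ { (c , eq) (c′ , eq′) → (λ k → c k + c′ k) , λ y →
          ≈-trans (+-cong (eq y) (eq′ y)) (≈-sym (≈-trans
            (sum-cong-≋ λ k → distribʳ (b k y) (c k) (c′ k))
            (∑-distrib-+ (λ k → c k * b k y) (λ k → c′ k * b k y)))) }
      ; •-closed = λ { a (c , eq) → (λ k → a * c k) , λ y →
          ≈-trans (*-congˡ (eq y)) (≈-trans (*-distribˡ-sum a (λ k → c k * b k y))
            (sum-cong-≋ λ k → ≈-sym (*-assoc a (c k) (b k y)))) }
      }

    sum-closed : ∀ {W : Pred (V D) 0ℓ} → IsSubspace W → ∀ {n} (b : Fin n → V D) → (∀ k → b k ∈ W) →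
      (λ y → sum λ k → b k y) ∈ W
    sum-closed sub {zero}  b b∈W = IsSubspace.0-closed sub
    sum-closed sub {suc n} b b∈W =
      IsSubspace.+-closed sub (b∈W zero) (sum-closed sub (b ∘ suc) (b∈W ∘ suc))

    span-∋ : ∀ {n} (b : Fin n → V D) k → b k ∈ Span b
    span-∋ b k = δ k , λ y → ≈-sym (≈-trans (sum-single _ k λ j j≢k →
        ≈-trans (*-congʳ (off j j≢k)) (zeroˡ (b j y)))
      (≈-trans (*-congʳ on) (*-identityˡ (b k y))))
      where
      δ : _ → _ → ℂ
      δ k j = if does (j Fin.≟ k) then 1ℂ else 0ℂ
      off : ∀ j → j ≢ k → δ k j ≈ 0ℂ
      off j j≢k with j Fin.≟ k
      ... | yes j≡k = contradiction j≡k j≢k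
      ... | no _ = ≈-refl
      on : δ k k ≈ 1ℂ
      on with k Fin.≟ k
      ... | yes _ = ≈-refl
      ... | no k≢k = contradiction refl k≢k

    span-⊆ : ∀ {W : Pred (V D) 0ℓ} → IsSubspace W → ∀ {n} {b : Fin n → V D} → (∀ k → b k ∈ W) →
      ∀ {v} → v ∈ Span b → v ∈ W
    span-⊆ sub {b = b} b∈W (c , eq) = IsSubspace.resp sub (λ y → ≈-sym (eq y))
      (sum-closed sub (λ k → c k •ᵥ b k) λ k → IsSubspace.•-closed sub (c k) (b∈W k))

    span-stable : ∀ {n} {b : Fin n → V D} {f} → Linear f → (∀ k → f (b k) ∈ Span b) → Stable (Span b) f
    span-stable {b = b} {f} lin fb∈ {w} (c , eq) = resp
      (λ y → ≈-sym (≈-trans (ᵥ-cong lin eq y) (sum-hom lin (λ k → c k •ᵥ b k) y)))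
      (sum-closed (span-subspace b) (λ k → f (c k •ᵥ b k)) λ k →
        resp (λ y → ≈-sym (•-hom lin (c k) (b k) y)) (•-closed (c k) (fb∈ k)))
      where open IsSubspace (span-subspace b)

-- Spectral decompositions with eigenvalues D - 2i

module Axes where
  open Scalars
  open LinearAlgebra
  open Complex

  linear-resp : ∀ {D} {f g : V D → V D} → (∀ v → f v ≈ᵥ g v) → Linear f → Linear g
  linear-resp f≈g lin = record
    { ᵥ-cong = λ {u} {v} u≈v → transᵥ (symᵥ (f≈g u)) (transᵥ (ᵥ-cong lin u≈v) (f≈g v))
    ; +-hom  = λ u v y → ≈-trans (≈-sym (f≈g (u +ᵥ v) y))
        (≈-trans (+-hom lin u v y) (+-cong (f≈g u y) (f≈g v y)))
    ; •-hom  = λ c v y → ≈-trans (≈-sym (f≈g (c •ᵥ v) y)) (≈-trans (•-hom lin c v y) (*-congˡ (f≈g v y)))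
    }

  ∘-linear : ∀ {D} {f g : V D → V D} → Linear f → Linear g → Linear (f ∘ g)
  ∘-linear {f = f} {g} lf lg = record
    { ᵥ-cong = λ u≈v → ᵥ-cong lf (ᵥ-cong lg u≈v)
    ; +-hom  = λ u v → transᵥ (ᵥ-cong lf (+-hom lg u v)) (+-hom lf (g u) (g v))
    ; •-hom  = λ c v → transᵥ (ᵥ-cong lf (•-hom lg c v)) (•-hom lf c (g v))
    }

  Eigenvector : ∀ {D} → (V D → V D) → ℂ → V D → Set
  Eigenvector Y μ v = Y v ≈ᵥ μ •ᵥ v

  lagrangeFactor : ∀ {D} → (V D → V D) → ℕ → ℕ → V D → V D
  lagrangeFactor {D} Y i j v with j ℕ.≟ i
  ... | yes _  = v
  ... | no j≢i = λ y →
    fromℚ ((ℚ.1/ (θ D i ℚ.- θ D j)) {{θ-distinct D j≢i}}) * (Y v y + - (θℂ D j * v y))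

  -- The product that defines `E i`, with an arbitrary operator Y in place of A. Being a polynomial
  -- in Y, it preserves every Y-stable subspace.
  lagrange : ∀ {D} → (V D → V D) → ℕ → List ℕ → V D → V D
  lagrange Y i l v = foldr (lagrangeFactor Y i) v l

  module _ {D} {Y : V D → V D} (Y-linear : Linear Y) (i : ℕ) where

    lagrangeFactor-linear : ∀ j → Linear (lagrangeFactor Y i j)
    lagrangeFactor-linear j with j ℕ.≟ i
    ... | yes _ = record { ᵥ-cong = λ u≈v → u≈v ; +-hom = λ _ _ _ → ≈-refl ; •-hom = λ _ _ _ → ≈-refl }
    ... | no _  = record
      { ᵥ-cong = λ u≈v y → *-congˡ (+-cong (ᵥ-cong Y-linear u≈v y) (-‿cong (*-congˡ (u≈v y))))
      ; +-hom  = λ u v y → ≈-trans (*-congˡ (+-congʳ (+-hom Y-linear u v y)))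
          (solve 6 (λ k t Yu Yv u v → k :* ((Yu :+ Yv) :+ :- (t :* (u :+ v))) :=
              k :* (Yu :+ :- (t :* u)) :+ k :* (Yv :+ :- (t :* v)))
            ≈-refl _ (θℂ D j) (Y u y) (Y v y) (u y) (v y))
      ; •-hom  = λ c v y → ≈-trans (*-congˡ (+-congʳ (•-hom Y-linear c v y)))
          (solve 5 (λ k t c Yv v → k :* (c :* Yv :+ :- (t :* (c :* v))) := c :* (k :* (Yv :+ :- (t :* v))))
            ≈-refl _ (θℂ D j) c (Y v y) (v y))
      }

    lagrange-linear : ∀ l → Linear (lagrange Y i l)
    lagrange-linear [] = record
      { ᵥ-cong = λ u≈v → u≈v ; +-hom = λ _ _ _ → ≈-refl ; •-hom = λ _ _ _ → ≈-refl }
    lagrange-linear (j ∷ l) = ∘-linear (lagrangeFactor-linear j) (lagrange-linear l)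

    lagrangeFactor-stable : ∀ {W} → IsSubspace W → Stable W Y → ∀ j → Stable W (lagrangeFactor Y i j)
    lagrangeFactor-stable sub stable j {w} w∈W with j ℕ.≟ i
    ... | yes _ = w∈W
    ... | no _  = •-closed _ (resp
      (λ y → +-congˡ (solve 2 (λ t v → con (ℚ.- 1ℚ) :* t :* v := :- (t :* v)) ≈-refl (θℂ D j) (w y)))
      (+-closed (stable w∈W) (•-closed (fromℚ (ℚ.- 1ℚ) * θℂ D j) w∈W)))
      where open IsSubspace sub

    lagrange-stable : ∀ {W} → IsSubspace W → Stable W Y → ∀ l → Stable W (lagrange Y i l)
    lagrange-stable sub stable [] w∈W = w∈W
    lagrange-stable sub stable (j ∷ l) w∈W =
      lagrangeFactor-stable sub stable j (lagrange-stable sub stable l w∈W)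

    lagrangeFactor-eigenvector : ∀ j {μ v} → Eigenvector Y μ v → Eigenvector Y μ (lagrangeFactor Y i j v)
    lagrangeFactor-eigenvector j {μ} {v} Yv≈μv with j ℕ.≟ i
    ... | yes _  = Yv≈μv
    ... | no j≢i = transᵥ (ᵥ-cong Y-linear scaled) (transᵥ (•-hom Y-linear κ v)
      λ y → ≈-trans (*-congˡ (Yv≈μv y)) (≈-trans
        (solve 3 (λ k m v → k :* (m :* v) := m :* (k :* v)) ≈-refl κ μ (v y))
        (*-congˡ (≈-sym (scaled y)))))
      where
      k κ : ℂ
      k = fromℚ ((ℚ.1/ (θ D i ℚ.- θ D j)) {{θ-distinct D j≢i}})
      κ = k * (μ + - θℂ D j)
      scaled : (λ y → k * (Y v y + - (θℂ D j * v y))) ≈ᵥ κ •ᵥ v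
      scaled y = ≈-trans (*-congˡ (+-congʳ (Yv≈μv y)))
        (solve 4 (λ k m t v → k :* (m :* v :+ :- (t :* v)) := k :* (m :+ :- t) :* v)
          ≈-refl k μ (θℂ D j) (v y))

    lagrange-eigenvector : ∀ l {μ v} → Eigenvector Y μ v → Eigenvector Y μ (lagrange Y i l v)
    lagrange-eigenvector [] eig = eig
    lagrange-eigenvector (j ∷ l) eig = lagrangeFactor-eigenvector j (lagrange-eigenvector l eig)

    lagrangeFactor-fixes : ∀ j {v} → Eigenvector Y (θℂ D i) v → lagrangeFactor Y i j v ≈ᵥ v
    lagrangeFactor-fixes j {v} eig with j ℕ.≟ i
    ... | yes _  = λ _ → ≈-refl
    ... | no j≢i = λ y → ≈-trans (*-congˡ (+-congʳ (eig y))) (≈-trans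
        (solve 4 (λ k s t v → k :* (s :* v :+ :- (t :* v)) := k :* (s :+ :- t) :* v)
          ≈-refl k (θℂ D i) (θℂ D j) (v y))
        (≈-trans (*-congʳ inverse) (*-identityˡ (v y))))
      where
      instance
        nonZero : ℚ.NonZero (θ D i ℚ.- θ D j)
        nonZero = θ-distinct D j≢i
      q : ℚ
      q = θ D i ℚ.- θ D j
      k : ℂ
      k = fromℚ (ℚ.1/ q)
      inverse : k * (θℂ D i + - θℂ D j) ≈ 1ℂ
      inverse = ≈-trans
        (*-congˡ (≈-sym (≈-trans (fromℚ-+ (θ D i) (ℚ.- θ D j)) (+-congˡ (fromℚ-neg (θ D j))))))
        (≈-trans (≈-sym (fromℚ-* (ℚ.1/ q) q)) (≈-reflexive (cong fromℚ (ℚ.*-inverseˡ q))))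

    lagrange-fixes : ∀ l {v} → Eigenvector Y (θℂ D i) v → lagrange Y i l v ≈ᵥ v
    lagrange-fixes [] eig _ = ≈-refl
    lagrange-fixes (j ∷ l) {v} eig = transᵥ
      (ᵥ-cong (lagrangeFactor-linear j) (lagrange-fixes l eig)) (lagrangeFactor-fixes j eig)

    lagrangeFactor-kills : ∀ j {v} → j ≢ i → Eigenvector Y (θℂ D j) v → lagrangeFactor Y i j v ≈ᵥ 0ᵥ
    lagrangeFactor-kills j {v} j≢i eig with j ℕ.≟ i
    ... | yes j≡i = contradiction j≡i j≢i
    ... | no _    = λ y → ≈-trans (*-congˡ (+-congʳ (eig y)))
      (solve 3 (λ k t v → k :* (t :* v :+ :- (t :* v)) := con 0ℚ) ≈-refl _ (θℂ D j) (v y))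

    -- The factors after j in the list act first and keep v an eigenvector, the factor at j
    -- annihilates it, and the remaining factors are linear.
    lagrange-kills : ∀ l {j v} → j ≢ i → j ∈ₗ l → Eigenvector Y (θℂ D j) v → lagrange Y i l v ≈ᵥ 0ᵥ
    lagrange-kills (j ∷ l) j≢i (here refl) eig =
      lagrangeFactor-kills j j≢i (lagrange-eigenvector l eig)
    lagrange-kills (j ∷ l) j≢i (there j∈l) eig =
      zero-hom (lagrangeFactor-linear j) (lagrange-kills l j≢i j∈l eig)

  -- A resolution of the identity into eigenprojections of Y; orthogonality and idempotence follow
  -- from these fields. Indices range over ℕ and `beyond` kills the projections past D, so the
  -- neighbour `suc i` of an index always makes sense.
  record Axis {D} (Y : V D → V D) (F : ℕ → V D → V D) : Set where
    field
      linear   : Linear Y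
      F-linear : ∀ i → Linear (F i)
      eigen    : ∀ i v → Eigenvector Y (θℂ D i) (F i v)
      commute  : ∀ i v → F i (Y v) ≈ᵥ Y (F i v)
      complete : ∀ v y → sum (λ (j : Fin (suc D)) → F (toℕ j) v y) ≈ v y
      beyond   : ∀ i v → D ℕ.< i → F i v ≈ᵥ 0ᵥ

    detect : ∀ {v} → (∀ i → F i v ≈ᵥ 0ᵥ) → v ≈ᵥ 0ᵥ
    detect {v} Fv≈0 y = ≈-trans (≈-sym (complete v y))
      (sum-zero (λ (j : Fin (suc D)) → F (toℕ j) v y) λ j → Fv≈0 (toℕ j) y)

    -- Applying `F i` to Y v = μ v and using that `F i` commutes with Y gives (μ - θ_i) F_i v = 0.
    -- The value μ may lie outside the spectrum, which is how the two ends of the index range are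
    -- treated.
    eigenvector-off : ∀ {μ v} i → Eigenvector Y μ v → Cancellable (μ + - θℂ D i) → F i v ≈ᵥ 0ᵥ
    eigenvector-off {μ} {v} i Yv≈μv cancel y = cancel (≈-trans
      (solve 3 (λ x m t → x :* (m :+ :- t) := m :* x :+ :- (t :* x)) ≈-refl (F i v y) μ (θℂ D i))
      (≈-trans (+-cong (≈-sym (•-hom (F-linear i) μ v y)) (-‿cong (≈-sym (eigen i v y))))
      (≈-trans (+-cong (≈-sym (ᵥ-cong (F-linear i) Yv≈μv y)) (-‿cong (≈-sym (commute i v y))))
        (-‿inverseʳ (F i (Y v) y)))))

    sum-F-single : ∀ (g : ℕ → ℂ) i → (∀ j → j ≢ i → g j ≈ 0ℂ) → (D ℕ.< i → g i ≈ 0ℂ) →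
      sum (λ (j : Fin (suc D)) → g (toℕ j)) ≈ g i
    sum-F-single g i off out with i ℕ.≤? D
    ... | yes i≤D = ≈-trans
      (sum-single (g ∘ toℕ) k λ j j≢k → off (toℕ j) λ eq →
        j≢k (Fin.toℕ-injective (trans eq (sym (Fin.toℕ-fromℕ< (ℕ.s≤s i≤D))))))
      (≈-reflexive (cong g (Fin.toℕ-fromℕ< (ℕ.s≤s i≤D))))
      where
      k : Fin (suc D)
      k = fromℕ< (ℕ.s≤s i≤D)
    ... | no i≰D = ≈-trans
      (sum-zero (g ∘ toℕ) λ j → off (toℕ j) λ eq →
        i≰D (subst (ℕ._≤ D) eq (ℕ.≤-pred (Fin.toℕ<n j))))
      (≈-sym (out (ℕ.≰⇒> i≰D)))

    -- Expand v by `complete` and drop the terms killed by f. The index may exceed D; the surviving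
    -- term is then 0 and f vanishes altogether.
    component : ∀ {f} → Linear f → ∀ i → (∀ j → j ≢ i → ∀ v → f (F j v) ≈ᵥ 0ᵥ) →
      ∀ v → f v ≈ᵥ f (F i v)
    component {f} lin i off v y = ≈-trans (ᵥ-cong lin (symᵥ (complete v)) y) (≈-trans
      (sum-hom lin (λ (j : Fin (suc D)) → F (toℕ j) v) y)
      (sum-F-single (λ j → f (F j v) y) i (λ j j≢i → off j j≢i v y)
        λ D<i → zero-hom lin (beyond i v D<i) y))

    orthogonal : ∀ {i j} v → j ≢ i → F i (F j v) ≈ᵥ 0ᵥ
    orthogonal {i} {j} v j≢i = eigenvector-off i (eigen j v) (θℂ-distinct D (j≢i ∘ sym))

    idempotent : ∀ i v → F i (F i v) ≈ᵥ F i v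
    idempotent i v = symᵥ (component (F-linear i) i (λ j j≢i v → orthogonal v j≢i) v)

    eigenvector-fixed : ∀ {v} i → Eigenvector Y (θℂ D i) v → F i v ≈ᵥ v
    eigenvector-fixed {v} i eig y = ≈-trans
      (≈-sym (sum-F-single (λ j → F j v y) i
        (λ j j≢i → eigenvector-off j eig (θℂ-distinct D j≢i) y) (λ D<i → beyond i v D<i y)))
      (complete v y)

    -- The Lagrange product fixes `F i v` and kills the other components of v. Hence the projections
    -- are determined by Y and preserve every Y-stable subspace.
    F≈lagrange : ∀ i v → F i v ≈ᵥ lagrange Y i (upTo (suc D)) v
    F≈lagrange i v y = ≈-trans
      (≈-trans (≈-sym (lagrange-fixes linear i l (eigen i v) y))
        (≈-sym (sum-F-single (λ j → lagrange Y i l (F j v) y) i (λ j j≢i → off j j≢i y)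
          λ D<i → zero-hom (lagrange-linear linear i l) (beyond i v D<i) y)))
      (≈-trans (≈-sym (sum-hom (lagrange-linear linear i l) (λ (j : Fin (suc D)) → F (toℕ j) v) y))
        (ᵥ-cong (lagrange-linear linear i l) (complete v) y))
      where
      l : List ℕ
      l = upTo (suc D)

      off : ∀ j → j ≢ i → lagrange Y i l (F j v) ≈ᵥ 0ᵥ
      off j j≢i with j ℕ.≤? D
      ... | yes j≤D = lagrange-kills linear i l j≢i (∈-upTo⁺ (ℕ.s≤s j≤D)) (eigen j v)
      ... | no j≰D  = zero-hom (lagrange-linear linear i l) (beyond j v (ℕ.≰⇒> j≰D))

    F-stable : ∀ {W} → IsSubspace W → Stable W Y → ∀ i → Stable W (F i)
    F-stable sub stable i {w} w∈W = IsSubspace.resp sub (symᵥ (F≈lagrange i w))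
      (lagrange-stable linear i sub stable (upTo (suc D)) w∈W)

  axis-resp : ∀ {D} {Y} {F G : ℕ → V D → V D} → (∀ i v → F i v ≈ᵥ G i v) → Axis Y F → Axis Y G
  axis-resp {D} {Y} {F} {G} F≈G axis = record
    { linear   = linear
    ; F-linear = λ i → linear-resp (F≈G i) (F-linear i)
    ; eigen    = λ i v → transᵥ (ᵥ-cong linear (symᵥ (F≈G i v)))
        (transᵥ (eigen i v) λ y → *-congˡ (F≈G i v y))
    ; commute  = λ i v → transᵥ (symᵥ (F≈G i (Y v))) (transᵥ (commute i v) (ᵥ-cong linear (F≈G i v)))
    ; complete = λ v y → ≈-trans
        (sum-cong-≋ {_} {λ (j : Fin (suc D)) → G (toℕ j) v y} {λ j → F (toℕ j) v y}
          (λ j → ≈-sym (F≈G (toℕ j) v y))) (complete v y)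
    ; beyond   = λ i v D<i → transᵥ (symᵥ (F≈G i v)) (beyond i v D<i)
    }
    where open Axis axis

  -- Carries the decomposition of A* to A by the Hadamard power, and that of A to A^ε by P.
  axis-conjugate : ∀ {D} {K K⁻¹ Y Y′ : V D → V D} {F : ℕ → V D → V D} →
    Linear K → Linear K⁻¹ → Linear Y′ → (∀ v → K (K⁻¹ v) ≈ᵥ v) → (∀ v → K⁻¹ (K v) ≈ᵥ v) →
    (∀ v → K (Y′ v) ≈ᵥ Y (K v)) → Axis Y F → Axis Y′ (λ i v → K⁻¹ (F i (K v)))
  axis-conjugate {D} {K} {K⁻¹} {Y} {Y′} {F} linK linK⁻¹ linY′ KK⁻¹ K⁻¹K KY′≈YK axis = record
    { linear   = linY′
    ; F-linear = λ i → ∘-linear linK⁻¹ (∘-linear (F-linear i) linK)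
    ; eigen    = λ i v → begin
        Y′ (K⁻¹ (F i (K v)))       ≈⟨ intertwine (F i (K v)) ⟨
        K⁻¹ (Y (F i (K v)))        ≈⟨ ᵥ-cong linK⁻¹ (eigen i (K v)) ⟩
        K⁻¹ (θℂ D i •ᵥ F i (K v))  ≈⟨ •-hom linK⁻¹ (θℂ D i) (F i (K v)) ⟩
        θℂ D i •ᵥ K⁻¹ (F i (K v))  ∎
    ; commute  = λ i v → begin
        K⁻¹ (F i (K (Y′ v)))   ≈⟨ ᵥ-cong linK⁻¹ (ᵥ-cong (F-linear i) (KY′≈YK v)) ⟩
        K⁻¹ (F i (Y (K v)))    ≈⟨ ᵥ-cong linK⁻¹ (commute i (K v)) ⟩
        K⁻¹ (Y (F i (K v)))    ≈⟨ intertwine (F i (K v)) ⟩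
        Y′ (K⁻¹ (F i (K v)))   ∎
    ; complete = λ v y → ≈-trans (≈-sym (sum-hom linK⁻¹ (λ (j : Fin (suc D)) → F (toℕ j) (K v)) y))
        (≈-trans (ᵥ-cong linK⁻¹ (complete (K v)) y) (K⁻¹K v y))
    ; beyond   = λ i v D<i → zero-hom linK⁻¹ (beyond i (K v) D<i)
    }
    where
    open Axis axis
    open ≈ᵥ-Reasoning
    intertwine : ∀ w → K⁻¹ (Y w) ≈ᵥ Y′ (K⁻¹ w)
    intertwine w = begin
      K⁻¹ (Y w)              ≈⟨ ᵥ-cong linK⁻¹ (ᵥ-cong linear (KK⁻¹ w)) ⟨
      K⁻¹ (Y (K (K⁻¹ w)))    ≈⟨ ᵥ-cong linK⁻¹ (KY′≈YK (K⁻¹ w)) ⟨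
      K⁻¹ (K (Y′ (K⁻¹ w)))   ≈⟨ K⁻¹K (Y′ (K⁻¹ w)) ⟩
      Y′ (K⁻¹ w)             ∎

-- Commutation relations and strings of components

module Triples where
  open Scalars
  open LinearAlgebra
  open Axes
  open Complex
  open import Relation.Binary.Reasoning.Setoid setoid

  cancellable-resp : ∀ {x y} → x ≈ y → Cancellable x → Cancellable y
  cancellable-resp x≈y cancel cy≈0 = cancel (≈-trans (*-congˡ x≈y) cy≈0)

  cancellable-neg : ∀ {x} → Cancellable x → Cancellable (- x)
  cancellable-neg {x} cancel {c} eq = cancel (≈-trans
    (solve 2 (λ c x → c :* x := :- (c :* (:- x))) ≈-refl c x)
    (≈-trans (-‿cong eq) (solve 0 (:- con 0ℚ := con 0ℚ) ≈-refl)))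

  double-cancel : ∀ n → Cancellable (nat (suc n) + nat (suc n))
  double-cancel n = cancellable-resp (nat-+ (suc n) (suc n)) (nat-cancel (n ℕ.+ suc n))

  nat-D : ∀ {D} r d → d ℕ.+ 2 ℕ.* r ≡ D → nat D ≈ nat d + (nat r + nat r)
  nat-D r d refl = ≈-trans (nat-+ d (2 ℕ.* r))
    (+-congˡ (≈-trans (nat-+ r (r ℕ.+ 0)) (+-congˡ (≈-reflexive (cong nat (ℕ.+-identityʳ r))))))

  θℂ-suc : ∀ D i → θℂ D i + - (1ℂ + 1ℂ) ≈ θℂ D (suc i)
  θℂ-suc D i = ≈-trans (+-congʳ (θℂ≈ D i)) (≈-trans
    (solve 2 (λ n i → (n :+ :- (i :+ i)) :+ :- (con 1ℚ :+ con 1ℚ) :=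
       n :+ :- ((con 1ℚ :+ i) :+ (con 1ℚ :+ i))) ≈-refl (nat D) (nat i))
    (≈-trans (+-congˡ (-‿cong (≈-sym (+-cong (nat-suc i) (nat-suc i))))) (≈-sym (θℂ≈ D (suc i)))))

  -- (D + 2) - (D - 2i) = 2(i + 1), so D + 2 is no eigenvalue; this closes the strings at index 0.
  above-θ₀ : ∀ D i → Cancellable ((θℂ D 0 + (1ℂ + 1ℂ)) + - θℂ D i)
  above-θ₀ D i = cancellable-resp (≈-sym (≈-trans
    (+-cong (+-congʳ (θℂ≈ D 0)) (-‿cong (θℂ≈ D i))) (≈-trans
    (solve 2 (λ n i → ((n :+ :- (con 0ℚ :+ con 0ℚ)) :+ (con 1ℚ :+ con 1ℚ)) :+ :- (n :+ :- (i :+ i)) :=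
       (con 1ℚ :+ i) :+ (con 1ℚ :+ i)) ≈-refl (nat D) (nat i))
    (≈-sym (+-cong (nat-suc i) (nat-suc i)))))) (double-cancel i)

  -- A presentation of sl₂ that treats the three operators alike. The scalar enters through its
  -- square, so that `𝐢` and `- 𝐢`, the two orientations, are handled together.
  record Triple {D} (X Y Z : V D → V D) (c : ℂ) : Set where
    field
      X-linear : Linear X
      Y-linear : Linear Y
      Z-linear : Linear Z
      c*c      : c * c ≈ - 1ℂ
      [X,Y]    : ∀ v y → X (Y v) y + - Y (X v) y ≈ c * (Z v y + Z v y)
      [Y,Z]    : ∀ v y → Y (Z v) y + - Z (Y v) y ≈ c * (X v y + X v y)
      [Z,X]    : ∀ v y → Z (X v) y + - X (Z v) y ≈ c * (Y v y + Y v y)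

  module _ {D} {X Y Z : V D → V D} {c : ℂ} (triple : Triple X Y Z c) where
    open Triple triple

    rotate : Triple Y Z X c
    rotate = record
      { X-linear = Y-linear ; Y-linear = Z-linear ; Z-linear = X-linear
      ; c*c = c*c ; [X,Y] = [Y,Z] ; [Y,Z] = [Z,X] ; [Z,X] = [X,Y] }

    -- Exchanging two operators reverses the cyclic order, and with it the sign of all three
    -- commutators. With `rotate` this reaches all six orders.
    reflect : Triple Y X Z (- c)
    reflect = record
      { X-linear = Y-linear ; Y-linear = X-linear ; Z-linear = Z-linear
      ; c*c   = ≈-trans (solve 1 (λ c → (:- c) :* (:- c) := c :* c) ≈-refl c) c*c
      ; [X,Y] = negate {X} {Y} {Z} [X,Y]
      ; [Y,Z] = negate {Z} {X} {Y} [Z,X]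
      ; [Z,X] = negate {Y} {Z} {X} [Y,Z]
      }
      where
      negate : ∀ {P Q R : V D → V D} → (∀ v y → P (Q v) y + - Q (P v) y ≈ c * (R v y + R v y)) →
        ∀ v y → Q (P v) y + - P (Q v) y ≈ - c * (R v y + R v y)
      negate {P} {Q} {R} eq v y = ≈-trans
        (solve 2 (λ a b → b :+ :- a := :- (a :+ :- b)) ≈-refl (P (Q v) y) (Q (P v) y))
        (≈-trans (-‿cong (eq v y))
          (solve 2 (λ c r → :- (c :* (r :+ r)) := (:- c) :* (r :+ r)) ≈-refl c (R v y)))

    raise : V D → V D
    raise v = Y v +ᵥ c •ᵥ Z v

    -- [X, Y + cZ] = 2cZ - 2c²Y = 2(Y + cZ), since c² = -1.
    raise-eigenvector : ∀ {μ v} → Eigenvector X μ v → Eigenvector X (μ + (1ℂ + 1ℂ)) (raise v)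
    raise-eigenvector {μ} {v} Xv≈μv y = begin
      X (Y v +ᵥ c •ᵥ Z v) y
        ≈⟨ ≈-trans (+-hom X-linear (Y v) (c •ᵥ Z v) y) (+-congˡ (•-hom X-linear c (Z v) y)) ⟩
      X (Y v) y + c * X (Z v) y
        ≈⟨ +-cong XY (*-congˡ XZ) ⟩
      (μ * Y v y + c * (Z v y + Z v y)) + c * (μ * Z v y + - (c * (Y v y + Y v y)))
        ≈⟨ solve 4 (λ m c p q → (m :* p :+ c :* (q :+ q)) :+ c :* (m :* q :+ :- (c :* (p :+ p))) :=
             m :* (p :+ c :* q) :+ c :* (q :+ q) :+ :- ((c :* c) :* (p :+ p))) ≈-refl μ c (Y v y) (Z v y) ⟩
      μ * (Y v y + c * Z v y) + c * (Z v y + Z v y) + - ((c * c) * (Y v y + Y v y))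
        ≈⟨ +-congˡ (-‿cong (*-congʳ c*c)) ⟩
      μ * (Y v y + c * Z v y) + c * (Z v y + Z v y) + - (- 1ℂ * (Y v y + Y v y))
        ≈⟨ solve 4 (λ m c p q → m :* (p :+ c :* q) :+ c :* (q :+ q) :+ :- ((:- con 1ℚ) :* (p :+ p)) :=
             (m :+ (con 1ℚ :+ con 1ℚ)) :* (p :+ c :* q)) ≈-refl μ c (Y v y) (Z v y) ⟩
      (μ + (1ℂ + 1ℂ)) * (Y v y + c * Z v y) ∎
      where
      XY : X (Y v) y ≈ μ * Y v y + c * (Z v y + Z v y)
      XY = ≈-trans (solve 2 (λ a b → a := b :+ (a :+ :- b)) ≈-refl (X (Y v) y) (Y (X v) y))
        (+-cong (≈-trans (ᵥ-cong Y-linear Xv≈μv y) (•-hom Y-linear μ v y)) ([X,Y] v y))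
      XZ : X (Z v) y ≈ μ * Z v y + - (c * (Y v y + Y v y))
      XZ = ≈-trans (solve 2 (λ a b → a := b :+ :- (b :+ :- a)) ≈-refl (X (Z v) y) (Z (X v) y))
        (+-cong (≈-trans (ᵥ-cong Z-linear Xv≈μv y) (•-hom Z-linear μ v y)) (-‿cong ([Z,X] v y)))

    shift : ℂ → V D → V D
    shift s v = X v +ᵥ (s * c) •ᵥ Z v

    shift-linear : ∀ s → Linear (shift s)
    shift-linear s = record
      { ᵥ-cong = λ u≈v y → +-cong (ᵥ-cong X-linear u≈v y) (*-congˡ (ᵥ-cong Z-linear u≈v y))
      ; +-hom  = λ u v y → ≈-trans
          (+-cong (+-hom X-linear u v y) (*-congˡ (+-hom Z-linear u v y)))
          (solve 5 (λ a b k p q → (a :+ b) :+ k :* (p :+ q) := (a :+ k :* p) :+ (b :+ k :* q))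
            ≈-refl (X u y) (X v y) (s * c) (Z u y) (Z v y))
      ; •-hom  = λ a v y → ≈-trans
          (+-cong (•-hom X-linear a v y) (*-congˡ (•-hom Z-linear a v y)))
          (solve 4 (λ a x k z → a :* x :+ k :* (a :* z) := a :* (x :+ k :* z))
            ≈-refl a (X v y) (s * c) (Z v y))
      }

    -- [Y, X + scZ] = -2cZ + 2sc²X = -2s(X + scZ), since c² = -1 and s² = 1.
    shift-eigenvector : ∀ {s μ v} → s * s ≈ 1ℂ → Eigenvector Y μ v →
      Eigenvector Y (μ + - (s + s)) (shift s v)
    shift-eigenvector {s} {μ} {v} s*s Yv≈μv y = begin
      Y (X v +ᵥ (s * c) •ᵥ Z v) y
        ≈⟨ ≈-trans (+-hom Y-linear (X v) ((s * c) •ᵥ Z v) y) (+-congˡ (•-hom Y-linear (s * c) (Z v) y)) ⟩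
      Y (X v) y + (s * c) * Y (Z v) y
        ≈⟨ +-cong YX (*-congˡ YZ) ⟩
      (μ * x + - (c * (z + z))) + (s * c) * (μ * z + c * (x + x))
        -- The z term receives a spare factor 1, which the next step replaces by s² so that s can be
        -- factored out.
        ≈⟨ solve 5 (λ m c s x z → (m :* x :+ :- (c :* (z :+ z))) :+
             (s :* c) :* (m :* z :+ c :* (x :+ x)) :=
             (m :* (x :+ (s :* c) :* z) :+ (c :* c) :* (s :* (x :+ x))) :+ con 1ℚ :* (:- (c :* (z :+ z))))
             ≈-refl μ c s x z ⟩
      (μ * (x + (s * c) * z) + (c * c) * (s * (x + x))) + 1ℂ * - (c * (z + z))
        ≈⟨ +-cong (+-congˡ (*-congʳ c*c)) (*-congʳ (≈-sym s*s)) ⟩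
      (μ * (x + (s * c) * z) + - 1ℂ * (s * (x + x))) + (s * s) * - (c * (z + z))
        ≈⟨ solve 5 (λ m c s x z →
             (m :* (x :+ (s :* c) :* z) :+ (:- con 1ℚ) :* (s :* (x :+ x))) :+
             (s :* s) :* (:- (c :* (z :+ z))) :=
             (m :+ :- (s :+ s)) :* (x :+ (s :* c) :* z)) ≈-refl μ c s x z ⟩
      (μ + - (s + s)) * (x + (s * c) * z) ∎
      where
      x z : ℂ
      x = X v y
      z = Z v y
      YX : Y (X v) y ≈ μ * x + - (c * (z + z))
      YX = ≈-trans (solve 2 (λ a b → a := b :+ :- (b :+ :- a)) ≈-refl (Y (X v) y) (X (Y v) y))
        (+-cong (≈-trans (ᵥ-cong X-linear Yv≈μv y) (•-hom X-linear μ v y)) (-‿cong ([X,Y] v y)))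
      YZ : Y (Z v) y ≈ μ * z + c * (x + x)
      YZ = ≈-trans (solve 2 (λ a b → a := b :+ (a :+ :- b)) ≈-refl (Y (Z v) y) (Z (Y v) y))
        (+-cong (≈-trans (ᵥ-cong Z-linear Yv≈μv y) (•-hom Z-linear μ v y)) ([Y,Z] v y))

  ±1-square : 1ℂ * 1ℂ ≈ 1ℂ × - 1ℂ * - 1ℂ ≈ 1ℂ
  ±1-square = *-identityˡ 1ℂ , solve 0 ((:- con 1ℚ) :* (:- con 1ℚ) := con 1ℚ) ≈-refl

  record HighestWeight {D} (X Y Z : V D → V D) (c : ℂ) (d : ℕ) (u : V D) : Set where
    field
      weight : Eigenvector X (nat d) u
      highest : ∀ y → Y u y + c * Z u y ≈ 0ℂ

  module Strings {D} {X Y Z : V D → V D} {c : ℂ} {F : ℕ → V D → V D}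
    (triple : Triple X Y Z c) (axis : Axis Y F)
    {r d : ℕ} (d+2r≡D : d ℕ.+ 2 ℕ.* r ≡ D) {u : V D} (hw : HighestWeight X Y Z c d u) where
    open Triple triple
    open Axis axis
    open HighestWeight hw

    θ≈ : ∀ i → θℂ D i ≈ (nat d + (nat r + nat r)) + - (nat i + nat i)
    θ≈ i = ≈-trans (θℂ≈ D i) (+-congʳ (nat-D r d d+2r≡D))

    -- The signs refer to the index: `M₊` moves i to i + 1 and thus lowers the Y-eigenvalue by 2.
    -- They differ from `raise`, which acts on X-eigenvalues.
    M₊ M₋ : V D → V D
    M₊ = shift triple 1ℂ
    M₋ = shift triple (- 1ℂ)

    F-shift : ∀ s i → F i (shift triple s u) ≈ᵥ (nat d + - (s * θℂ D i)) •ᵥ F i u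
    F-shift s i y = begin
      F i (shift triple s u) y
        ≈⟨ ᵥ-cong (F-linear i) shift-u y ⟩
      F i (nat d •ᵥ u +ᵥ (- s) •ᵥ Y u) y
        ≈⟨ ≈-trans (+-hom (F-linear i) (nat d •ᵥ u) ((- s) •ᵥ Y u) y)
             (+-cong (•-hom (F-linear i) (nat d) u y) (•-hom (F-linear i) (- s) (Y u) y)) ⟩
      nat d * F i u y + - s * F i (Y u) y
        ≈⟨ +-congˡ (*-congˡ (≈-trans (commute i u y) (eigen i u y))) ⟩
      nat d * F i u y + - s * (θℂ D i * F i u y)
        ≈⟨ solve 4 (λ d s t f → d :* f :+ (:- s) :* (t :* f) := (d :+ :- (s :* t)) :* f)
             ≈-refl (nat d) s (θℂ D i) (F i u y) ⟩
      (nat d + - (s * θℂ D i)) * F i u y ∎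
      where
      shift-u : shift triple s u ≈ᵥ nat d •ᵥ u +ᵥ (- s) •ᵥ Y u
      shift-u y = ≈-trans
        (solve 5 (λ s c x y z → x :+ (s :* c) :* z := (x :+ (:- s) :* y) :+ s :* (y :+ c :* z))
          ≈-refl s c (X u y) (Y u y) (Z u y))
        (≈-trans (+-cong (+-congʳ (weight y)) (*-congˡ (highest y)))
          (solve 2 (λ a s → a :+ s :* con 0ℚ := a) ≈-refl _ s))

    -- The shift carries only the j-th component to the eigenvalue θ_i. Hence `F i` after the shift
    -- sees u through `F j u` alone, and `F-shift` evaluates it on u.
    shift-component : ∀ s i j → s * s ≈ 1ℂ → θℂ D j + - (s + s) ≈ θℂ D i →
      shift triple s (F j u) ≈ᵥ (nat d + - (s * θℂ D i)) •ᵥ F i u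
    shift-component s i j s*s θj-2s≈θi = transᵥ (symᵥ (eigenvector-fixed i
        (λ y → ≈-trans (shift-eigenvector triple s*s (eigen j u) y) (*-congʳ θj-2s≈θi))))
      (transᵥ (symᵥ (component (∘-linear (F-linear i) (shift-linear triple s)) j off u)) (F-shift s i))
      where
      off : ∀ k → k ≢ j → ∀ v → F i (shift triple s (F k v)) ≈ᵥ 0ᵥ
      -- Both eigenvalues move by -2s, so the gap to θ_i is still θ_k - θ_j.
      off k k≢j v = eigenvector-off i (shift-eigenvector triple s*s (eigen k v))
        (cancellable-resp (≈-trans
          (solve 3 (λ k j s → k :+ :- j := (k :+ :- (s :+ s)) :+ :- (j :+ :- (s :+ s)))
            ≈-refl (θℂ D k) (θℂ D j) s)
          (+-congˡ (-‿cong θj-2s≈θi))) (θℂ-distinct D (k≢j ∘ sym)))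

    raise-component : ∀ i → M₊ (F i u) ≈ᵥ (nat d + - θℂ D (suc i)) •ᵥ F (suc i) u
    raise-component i y = ≈-trans
      (shift-component 1ℂ (suc i) i (proj₁ ±1-square) (θℂ-suc D i) y)
      (*-congʳ (+-congˡ (-‿cong (*-identityˡ _))))

    lower-component : ∀ i → M₋ (F (suc i) u) ≈ᵥ (nat d + θℂ D i) •ᵥ F i u
    lower-component i y = ≈-trans
      (shift-component (- 1ℂ) i (suc i) (proj₂ ±1-square) (≈-trans
        (+-congʳ (≈-sym (θℂ-suc D i)))
        (solve 1 (λ t → (t :+ :- (con 1ℚ :+ con 1ℚ)) :+ :- ((:- con 1ℚ) :+ (:- con 1ℚ)) := t)
          ≈-refl (θℂ D i))) y)
      (*-congʳ (solve 2 (λ d t → d :+ :- ((:- con 1ℚ) :* t) := d :+ t) ≈-refl (nat d) (θℂ D i)))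

    lower-bottom : M₋ (F 0 u) ≈ᵥ 0ᵥ
    lower-bottom = detect λ i → eigenvector-off i (shift-eigenvector triple (proj₂ ±1-square) (eigen 0 u))
      (cancellable-resp (+-congʳ
        (solve 1 (λ t → t :+ (con 1ℚ :+ con 1ℚ) := t :+ :- ((:- con 1ℚ) :+ (:- con 1ℚ))) ≈-refl (θℂ D 0)))
        (above-θ₀ D i))

    F₀-raise : ∀ v → F 0 (M₊ v) ≈ᵥ 0ᵥ
    -- Every component is sent to an eigenvalue θ_j - 2 < θ_0. With all indices off, `component` is
    -- applied at `suc D`, where the remaining projection is 0.
    F₀-raise v = transᵥ (component lin (suc D) (λ j _ → off j) v)
      (zero-hom lin (beyond (suc D) v ℕ.≤-refl))
      where
      lin : Linear (F 0 ∘ M₊)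
      lin = ∘-linear (F-linear 0) (shift-linear triple 1ℂ)
      off : ∀ j w → F 0 (M₊ (F j w)) ≈ᵥ 0ᵥ
      off j w = eigenvector-off 0 (shift-eigenvector triple (proj₁ ±1-square) (eigen j w))
        (cancellable-resp
          (solve 2 (λ a b → :- ((a :+ (con 1ℚ :+ con 1ℚ)) :+ :- b) := (b :+ :- (con 1ℚ :+ con 1ℚ)) :+ :- a)
            ≈-refl (θℂ D 0) (θℂ D j))
          (cancellable-neg (above-θ₀ D j)))

    -- The ends of the string are the zeros of the two coefficients: d - θ_{r+k} = 2k vanishes at k
    -- = 0, and d + θ_{r+k} = 2(d - k) at k = d.
    raise-coefficient : ∀ k → nat d + - θℂ D (r ℕ.+ k) ≈ nat k + nat k
    raise-coefficient k = ≈-trans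
      (+-congˡ (-‿cong (≈-trans (θ≈ (r ℕ.+ k)) (+-congˡ (-‿cong (+-cong (nat-+ r k) (nat-+ r k)))))))
      (solve 3 (λ d r k → d :+ :- ((d :+ (r :+ r)) :+ :- ((r :+ k) :+ (r :+ k))) := k :+ k)
        ≈-refl (nat d) (nat r) (nat k))

    -- Here and in the next two lemmas a strict inequality is given as an equation with `suc m`, so
    -- that the coefficient becomes twice `nat (suc m)` up to sign.
    raise-coefficient-below : ∀ i m → r ≡ i ℕ.+ suc m → Cancellable (nat d + - θℂ D i)
    raise-coefficient-below i m refl = cancellable-resp (≈-sym (≈-trans
      (+-congˡ (-‿cong (≈-trans (θ≈ i) (+-congʳ (+-congˡ (+-cong (nat-+ i (suc m)) (nat-+ i (suc m))))))))
      (solve 3 (λ d i m → d :+ :- ((d :+ ((i :+ m) :+ (i :+ m))) :+ :- (i :+ i)) := :- (m :+ m))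
        ≈-refl (nat d) (nat i) (nat (suc m))))) (cancellable-neg (double-cancel m))

    lower-coefficient : ∀ k m → d ≡ k ℕ.+ suc m → Cancellable (nat d + θℂ D (r ℕ.+ k))
    lower-coefficient k m refl = cancellable-resp (≈-sym (≈-trans
      (+-cong (nat-+ k (suc m)) (≈-trans (θ≈ (r ℕ.+ k))
        (+-cong (+-congʳ (nat-+ k (suc m))) (-‿cong (+-cong (nat-+ r k) (nat-+ r k))))))
      (solve 3 (λ r k m → (k :+ m) :+ (((k :+ m) :+ (r :+ r)) :+ :- ((r :+ k) :+ (r :+ k))) := m :+ m)
        ≈-refl (nat r) (nat k) (nat (suc m))))) (double-cancel m)

    lower-coefficient-above : ∀ i m → i ≡ (r ℕ.+ d) ℕ.+ suc m → Cancellable (nat d + θℂ D i)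
    lower-coefficient-above i m refl = cancellable-resp (≈-sym (≈-trans
      (+-congˡ (≈-trans (θ≈ i) (+-congˡ (-‿cong (+-cong nat-i nat-i)))))
      (solve 3 (λ d r m → d :+ ((d :+ (r :+ r)) :+ :- (((r :+ d) :+ m) :+ ((r :+ d) :+ m))) := :- (m :+ m))
        ≈-refl (nat d) (nat r) (nat (suc m))))) (cancellable-neg (double-cancel m))
      where
      nat-i : nat ((r ℕ.+ d) ℕ.+ suc m) ≈ (nat r + nat d) + nat (suc m)
      nat-i = ≈-trans (nat-+ (r ℕ.+ d) (suc m)) (+-congʳ (nat-+ r d))

    cancel-scalar : ∀ {x} {v : V D} → Cancellable x → x •ᵥ v ≈ᵥ 0ᵥ → v ≈ᵥ 0ᵥ
    cancel-scalar cancel eq y = cancel (≈-trans (*-comm _ _) (eq y))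

    -- Induction upwards from 0: the multiple (d - θ_i) u_i is the image of u_{i-1} under `M₊`, or
    -- for i = 0 the 0-th component of `M₊ u`, which `F₀-raise` excludes. Below r the coefficient
    -- cancels.
    below : ∀ i → i ℕ.< r → F i u ≈ᵥ 0ᵥ
    below i i<r = cancel-scalar (raise-coefficient-below i (r ℕ.∸ suc i)
        (trans (sym (ℕ.m+[n∸m]≡n i<r)) (sym (ℕ.+-suc i (r ℕ.∸ suc i))))) (raised i i<r)
      where
      raised : ∀ i → i ℕ.< r → (nat d + - θℂ D i) •ᵥ F i u ≈ᵥ 0ᵥ
      raised zero _ y = ≈-trans (≈-sym (≈-trans (F-shift 1ℂ 0 y)
        (*-congʳ (+-congˡ (-‿cong (*-identityˡ _)))))) (F₀-raise u y)
      raised (suc i) i<r = transᵥ (symᵥ (raise-component i))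
        (zero-hom (shift-linear triple 1ℂ) (below i (ℕ.<-trans (ℕ.n<1+n i) i<r)))

    above : ∀ i → r ℕ.+ d ℕ.< i → F i u ≈ᵥ 0ᵥ
    above i r+d<i = descend (suc D ℕ.∸ i) i r+d<i (ℕ.m≤n+m∸n (suc D) i)
      where
      -- Downward induction from indices past D, where `beyond` applies; k bounds the number of
      -- steps from i to such an index.
      descend : ∀ k i → r ℕ.+ d ℕ.< i → D ℕ.< i ℕ.+ k → F i u ≈ᵥ 0ᵥ
      descend zero i _ D<i = beyond i u (subst (D ℕ.<_) (ℕ.+-identityʳ i) D<i)
      descend (suc k) i r+d<i D<i+k = cancel-scalar
        (lower-coefficient-above i (i ℕ.∸ suc (r ℕ.+ d))
          (trans (sym (ℕ.m+[n∸m]≡n r+d<i)) (sym (ℕ.+-suc (r ℕ.+ d) _))))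
        (transᵥ (symᵥ (lower-component i)) (zero-hom (shift-linear triple (- 1ℂ))
          (descend k (suc i) (ℕ.m≤n⇒m≤1+n r+d<i) (subst (D ℕ.<_) (ℕ.+-suc i k) D<i+k))))

    basis : Fin (suc d) → V D
    basis k = F (r ℕ.+ toℕ k) u

    component∈span : ∀ i → F i u ∈ Span basis
    component∈span i with r ℕ.≤? i | i ℕ.≤? r ℕ.+ d
    ... | no r≰i | _ = resp (symᵥ (below i (ℕ.≰⇒> r≰i))) 0-closed
      where open IsSubspace (span-subspace basis)
    ... | yes _ | no i≰r+d = resp (symᵥ (above i (ℕ.≰⇒> i≰r+d))) 0-closed
      where open IsSubspace (span-subspace basis)
    ... | yes r≤i | yes i≤r+d = subst (λ j → F j u ∈ Span basis)
        (trans (cong (r ℕ.+_) (Fin.toℕ-fromℕ< i∸r<)) (ℕ.m+[n∸m]≡n r≤i)) (span-∋ basis (fromℕ< i∸r<))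
      where
      i∸r< : i ℕ.∸ r ℕ.< suc d
      i∸r< = ℕ.s≤s (ℕ.≤-trans (ℕ.∸-monoˡ-≤ r i≤r+d) (ℕ.≤-reflexive (ℕ.m+n∸m≡n r d)))

    raise∈span : ∀ i → M₊ (F i u) ∈ Span basis
    raise∈span i = resp (symᵥ (raise-component i)) (•-closed _ (component∈span (suc i)))
      where open IsSubspace (span-subspace basis)

    lower∈span : ∀ i → M₋ (F i u) ∈ Span basis
    lower∈span zero = resp (symᵥ lower-bottom) 0-closed
      where open IsSubspace (span-subspace basis)
    lower∈span (suc i) = resp (symᵥ (lower-component i)) (•-closed _ (component∈span i))
      where open IsSubspace (span-subspace basis)

    -- X = (M₊ + M₋)/2; similarly cZ = (M₊ - M₋)/2, where c is inverted by multiplying by -c.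
    span-stable-X : Stable (Span basis) X
    span-stable-X = span-stable X-linear λ k → let v = basis k in resp
      (λ y → solve 3 (λ c x z →
          con ½ :* ((x :+ (con 1ℚ :* c) :* z) :+ (x :+ ((:- con 1ℚ) :* c) :* z)) := x)
        ≈-refl c (X v y) (Z v y))
      (•-closed (fromℚ ½) (+-closed (raise∈span (r ℕ.+ toℕ k)) (lower∈span (r ℕ.+ toℕ k))))
      where open IsSubspace (span-subspace basis)

    span-stable-Y : Stable (Span basis) Y
    span-stable-Y = span-stable Y-linear λ k →
      resp (symᵥ (eigen (r ℕ.+ toℕ k) u)) (•-closed _ (span-∋ basis k))
      where open IsSubspace (span-subspace basis)

    span-stable-Z : Stable (Span basis) Z
    span-stable-Z = span-stable Z-linear λ k → let v = basis k in resp
      (λ y → ≈-trans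
        (solve 3 (λ c x z → (:- c) :* (con ½ :*
            ((x :+ (con 1ℚ :* c) :* z) :+ (:- con 1ℚ) :* (x :+ ((:- con 1ℚ) :* c) :* z))) :=
            :- ((c :* c) :* z))
          ≈-refl c (X v y) (Z v y))
        (≈-trans (-‿cong (*-congʳ c*c)) (solve 1 (λ z → :- ((:- con 1ℚ) :* z) := z) ≈-refl (Z v y))))
      (•-closed (- c) (•-closed (fromℚ ½) (+-closed (raise∈span (r ℕ.+ toℕ k))
        (•-closed (- 1ℂ) (lower∈span (r ℕ.+ toℕ k))))))
      where open IsSubspace (span-subspace basis)

    u∈span : u ∈ Span basis
    u∈span = IsSubspace.resp (span-subspace basis) (complete u)
      (sum-closed (span-subspace basis) (λ (j : Fin (suc D)) → F (toℕ j) u) λ j → component∈span (toℕ j))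

    module _ (u≢0 : Nonzero u) where

      -- A scalar annihilating one component annihilates its neighbours, hence u.
      component-cancel : ∀ k → k ℕ.≤ d → ∀ {a} → a •ᵥ F (r ℕ.+ k) u ≈ᵥ 0ᵥ → a ≈ 0ℂ
      component-cancel k k≤d {a} eq = #0⇒cancellable (proj₂ u≢0) 
          (detect {a •ᵥ u} (λ i y → ≈-trans (•-hom (F-linear i) a u y) (everywhere i y)) (proj₁ u≢0))
        where
        scaled : ∀ {f} → Linear f → ∀ {v w x} → Cancellable x → f v ≈ᵥ x •ᵥ w → a •ᵥ v ≈ᵥ 0ᵥ → a •ᵥ w ≈ᵥ 0ᵥ
        scaled {f} lin {v} {w} {x} cancel fv≈xw av≈0 y = cancel (begin
          (a * w y) * x   ≈⟨ solve 3 (λ a w x → (a :* w) :* x := a :* (x :* w)) ≈-refl a (w y) x ⟩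
          a * (x * w y)   ≈⟨ *-congˡ (fv≈xw y) ⟨
          a * f v y       ≈⟨ •-hom lin a v y ⟨
          f (a •ᵥ v) y    ≈⟨ zero-hom lin av≈0 y ⟩
          0ℂ              ∎)
        -- `M₋` carries the relation a u_i = 0 down to index r, since its coefficient 2(d - k)
        -- cancels for k < d.
        down : ∀ k → k ℕ.≤ d → a •ᵥ F (r ℕ.+ k) u ≈ᵥ 0ᵥ → a •ᵥ F (r ℕ.+ 0) u ≈ᵥ 0ᵥ
        down zero _ eq = eq
        down (suc k) k<d eq = down k (ℕ.<⇒≤ k<d) (scaled (shift-linear triple (- 1ℂ))
          (lower-coefficient k (d ℕ.∸ suc k)
            (trans (sym (ℕ.m+[n∸m]≡n k<d)) (sym (ℕ.+-suc k (d ℕ.∸ suc k)))))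
          (lower-component (r ℕ.+ k))
          (subst (λ i → a •ᵥ F i u ≈ᵥ 0ᵥ) (ℕ.+-suc r k) eq))
        -- From r upwards the coefficient of `M₊` is 2(m + 1), which cancels for every m; no upper
        -- bound on the index is required.
        up : ∀ m → a •ᵥ F (r ℕ.+ m) u ≈ᵥ 0ᵥ
        up zero = down k k≤d eq
        up (suc m) = scaled (shift-linear triple 1ℂ)
          (cancellable-resp (≈-sym (raise-coefficient (suc m))) (double-cancel m))
          (subst (λ i → M₊ (F (r ℕ.+ m) u) ≈ᵥ (nat d + - θℂ D i) •ᵥ F i u) (sym (ℕ.+-suc r m))
            (raise-component (r ℕ.+ m)))
          (up m)
        everywhere : ∀ i → a •ᵥ F i u ≈ᵥ 0ᵥ
        everywhere i with r ℕ.≤? i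
        ... | yes r≤i = subst (λ j → a •ᵥ F j u ≈ᵥ 0ᵥ) (ℕ.m+[n∸m]≡n r≤i) (up (i ℕ.∸ r))
        ... | no r≰i = λ y → ≈-trans (*-congˡ (below i (ℕ.≰⇒> r≰i) y)) (zeroʳ a)

      -- Projecting a vanishing combination by `F (r + k)` isolates its k-th term, and
      -- `component-cancel` then yields the coefficient without exhibiting a nonzero entry of that
      -- component.
      independent : ∀ (a : Fin (suc d) → ℂ) → (∀ y → sum (λ k → a k * basis k y) ≈ 0ℂ) → ∀ k → a k ≈ 0ℂ
      independent a eq k = component-cancel (toℕ k) (ℕ.≤-pred (Fin.toℕ<n k)) λ y → begin
        a k * F (r ℕ.+ toℕ k) u y
          ≈⟨ *-congˡ (idempotent (r ℕ.+ toℕ k) u y) ⟨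
        a k * F (r ℕ.+ toℕ k) (basis k) y
          ≈⟨ sum-single (λ j → a j * F (r ℕ.+ toℕ k) (basis j) y) k (λ j j≢k → ≈-trans
               (*-congˡ (orthogonal u (λ eq → j≢k (Fin.toℕ-injective (ℕ.+-cancelˡ-≡ r _ _ eq))) y))
               (zeroʳ (a j))) ⟨
        sum (λ j → a j * F (r ℕ.+ toℕ k) (basis j) y)
          ≈⟨ sum-cong-≋ {_} {λ j → a j * F (r ℕ.+ toℕ k) (basis j) y}
               (λ j → ≈-sym (•-hom (F-linear (r ℕ.+ toℕ k)) (a j) (basis j) y)) ⟩
        sum (λ j → F (r ℕ.+ toℕ k) (a j •ᵥ basis j) y)
          ≈⟨ sum-hom (F-linear (r ℕ.+ toℕ k)) (λ j → a j •ᵥ basis j) y ⟨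
        F (r ℕ.+ toℕ k) (λ z → sum (λ j → a j * basis j z)) y
          ≈⟨ zero-hom (F-linear (r ℕ.+ toℕ k)) eq y ⟩
        0ℂ ∎

      -- The hypothesis `generate` conceals which two of X, Y, Z are the generators A and A* of T.
      module _ {W : Pred (V D) 0ℓ} (irreducible : IsIrreducible W) (u∈W : u ∈ W) (Y-stable : Stable W Y)
        (generate : ∀ {U : Pred (V D) 0ℓ} → IsSubspace U →
          Stable U X → Stable U Y → Stable U Z → IsTModule U) where
        open IsIrreducible irreducible
        open IsTModule isTModule

        basis∈W : ∀ k → basis k ∈ W
        basis∈W k = F-stable isSubspace Y-stable (r ℕ.+ toℕ k) u∈W

        W⊆span : W ⊆ Span basis
        W⊆span = simple (Span basis)
          (generate (span-subspace basis) span-stable-X span-stable-Y span-stable-Z)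
          -- The vector u, with its entry apart from 0, witnesses that the span is not 0.
          (span-⊆ isSubspace basis∈W) (u , u∈span , u≢0)

        isBasis : IsBasis W basis
        isBasis = record { inside = basis∈W ; independent = independent ; spanning = W⊆span }

        -- The spanning components have index at least r. This is the hypothesis `vanishes` for a
        -- triple that starts at Y.
        vanishes-below : ∀ {w} → w ∈ W → ∀ i → i ℕ.< r → F i w ≈ᵥ 0ᵥ
        vanishes-below w∈W i i<r y = let a , eq = W⊆span w∈W in begin
          F i _ y
            ≈⟨ ᵥ-cong (F-linear i) eq y ⟩
          F i (λ z → sum (λ k → a k * basis k z)) y
            ≈⟨ sum-hom (F-linear i) (λ k → a k •ᵥ basis k) y ⟩
          sum (λ k → F i (a k •ᵥ basis k) y)
            ≈⟨ sum-zero (λ k → F i (a k •ᵥ basis k) y) (λ k → ≈-trans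
                 (•-hom (F-linear i) (a k) (basis k) y)
                 (≈-trans (*-congˡ (orthogonal u (λ eq →
                   ℕ.<⇒≱ i<r (subst (r ℕ.≤_) eq (ℕ.m≤m+n r (toℕ k)))) y))
                   (zeroʳ (a k)))) ⟩
          0ℂ ∎

  module _ {D} {X Y Z : V D → V D} {c : ℂ} {G : ℕ → V D → V D} (triple : Triple X Y Z c) (axis : Axis X G)
    {r d : ℕ} (d+2r≡D : d ℕ.+ 2 ℕ.* r ≡ D) {W : Pred (V D) 0ℓ} (subspace : IsSubspace W)
    (Y-stable : Stable W Y) (Z-stable : Stable W Z)
    (vanishes : ∀ {w} → w ∈ W → ∀ i → i ℕ.< r → G i w ≈ᵥ 0ᵥ) where
    open Axis axis
    open IsSubspace subspace

    -- The vector (Y + cZ)u has X-eigenvalue θ_r + 2. Its components at i ≥ r vanish because the gap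
    -- to θ_i is 2(i - r + 1), those at i < r because it lies in W; splitting by i in this way also
    -- covers r = 0.
    highestWeight : ∀ {u} → u ∈ W → Eigenvector X (θℂ D r) u → HighestWeight X Y Z c d u
    highestWeight {u} u∈W eig = record { weight = weight ; highest = detect annihilated }
      where
      weight : Eigenvector X (nat d) u
      weight y = ≈-trans (eig y) (*-congʳ (≈-trans (θℂ≈ D r) (≈-trans (+-congʳ (nat-D r d d+2r≡D))
        (solve 2 (λ d r → (d :+ (r :+ r)) :+ :- (r :+ r) := d) ≈-refl (nat d) (nat r)))))
      annihilated : ∀ i → G i (raise triple u) ≈ᵥ 0ᵥ
      annihilated i with r ℕ.≤? i
      ... | no r≰i = vanishes (+-closed (Y-stable u∈W) (•-closed c (Z-stable u∈W))) i (ℕ.≰⇒> r≰i)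
      ... | yes r≤i = eigenvector-off i (raise-eigenvector triple eig) (cancellable-resp (≈-sym (≈-trans
          (+-cong (+-congʳ (θℂ≈ D r)) (-‿cong (≈-trans (θℂ≈ D i) (+-congˡ (-‿cong (+-cong nat-i nat-i))))))
          (≈-trans (solve 3 (λ n r m →
              ((n :+ :- (r :+ r)) :+ (con 1ℚ :+ con 1ℚ)) :+ :- (n :+ :- ((r :+ m) :+ (r :+ m))) :=
              (con 1ℚ :+ m) :+ (con 1ℚ :+ m)) ≈-refl (nat D) (nat r) (nat m))
            (≈-sym (+-cong (nat-suc m) (nat-suc m)))))) (double-cancel m))
        where
        m : ℕ
        m = i ℕ.∸ r
        nat-i : nat i ≈ nat r + nat m
        nat-i = ≈-trans (≈-reflexive (cong nat (sym (ℕ.m+[n∸m]≡n r≤i)))) (nat-+ r m)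

-- The cube as a tensor power: derivations and conjugations

module Cube where
  open Scalars
  open LinearAlgebra
  open Axes
  open Triples
  open Complex
  open Hamming using (hamming; lookup-ext)
  open KroneckerPower using (sumX-cong; *-sumX; kronecker-inverse; δ)
  open import Relation.Binary.Reasoning.Setoid setoid

  Mat₂ : Set
  Mat₂ = Fin 2 → Fin 2 → ℂ

  -- The action of a 2 × 2 matrix on (ℂ²)^{⊗D} by derivations.
  ρ : ∀ {D} → Mat₂ → V D → V D
  ρ M v []      = 0ℂ
  ρ M v (a ∷ y) = (M a 0F * v (0F ∷ y) + M a 1F * v (1F ∷ y)) + ρ M (v ∘ (a ∷_)) y

  ρ-cong : ∀ {D} (M : Mat₂) {u v : V D} → u ≈ᵥ v → ρ M u ≈ᵥ ρ M v
  ρ-cong M u≈v []      = ≈-refl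
  ρ-cong M u≈v (a ∷ y) =
    +-cong (+-cong (*-congˡ (u≈v (0F ∷ y))) (*-congˡ (u≈v (1F ∷ y)))) (ρ-cong M (λ z → u≈v (a ∷ z)) y)

  ρ-+ : ∀ {D} (M : Mat₂) (u v : V D) → ρ M (u +ᵥ v) ≈ᵥ ρ M u +ᵥ ρ M v
  ρ-+ M u v []      = ≈-sym (+-identityˡ 0ℂ)
  ρ-+ M u v (a ∷ y) = ≈-trans (+-congˡ (ρ-+ M (u ∘ (a ∷_)) (v ∘ (a ∷_)) y))
    (solve 8 (λ m n p q s t x z → (m :* (p :+ q) :+ n :* (s :+ t)) :+ (x :+ z) :=
       ((m :* p :+ n :* s) :+ x) :+ ((m :* q :+ n :* t) :+ z)) ≈-refl
      (M a 0F) (M a 1F) (u (0F ∷ y)) (v (0F ∷ y)) (u (1F ∷ y)) (v (1F ∷ y))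
      (ρ M (u ∘ (a ∷_)) y) (ρ M (v ∘ (a ∷_)) y))

  ρ-• : ∀ {D} (M : Mat₂) c (v : V D) → ρ M (c •ᵥ v) ≈ᵥ c •ᵥ ρ M v
  ρ-• M c v []      = ≈-sym (zeroʳ c)
  ρ-• M c v (a ∷ y) = ≈-trans (+-congˡ (ρ-• M c (v ∘ (a ∷_)) y))
    (solve 6 (λ c m n p q x → (m :* (c :* p) :+ n :* (c :* q)) :+ c :* x :=
       c :* ((m :* p :+ n :* q) :+ x)) ≈-refl
      c (M a 0F) (M a 1F) (v (0F ∷ y)) (v (1F ∷ y)) (ρ M (v ∘ (a ∷_)) y))

  ρ-linear : ∀ {D} (M : Mat₂) → Linear (ρ {D} M)
  ρ-linear M = record { ᵥ-cong = ρ-cong M ; +-hom = ρ-+ M ; •-hom = ρ-• M }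

  commutator : Mat₂ → Mat₂ → Mat₂
  commutator M N a b =
    (M a 0F * N 0F b + M a 1F * N 1F b) + - (N a 0F * M 0F b + N a 1F * M 1F b)

  linear-combination : ∀ {D} {f : V D → V D} → Linear f → ∀ m n (v w x : V D) y →
    f ((m •ᵥ v +ᵥ n •ᵥ w) +ᵥ x) y ≈ (m * f v y + n * f w y) + f x y
  linear-combination lin m n v w x y = ≈-trans (+-hom lin (m •ᵥ v +ᵥ n •ᵥ w) x y)
    (+-congʳ (≈-trans (+-hom lin (m •ᵥ v) (n •ᵥ w) y) (+-cong (•-hom lin m v y) (•-hom lin n w y))))

  -- Terms in which M and N act on different coordinates cancel. What remains is the 2 by 2
  -- commutator on the first coordinate and the induction hypothesis on the others.
  ρ-commutator : ∀ {D} {M N Q : Mat₂} {c} → (∀ a b → commutator M N a b ≈ c * (Q a b + Q a b)) →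
    ∀ (v : V D) y → ρ M (ρ N v) y + - ρ N (ρ M v) y ≈ c * (ρ Q v y + ρ Q v y)
  ρ-commutator {c = c} [M,N] v [] =
    solve 1 (λ c → con 0ℚ :+ :- con 0ℚ := c :* (con 0ℚ :+ con 0ℚ)) ≈-refl c
  ρ-commutator {M = M} {N} {Q} {c} [M,N] v (a ∷ y) = begin
    ρ M (ρ N v) (a ∷ y) + - ρ N (ρ M v) (a ∷ y)
      ≈⟨ +-cong (+-congˡ (linear-combination (ρ-linear M) (N a 0F) (N a 1F) v₀ v₁ (ρ N vₐ) y))
           (-‿cong (+-congˡ (linear-combination (ρ-linear N) (M a 0F) (M a 1F) v₀ v₁ (ρ M vₐ) y))) ⟩
    ((M a 0F * (N₀ + p₀) + M a 1F * (N₁ + p₁)) + ((N a 0F * q₀ + N a 1F * q₁) + ρ M (ρ N vₐ) y)) +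
    - ((N a 0F * (M₀ + q₀) + N a 1F * (M₁ + q₁)) + ((M a 0F * p₀ + M a 1F * p₁) + ρ N (ρ M vₐ) y))
      ≈⟨ solve 14 (λ m₀ m₁ n₀ n₁ M₀ M₁ N₀ N₁ p₀ p₁ q₀ q₁ s t →
           ((m₀ :* (N₀ :+ p₀) :+ m₁ :* (N₁ :+ p₁)) :+ ((n₀ :* q₀ :+ n₁ :* q₁) :+ s)) :+
           :- ((n₀ :* (M₀ :+ q₀) :+ n₁ :* (M₁ :+ q₁)) :+ ((m₀ :* p₀ :+ m₁ :* p₁) :+ t)) :=
           ((m₀ :* N₀ :+ m₁ :* N₁) :+ :- (n₀ :* M₀ :+ n₁ :* M₁)) :+ (s :+ :- t)) ≈-refl
           (M a 0F) (M a 1F) (N a 0F) (N a 1F) M₀ M₁ N₀ N₁ p₀ p₁ q₀ q₁ (ρ M (ρ N vₐ) y) (ρ N (ρ M vₐ) y) ⟩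
    ((M a 0F * N₀ + M a 1F * N₁) + - (N a 0F * M₀ + N a 1F * M₁)) + (ρ M (ρ N vₐ) y + - ρ N (ρ M vₐ) y)
      ≈⟨ +-cong (solve 14 (λ m₀ m₁ n₀ n₁ M₀₀ M₀₁ M₁₀ M₁₁ N₀₀ N₀₁ N₁₀ N₁₁ v₀ v₁ →
             (m₀ :* (N₀₀ :* v₀ :+ N₀₁ :* v₁) :+ m₁ :* (N₁₀ :* v₀ :+ N₁₁ :* v₁)) :+
             :- (n₀ :* (M₀₀ :* v₀ :+ M₀₁ :* v₁) :+ n₁ :* (M₁₀ :* v₀ :+ M₁₁ :* v₁)) :=
             ((m₀ :* N₀₀ :+ m₁ :* N₁₀) :+ :- (n₀ :* M₀₀ :+ n₁ :* M₁₀)) :* v₀ :+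
             ((m₀ :* N₀₁ :+ m₁ :* N₁₁) :+ :- (n₀ :* M₀₁ :+ n₁ :* M₁₁)) :* v₁) ≈-refl
             (M a 0F) (M a 1F) (N a 0F) (N a 1F) (M 0F 0F) (M 0F 1F) (M 1F 0F) (M 1F 1F)
             (N 0F 0F) (N 0F 1F) (N 1F 0F) (N 1F 1F) (v₀ y) (v₁ y))
           (ρ-commutator {M = M} {N} {Q} [M,N] vₐ y) ⟩
    (commutator M N a 0F * v₀ y + commutator M N a 1F * v₁ y) + c * (ρ Q vₐ y + ρ Q vₐ y)
      ≈⟨ +-congʳ (+-cong (*-congʳ ([M,N] a 0F)) (*-congʳ ([M,N] a 1F))) ⟩
    (c * (Q a 0F + Q a 0F) * v₀ y + c * (Q a 1F + Q a 1F) * v₁ y) + c * (ρ Q vₐ y + ρ Q vₐ y)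
      ≈⟨ solve 6 (λ c p q v w t → (c :* (p :+ p) :* v :+ c :* (q :+ q) :* w) :+ c :* (t :+ t) :=
           c :* (((p :* v :+ q :* w) :+ t) :+ ((p :* v :+ q :* w) :+ t))) ≈-refl
           c (Q a 0F) (Q a 1F) (v₀ y) (v₁ y) (ρ Q vₐ y) ⟩
    c * (ρ Q v (a ∷ y) + ρ Q v (a ∷ y)) ∎
    where
    v₀ v₁ vₐ : V _
    v₀ = v ∘ (0F ∷_)
    v₁ = v ∘ (1F ∷_)
    vₐ = v ∘ (a ∷_)
    M₀ M₁ N₀ N₁ p₀ p₁ q₀ q₁ : ℂ
    M₀ = M 0F 0F * v₀ y + M 0F 1F * v₁ y
    M₁ = M 1F 0F * v₀ y + M 1F 1F * v₁ y
    N₀ = N 0F 0F * v₀ y + N 0F 1F * v₁ y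
    N₁ = N 1F 0F * v₀ y + N 1F 1F * v₁ y
    p₀ = ρ N v₀ y
    p₁ = ρ N v₁ y
    q₀ = ρ M v₀ y
    q₁ = ρ M v₁ y

  kronecker-∷ : ∀ {D} (k : Mat₂) (v : V (suc D)) a y → (kroneckerPower k *ᵥ v) (a ∷ y) ≈
    k a 0F * (kroneckerPower k *ᵥ (v ∘ (0F ∷_))) y + k a 1F * (kroneckerPower k *ᵥ (v ∘ (1F ∷_))) y
  kronecker-∷ {D} k v a y = ≈-trans (+-cong (pull 0F) (+-congʳ (pull 1F))) (+-congˡ (+-identityʳ _))
    where
    pull : ∀ b → sumX (λ z → (k a b * kroneckerPower k y z) * v (b ∷ z)) ≈
      k a b * (kroneckerPower k *ᵥ (v ∘ (b ∷_))) y
    pull b = ≈-trans (sumX-cong {D} λ z → *-assoc (k a b) (kroneckerPower k y z) (v (b ∷ z)))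
      (*-sumX {D} (k a b) _)

  -- Induction on the coordinates: k m′ = m k settles the first one, and the derivation on the rest
  -- passes through by linearity and the induction hypothesis.
  kronecker-intertwines : ∀ {D} {k m m′ : Mat₂} →
    (∀ a b → k a 0F * m′ 0F b + k a 1F * m′ 1F b ≈ m a 0F * k 0F b + m a 1F * k 1F b) →
    ∀ (v : V D) → kroneckerPower k *ᵥ ρ m′ v ≈ᵥ ρ m (kroneckerPower k *ᵥ v)
  kronecker-intertwines km′≈mk v [] = zeroʳ 1ℂ
  kronecker-intertwines {suc D} {k} {m} {m′} km′≈mk v (a ∷ y) = begin
    (K (ρ m′ v)) (a ∷ y)
      ≈⟨ kronecker-∷ k (ρ m′ v) a y ⟩
    k a 0F * K (ρ m′ v ∘ (0F ∷_)) y + k a 1F * K (ρ m′ v ∘ (1F ∷_)) y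
      ≈⟨ +-cong (*-congˡ (row 0F)) (*-congˡ (row 1F)) ⟩
    k a 0F * ((m′ 0F 0F * x₀ + m′ 0F 1F * x₁) + K (ρ m′ v₀) y) +
    k a 1F * ((m′ 1F 0F * x₀ + m′ 1F 1F * x₁) + K (ρ m′ v₁) y)
      ≈⟨ +-cong (*-congˡ (+-congˡ (kronecker-intertwines km′≈mk v₀ y)))
           (*-congˡ (+-congˡ (kronecker-intertwines km′≈mk v₁ y))) ⟩
    k a 0F * ((m′ 0F 0F * x₀ + m′ 0F 1F * x₁) + ρ m (K v₀) y) +
    k a 1F * ((m′ 1F 0F * x₀ + m′ 1F 1F * x₁) + ρ m (K v₁) y)
      ≈⟨ solve 10 (λ k₀ k₁ m₀₀ m₀₁ m₁₀ m₁₁ x₀ x₁ p q →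
           k₀ :* ((m₀₀ :* x₀ :+ m₀₁ :* x₁) :+ p) :+ k₁ :* ((m₁₀ :* x₀ :+ m₁₁ :* x₁) :+ q) :=
           ((k₀ :* m₀₀ :+ k₁ :* m₁₀) :* x₀ :+ (k₀ :* m₀₁ :+ k₁ :* m₁₁) :* x₁) :+
           (k₀ :* p :+ k₁ :* q)) ≈-refl
           (k a 0F) (k a 1F) (m′ 0F 0F) (m′ 0F 1F) (m′ 1F 0F) (m′ 1F 1F) x₀ x₁
           (ρ m (K v₀) y) (ρ m (K v₁) y) ⟩
    ((k a 0F * m′ 0F 0F + k a 1F * m′ 1F 0F) * x₀ + (k a 0F * m′ 0F 1F + k a 1F * m′ 1F 1F) * x₁) +
    (k a 0F * ρ m (K v₀) y + k a 1F * ρ m (K v₁) y)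
      ≈⟨ +-congʳ (+-cong (*-congʳ (km′≈mk a 0F)) (*-congʳ (km′≈mk a 1F))) ⟩
    ((m a 0F * k 0F 0F + m a 1F * k 1F 0F) * x₀ + (m a 0F * k 0F 1F + m a 1F * k 1F 1F) * x₁) +
    (k a 0F * ρ m (K v₀) y + k a 1F * ρ m (K v₁) y)
      ≈⟨ +-cong
           (solve 8 (λ m₀ m₁ k₀₀ k₀₁ k₁₀ k₁₁ x₀ x₁ →
             (m₀ :* k₀₀ :+ m₁ :* k₁₀) :* x₀ :+ (m₀ :* k₀₁ :+ m₁ :* k₁₁) :* x₁ :=
             m₀ :* (k₀₀ :* x₀ :+ k₀₁ :* x₁) :+ m₁ :* (k₁₀ :* x₀ :+ k₁₁ :* x₁)) ≈-refl
             (m a 0F) (m a 1F) (k 0F 0F) (k 0F 1F) (k 1F 0F) (k 1F 1F) x₀ x₁)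
           (≈-sym (≈-trans (+-hom (ρ-linear m) (k a 0F •ᵥ K v₀) (k a 1F •ᵥ K v₁) y)
             (+-cong (•-hom (ρ-linear m) (k a 0F) (K v₀) y) (•-hom (ρ-linear m) (k a 1F) (K v₁) y)))) ⟩
    (m a 0F * (k 0F 0F * x₀ + k 0F 1F * x₁) + m a 1F * (k 1F 0F * x₀ + k 1F 1F * x₁)) +
    ρ m (k a 0F •ᵥ K v₀ +ᵥ k a 1F •ᵥ K v₁) y
      ≈⟨ +-cong (+-cong (*-congˡ (kronecker-∷ k v 0F y)) (*-congˡ (kronecker-∷ k v 1F y)))
           (ᵥ-cong (ρ-linear m) (kronecker-∷ k v a) y) ⟨
    ρ m (kroneckerPower k *ᵥ v) (a ∷ y) ∎
    where
    K : ∀ {D} → V D → V D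
    K w = kroneckerPower k *ᵥ w
    v₀ v₁ : V D
    v₀ = v ∘ (0F ∷_)
    v₁ = v ∘ (1F ∷_)
    x₀ x₁ : ℂ
    x₀ = K v₀ y
    x₁ = K v₁ y
    row : ∀ b → K (ρ m′ v ∘ (b ∷_)) y ≈ (m′ b 0F * x₀ + m′ b 1F * x₁) + K (ρ m′ (v ∘ (b ∷_))) y
    row b = linear-combination (*ᵥ-linear (kroneckerPower k))
      (m′ b 0F) (m′ b 1F) v₀ v₁ (ρ m′ (v ∘ (b ∷_))) y

  -- The Pauli matrices σ_x, σ_z and -σ_y, which are A, A* and A^ε for D = 1.
  σ σ* σᵋ : Mat₂
  σ 0F 0F = 0ℂ
  σ 0F 1F = 1ℂ
  σ 1F 0F = 1ℂ
  σ 1F 1F = 0ℂ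
  σ* 0F 0F = 1ℂ
  σ* 0F 1F = 0ℂ
  σ* 1F 0F = 0ℂ
  σ* 1F 1F = - 1ℂ
  σᵋ 0F 0F = 0ℂ
  σᵋ 0F 1F = 𝐢
  σᵋ 1F 0F = - 𝐢
  σᵋ 1F 1F = 0ℂ

  -- The Hadamard matrix; its Kronecker power conjugates A to A*.
  H₁ H₁⁻¹ : Mat₂
  H₁ 0F 0F = 1ℂ
  H₁ 0F 1F = 1ℂ
  H₁ 1F 0F = 1ℂ
  H₁ 1F 1F = - 1ℂ
  H₁⁻¹ a b = fromℚ ½ * H₁ a b

  -- The matrix entries compared below are constant sequences of explicit rationals, so both sides
  -- compute; pairing the two parts settles an entry by a single `refl`.
  SameSequences : ℂ → ℂ → Set
  SameSequences z w = ∀ n → (seq (re z) n , seq (im z) n) ≡ (seq (re w) n , seq (im w) n)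

  entrywise : ∀ (M N : Mat₂) → SameSequences (M 0F 0F) (N 0F 0F) → SameSequences (M 0F 1F) (N 0F 1F) →
    SameSequences (M 1F 0F) (N 1F 0F) → SameSequences (M 1F 1F) (N 1F 1F) → ∀ a b → M a b ≈ N a b
  entrywise M N p q r s = λ
    { 0F 0F → pointwise (cong proj₁ ∘ p) (cong proj₂ ∘ p)
    ; 0F 1F → pointwise (cong proj₁ ∘ q) (cong proj₂ ∘ q)
    ; 1F 0F → pointwise (cong proj₁ ∘ r) (cong proj₂ ∘ r)
    ; 1F 1F → pointwise (cong proj₁ ∘ s) (cong proj₂ ∘ s)
    }

  opaque
    unfolding _*_

    [σ,σ*] : ∀ a b → commutator σ σ* a b ≈ 𝐢 * (σᵋ a b + σᵋ a b)
    [σ,σ*] = entrywise (commutator σ σ*) (λ a b → 𝐢 * (σᵋ a b + σᵋ a b))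
      (λ _ → refl) (λ _ → refl) (λ _ → refl) (λ _ → refl)

    [σ*,σᵋ] : ∀ a b → commutator σ* σᵋ a b ≈ 𝐢 * (σ a b + σ a b)
    [σ*,σᵋ] = entrywise (commutator σ* σᵋ) (λ a b → 𝐢 * (σ a b + σ a b))
      (λ _ → refl) (λ _ → refl) (λ _ → refl) (λ _ → refl)

    [σᵋ,σ] : ∀ a b → commutator σᵋ σ a b ≈ 𝐢 * (σ* a b + σ* a b)
    [σᵋ,σ] = entrywise (commutator σᵋ σ) (λ a b → 𝐢 * (σ* a b + σ* a b))
      (λ _ → refl) (λ _ → refl) (λ _ → refl) (λ _ → refl)

    H₁σ≈σ*H₁ : ∀ a b → H₁ a 0F * σ 0F b + H₁ a 1F * σ 1F b ≈ σ* a 0F * H₁ 0F b + σ* a 1F * H₁ 1F b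
    H₁σ≈σ*H₁ = entrywise (λ a b → H₁ a 0F * σ 0F b + H₁ a 1F * σ 1F b)
      (λ a b → σ* a 0F * H₁ 0F b + σ* a 1F * H₁ 1F b)
      (λ _ → refl) (λ _ → refl) (λ _ → refl) (λ _ → refl)

    P₁σᵋ≈σP₁ : ∀ a b → P₁ a 0F * σᵋ 0F b + P₁ a 1F * σᵋ 1F b ≈ σ a 0F * P₁ 0F b + σ a 1F * P₁ 1F b
    P₁σᵋ≈σP₁ = entrywise (λ a b → P₁ a 0F * σᵋ 0F b + P₁ a 1F * σᵋ 1F b)
      (λ a b → σ a 0F * P₁ 0F b + σ a 1F * P₁ 1F b)
      (λ _ → refl) (λ _ → refl) (λ _ → refl) (λ _ → refl)

    H₁H₁⁻¹ : ∀ a b → sum (λ c → H₁ a c * H₁⁻¹ c b) ≈ δ a b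
    H₁H₁⁻¹ = entrywise (λ a b → sum (λ c → H₁ a c * H₁⁻¹ c b)) δ
      (λ _ → refl) (λ _ → refl) (λ _ → refl) (λ _ → refl)

    H₁⁻¹H₁ : ∀ a b → sum (λ c → H₁⁻¹ a c * H₁ c b) ≈ δ a b
    H₁⁻¹H₁ = entrywise (λ a b → sum (λ c → H₁⁻¹ a c * H₁ c b)) δ
      (λ _ → refl) (λ _ → refl) (λ _ → refl) (λ _ → refl)

  A-∷-same : ∀ {D} a (y z : X D) → A (a ∷ y) (a ∷ z) ≡ A y z
  A-∷-same a y z = cong (if_then 1ℂ else 0ℂ)
    (does-⇔ (mk⇔ shrink grow) (adjacent? (a ∷ y) (a ∷ z)) (adjacent? y z))
    where
    shrink : Adjacent (a ∷ y) (a ∷ z) → Adjacent y z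
    shrink (zero , differ , _) = contradiction refl differ
    shrink (suc k , differ , agree) = k , differ , λ j j≢k → agree (suc j) (j≢k ∘ Fin.suc-injective)
    grow : Adjacent y z → Adjacent (a ∷ y) (a ∷ z)
    grow (k , differ , agree) = suc k , differ , λ where
      zero    _   → refl
      (suc j) j≢k → agree j (j≢k ∘ cong suc)

  A-∷-differ : ∀ {D} {a b} (y z : X D) → a ≢ b → A (a ∷ y) (b ∷ z) ≡ I y z
  A-∷-differ {a = a} {b} y z a≢b = cong (if_then 1ℂ else 0ℂ)
    (does-⇔ (mk⇔ equal adjacent) (adjacent? (a ∷ y) (b ∷ z)) (≡-dec Fin._≟_ y z))
    where
    equal : Adjacent (a ∷ y) (b ∷ z) → y ≡ z
    equal (zero , _ , agree) = lookup-ext y z λ j → agree (suc j) λ ()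
    equal (suc k , _ , agree) = contradiction (agree zero λ ()) a≢b
    adjacent : y ≡ z → Adjacent (a ∷ y) (b ∷ z)
    adjacent refl = zero , a≢b , λ where
      zero    j≢0 → contradiction refl j≢0
      (suc j) _   → refl

  -- A neighbour differs either in the first coordinate, which σ exchanges, or in a later one, which
  -- is adjacency in the smaller cube.
  A≈ρσ : ∀ {D} (v : V D) → A *ᵥ v ≈ᵥ ρ σ v
  A≈ρσ v [] = zeroˡ (v [])
  A≈ρσ {suc D} v (0F ∷ y) = ≈-trans
    (+-cong (≈-trans (sumX-cong {D} λ z → *-congʳ (≈-reflexive (A-∷-same 0F y z)))
        (A≈ρσ (v ∘ (0F ∷_)) y))
      (+-congʳ (≈-trans (sumX-cong {D} λ z → *-congʳ (≈-reflexive (A-∷-differ y z λ ())))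
        (I-*ᵥ (v ∘ (1F ∷_)) y))))
    (solve 3 (λ p v w → p :+ (w :+ con 0ℚ) := (con 0ℚ :* v :+ con 1ℚ :* w) :+ p) ≈-refl
      (ρ σ (v ∘ (0F ∷_)) y) (v (0F ∷ y)) (v (1F ∷ y)))
  A≈ρσ {suc D} v (1F ∷ y) = ≈-trans
    (+-cong (≈-trans (sumX-cong {D} λ z → *-congʳ (≈-reflexive (A-∷-differ y z λ ())))
        (I-*ᵥ (v ∘ (0F ∷_)) y))
      (+-congʳ (≈-trans (sumX-cong {D} λ z → *-congʳ (≈-reflexive (A-∷-same 1F y z)))
        (A≈ρσ (v ∘ (1F ∷_)) y))))
    (solve 3 (λ p v w → v :+ (p :+ con 0ℚ) := (con 1ℚ :* v :+ con 0ℚ :* w) :+ p) ≈-refl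
      (ρ σ (v ∘ (1F ∷_)) y) (v (0F ∷ y)) (v (1F ∷ y)))

  A*-*ᵥ : ∀ {D} (v : V D) y → (A* *ᵥ v) y ≈ θℂ D (∂ origin y) * v y
  A*-*ᵥ {D} = diagonal-*ᵥ (λ y → θℂ D (∂ origin y))

  -- D - 2∂ is a sum over coordinates: 1 for each entry 0 and -1 for each entry 1, the diagonal of
  -- `σ*`.
  A*≈ρσ* : ∀ {D} (v : V D) → A* *ᵥ v ≈ᵥ ρ σ* v
  A*≈ρσ* v y = ≈-trans (A*-*ᵥ v y) (diagonal v y)
    where
    diagonal : ∀ {D} (v : V D) y → θℂ D (hamming origin y) * v y ≈ ρ σ* v y
    diagonal v [] = zeroˡ (v [])
    diagonal {suc D} v (0F ∷ y) = begin
      θℂ (suc D) h * v (0F ∷ y)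
        ≈⟨ *-congʳ (≈-trans (θℂ≈ (suc D) h) (+-congʳ (nat-suc D))) ⟩
      ((1ℂ + nat D) + - (nat h + nat h)) * v (0F ∷ y)
        ≈⟨ solve 4 (λ n h v w → ((con 1ℚ :+ n) :+ :- (h :+ h)) :* v :=
             (con 1ℚ :* v :+ con 0ℚ :* w) :+ (n :+ :- (h :+ h)) :* v) ≈-refl
             (nat D) (nat h) (v (0F ∷ y)) (v (1F ∷ y)) ⟩
      (1ℂ * v (0F ∷ y) + 0ℂ * v (1F ∷ y)) + (nat D + - (nat h + nat h)) * v (0F ∷ y)
        ≈⟨ +-congˡ (≈-trans (*-congʳ (≈-sym (θℂ≈ D h))) (diagonal (v ∘ (0F ∷_)) y)) ⟩
      ρ σ* v (0F ∷ y) ∎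
      where
      h : ℕ
      h = hamming origin y
    diagonal {suc D} v (1F ∷ y) = begin
      θℂ (suc D) (suc h) * v (1F ∷ y)
        ≈⟨ *-congʳ (≈-trans (θℂ≈ (suc D) (suc h))
             (+-cong (nat-suc D) (-‿cong (+-cong (nat-suc h) (nat-suc h))))) ⟩
      ((1ℂ + nat D) + - ((1ℂ + nat h) + (1ℂ + nat h))) * v (1F ∷ y)
        ≈⟨ solve 4 (λ n h v w → ((con 1ℚ :+ n) :+ :- ((con 1ℚ :+ h) :+ (con 1ℚ :+ h))) :* w :=
             (con 0ℚ :* v :+ (:- con 1ℚ) :* w) :+ (n :+ :- (h :+ h)) :* w) ≈-refl
             (nat D) (nat h) (v (0F ∷ y)) (v (1F ∷ y)) ⟩
      (0ℂ * v (0F ∷ y) + - 1ℂ * v (1F ∷ y)) + (nat D + - (nat h + nat h)) * v (1F ∷ y)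
        ≈⟨ +-congˡ (≈-trans (*-congʳ (≈-sym (θℂ≈ D h))) (diagonal (v ∘ (1F ∷_)) y)) ⟩
      ρ σ* v (1F ∷ y) ∎
      where
      h : ℕ
      h = hamming origin y

  hamming≤D : ∀ {D} (y z : X D) → hamming y z ℕ.≤ D
  hamming≤D [] [] = ℕ.z≤n
  hamming≤D (a ∷ y) (b ∷ z) with a Fin.≟ b
  ... | yes _ = ℕ.m≤n⇒m≤1+n (hamming≤D y z)
  ... | no  _ = ℕ.s≤s (hamming≤D y z)

  module _ {D : ℕ} where

    indicator : ℕ → X D → ℂ
    indicator i y = if does (∂ origin y ℕ.≟ i) then 1ℂ else 0ℂ

    indicator-off : ∀ {i y} → ∂ origin y ≢ i → indicator i y ≈ 0ℂ
    indicator-off {i} {y} ∂≢i = ≈-reflexive (cong (if_then 1ℂ else 0ℂ) (dec-false (∂ origin y ℕ.≟ i) ∂≢i))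

    indicator-on : ∀ y → indicator (∂ origin y) y ≈ 1ℂ
    indicator-on y = ≈-reflexive (cong (if_then 1ℂ else 0ℂ) (dec-true (∂ origin y ℕ.≟ ∂ origin y) refl))

    E*-*ᵥ : ∀ i (v : V D) y → (E* i *ᵥ v) y ≈ indicator i y * v y
    E*-*ᵥ i = diagonal-*ᵥ (indicator i)

    -- The one decomposition verified directly, all matrices being diagonal; the other two are
    -- obtained by conjugation.
    E*-axis : Axis (A* {D} *ᵥ_) (λ i → E* i *ᵥ_)
    E*-axis = record
      { linear   = *ᵥ-linear A*
      ; F-linear = λ i → *ᵥ-linear (E* i)
      ; eigen    = λ i v y → begin
          (A* *ᵥ (E* i *ᵥ v)) y                          ≈⟨ A*-*ᵥ (E* i *ᵥ v) y ⟩
          θℂ D (∂ origin y) * (E* i *ᵥ v) y              ≈⟨ *-congˡ (E*-*ᵥ i v y) ⟩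
          θℂ D (∂ origin y) * (indicator i y * v y)      ≈⟨ *-assoc _ _ _ ⟨
          (θℂ D (∂ origin y) * indicator i y) * v y      ≈⟨ *-congʳ (support i y) ⟩
          (θℂ D i * indicator i y) * v y                 ≈⟨ *-assoc _ _ _ ⟩
          θℂ D i * (indicator i y * v y)                 ≈⟨ *-congˡ (E*-*ᵥ i v y) ⟨
          θℂ D i * (E* i *ᵥ v) y                         ∎
      ; commute  = λ i v y → begin
          (E* i *ᵥ (A* *ᵥ v)) y                          ≈⟨ E*-*ᵥ i (A* *ᵥ v) y ⟩
          indicator i y * (A* *ᵥ v) y                    ≈⟨ *-congˡ (A*-*ᵥ v y) ⟩
          indicator i y * (θℂ D (∂ origin y) * v y)      ≈⟨ solve 3
                                                              (λ e t v → e :* (t :* v) := t :* (e :* v))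
                                                              ≈-refl (indicator i y) (θℂ D (∂ origin y)) (v y) ⟩
          θℂ D (∂ origin y) * (indicator i y * v y)      ≈⟨ *-congˡ (E*-*ᵥ i v y) ⟨
          θℂ D (∂ origin y) * (E* i *ᵥ v) y              ≈⟨ A*-*ᵥ (E* i *ᵥ v) y ⟨
          (A* *ᵥ (E* i *ᵥ v)) y                          ∎
      ; complete = complete
      ; beyond   = λ i v D<i y → ≈-trans (E*-*ᵥ i v y) (≈-trans
          (*-congʳ (indicator-off λ eq → ℕ.<⇒≱ D<i (subst (ℕ._≤ D) eq (hamming≤D origin y))))
          (zeroˡ (v y)))
      }
      where
      support : ∀ i y → θℂ D (∂ origin y) * indicator i y ≈ θℂ D i * indicator i y
      support i y with ∂ origin y ℕ.≟ i
      ... | yes ∂≡i = *-congʳ (≈-reflexive (cong (θℂ D) ∂≡i))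
      ... | no ∂≢i  = ≈-trans (annihilate (θℂ D (∂ origin y))) (≈-sym (annihilate (θℂ D i)))
        where
        annihilate : ∀ x → x * indicator i y ≈ 0ℂ
        annihilate x = ≈-trans (*-congˡ (indicator-off ∂≢i)) (zeroʳ x)
      complete : ∀ v y → sum (λ (j : Fin (suc D)) → (E* (toℕ j) *ᵥ v) y) ≈ v y
      complete v y = ≈-trans
        (sum-single (λ (j : Fin (suc D)) → (E* (toℕ j) *ᵥ v) y) k λ j j≢k → ≈-trans (E*-*ᵥ (toℕ j) v y)
          (≈-trans (*-congʳ (indicator-off λ eq → j≢k (Fin.toℕ-injective (trans (sym eq) (sym toℕ-k)))))
            (zeroˡ (v y))))
        (≈-trans (E*-*ᵥ (toℕ k) v y) (≈-trans
          (*-congʳ (≈-trans (≈-reflexive (cong (λ i → indicator i y) toℕ-k)) (indicator-on y)))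
          (*-identityˡ (v y))))
        where
        k : Fin (suc D)
        k = fromℕ< (ℕ.s≤s (hamming≤D origin y))
        toℕ-k : toℕ k ≡ ∂ origin y
        toℕ-k = Fin.toℕ-fromℕ< (ℕ.s≤s (hamming≤D origin y))

    factor-*ᵥ : ∀ i j (v : V D) → factor i j *ᵥ v ≈ᵥ lagrangeFactor (A *ᵥ_) i j v
    factor-*ᵥ i j v with j ℕ.≟ i
    ... | yes _  = I-*ᵥ v
    ... | no j≢i = λ y → ≈-trans (•ₘ-*ᵥ _ (A -ₘ (θℂ D j •ₘ I)) v y)
      (*-congˡ (≈-trans (-ₘ-*ᵥ A (θℂ D j •ₘ I) v y)
      (+-congˡ (-‿cong (≈-trans (•ₘ-*ᵥ (θℂ D j) I v y) (*-congˡ (I-*ᵥ v y)))))))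

    E≈lagrange : ∀ i (v : V D) → E i *ᵥ v ≈ᵥ lagrange (A *ᵥ_) i (upTo (suc D)) v
    E≈lagrange i v = go (upTo (suc D))
      where
      go : ∀ l → foldr (λ j M → factor i j *ₘ M) I l *ᵥ v ≈ᵥ lagrange (A *ᵥ_) i l v
      go [] = I-*ᵥ v
      go (j ∷ l) = transᵥ (*ₘ-*ᵥ (factor i j) _ v) (transᵥ (factor-*ᵥ i j _)
        (ᵥ-cong (lagrangeFactor-linear (*ᵥ-linear A) i j) (go l)))

    matrix-inverse : ∀ {K L : Mat D} → K *ₘ L ≈ₘ I → ∀ v → K *ᵥ (L *ᵥ v) ≈ᵥ v
    matrix-inverse {K} {L} KL≈I v = transᵥ (symᵥ (*ₘ-*ᵥ K L v)) (transᵥ (*ᵥ-congˡ KL≈I v) (I-*ᵥ v))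

    -- Conjugation yields eigenprojections of A that are not literally `E i`; both families equal
    -- the Lagrange products in A, hence agree.
    E-axis : Axis (A {D} *ᵥ_) (λ i → E i *ᵥ_)
    E-axis = axis-resp (λ i v → transᵥ (Axis.F≈lagrange conjugated i v) (symᵥ (E≈lagrange i v))) conjugated
      where
      conjugated : Axis (A {D} *ᵥ_) (λ i v → kroneckerPower H₁⁻¹ *ᵥ (E* i *ᵥ (kroneckerPower H₁ *ᵥ v)))
      conjugated = axis-conjugate (*ᵥ-linear _) (*ᵥ-linear _) (*ᵥ-linear A)
        (matrix-inverse (kronecker-inverse H₁ H₁⁻¹ H₁H₁⁻¹))
        (matrix-inverse (kronecker-inverse H₁⁻¹ H₁ H₁⁻¹H₁))
        (λ v → transᵥ (ᵥ-cong (*ᵥ-linear (kroneckerPower H₁)) (A≈ρσ v)) (transᵥ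
          (kronecker-intertwines {m = σ*} {σ} H₁σ≈σ*H₁ v) (symᵥ (A*≈ρσ* (kroneckerPower H₁ *ᵥ v)))))
        E*-axis

    Eᵋ-axis : Axis (ρ {D} σᵋ) (λ i → Eᵋ i *ᵥ_)
    Eᵋ-axis = axis-resp
      (λ i v → symᵥ (transᵥ (*ₘ-*ᵥ (P⁻¹ *ₘ E i) P v) (*ₘ-*ᵥ P⁻¹ (E i) (P *ᵥ v))))
      (axis-conjugate (*ᵥ-linear P) (*ᵥ-linear P⁻¹) (ρ-linear σᵋ)
        (matrix-inverse KroneckerPower.P-inverseʳ) (matrix-inverse KroneckerPower.P-inverseˡ)
        (λ v → transᵥ (kronecker-intertwines {m = σ} {σᵋ} P₁σᵋ≈σP₁ v) (symᵥ (A≈ρσ (P *ᵥ v))))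
        E-axis)

    -- ρ σᵋ is the operator A^ε = −i(AA* − A*A)/2.
    A-A*-Aᵋ : Triple (A {D} *ᵥ_) (A* *ᵥ_) (ρ σᵋ) 𝐢
    A-A*-Aᵋ = record
      { X-linear = *ᵥ-linear A
      ; Y-linear = *ᵥ-linear A*
      ; Z-linear = ρ-linear σᵋ
      ; c*c      = 𝐢*𝐢
      ; [X,Y]    = λ v y → ≈-trans
          (+-cong (composite (A *ᵥ_) (ρ-linear σ) A≈ρσ A*≈ρσ* v y)
            (-‿cong (composite (A* *ᵥ_) (ρ-linear σ*) A*≈ρσ* A≈ρσ v y)))
          (ρ-commutator {M = σ} {σ*} {σᵋ} [σ,σ*] v y)
      ; [Y,Z]    = λ v y → ≈-trans
          (+-cong (A*≈ρσ* (ρ σᵋ v) y) (-‿cong (ᵥ-cong (ρ-linear σᵋ) (A*≈ρσ* v) y)))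
          (≈-trans (ρ-commutator {M = σ*} {σᵋ} {σ} [σ*,σᵋ] v y)
            (*-congˡ (≈-sym (+-cong (A≈ρσ v y) (A≈ρσ v y)))))
      ; [Z,X]    = λ v y → ≈-trans
          (+-cong (ᵥ-cong (ρ-linear σᵋ) (A≈ρσ v) y) (-‿cong (A≈ρσ (ρ σᵋ v) y)))
          (≈-trans (ρ-commutator {M = σᵋ} {σ} {σ*} [σᵋ,σ] v y)
            (*-congˡ (≈-sym (+-cong (A*≈ρσ* v y) (A*≈ρσ* v y)))))
      }
      where
      composite : ∀ (f : V D → V D) {f′ g g′ : V D → V D} → Linear f′ →
        (∀ v → f v ≈ᵥ f′ v) → (∀ v → g v ≈ᵥ g′ v) →
        ∀ v → f (g v) ≈ᵥ f′ (g′ v)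
      composite f {g = g} lin f≈f′ g≈g′ v = transᵥ (f≈f′ (g v)) (ᵥ-cong lin (g≈g′ v))

-- The six bases

module Main where
  open Scalars
  open LinearAlgebra
  open Axes
  open Triples
  open Cube
  open Complex

  -- Z = -(c/2)(XY - YX), as -c is the inverse of c. So a T-module is stable under A^ε.
  stable-Z : ∀ {D} {X Y Z : V D → V D} {c} → Triple X Y Z c → ∀ {W} → IsSubspace W →
    Stable W X → Stable W Y → Stable W Z
  stable-Z {X = X} {Y} {Z} {c} triple sub X-stable Y-stable {w} w∈W = resp
    (λ y → ≈-trans (*-congˡ (≈-trans
        (solve 2 (λ a b → a :+ (:- con 1ℚ) :* b := a :+ :- b) ≈-refl (X (Y w) y) (Y (X w) y)) ([X,Y] w y)))
      (≈-trans (solve 2 (λ c z → ((:- con ½) :* c) :* (c :* (z :+ z)) := :- ((c :* c) :* z))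
          ≈-refl c (Z w y))
      (≈-trans (-‿cong (*-congʳ c*c)) (solve 1 (λ z → :- ((:- con 1ℚ) :* z) := z) ≈-refl (Z w y)))))
    (•-closed (- fromℚ ½ * c) (+-closed (X-stable (Y-stable w∈W))
      (•-closed (- 1ℂ) (Y-stable (X-stable w∈W)))))
    where
    open Triple triple
    open IsSubspace sub

  module Bases {D : ℕ} {W : Pred (V D) 0ℓ} (irreducible : IsIrreducible W) {r d : ℕ}
    (d+2r≡D : d ℕ.+ 2 ℕ.* r ≡ D) (endpoint : IsEndpoint W r) where
    open IsIrreducible irreducible using (isTModule)
    open IsEndpoint endpoint renaming (nonzero to E*W≢0)
    open IsTModule isTModule
    open IsSubspace isSubspace

    VanishesBelow : (ℕ → V D → V D) → Set
    VanishesBelow F = ∀ {w} → w ∈ W → ∀ i → i ℕ.< r → F i w ≈ᵥ 0ᵥ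

    -- The common form of the six cases. The second component of the result passes the bound r on
    -- indices from the family G to the family F.
    basis-of-components : ∀ {X Y Z c} {G : ℕ → Mat D} {F : ℕ → V D → V D} →
      Triple X Y Z c → Axis X (λ i → G i *ᵥ_) → Axis Y F → Stable W X → Stable W Y → Stable W Z →
      (∀ {U : Pred (V D) 0ℓ} → IsSubspace U → Stable U X → Stable U Y → Stable U Z → IsTModule U) →
      VanishesBelow (λ i → G i *ᵥ_) → ∀ u → u ∈ G r ⟪ W ⟫ → Nonzero u →
      IsBasis W (λ (k : Fin (suc d)) → F (r ℕ.+ toℕ k) u) × VanishesBelow F
    basis-of-components {X} triple X-axis Y-axis X-stable Y-stable Z-stable generate vanishes
      u (w , w∈W , u≈Gw) u≢0 =
      isBasis u≢0 irreducible u∈W Y-stable generate , vanishes-below u≢0 irreducible u∈W Y-stable generate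
      where
      open Axis X-axis
      u∈W : u ∈ W
      u∈W = resp (symᵥ u≈Gw) (F-stable isSubspace X-stable r w∈W)
      eigenvector : Eigenvector X (θℂ D r) u
      eigenvector = transᵥ (ᵥ-cong linear u≈Gw) (transᵥ (eigen r w) λ y → *-congˡ (≈-sym (u≈Gw y)))
      open Strings triple Y-axis {r} {d} d+2r≡D
        (highestWeight triple X-axis {r} {d} d+2r≡D isSubspace Y-stable Z-stable vanishes u∈W eigenvector)

    A-stable : Stable W (A *ᵥ_)
    A-stable = invariant A∈T

    A*-stable : Stable W (A* *ᵥ_)
    A*-stable = invariant A*∈T

    Aᵋ-stable : Stable W (ρ σᵋ)
    Aᵋ-stable = stable-Z A-A*-Aᵋ isSubspace A-stable A*-stable

    A*-Aᵋ-A : Triple (A* *ᵥ_) (ρ σᵋ) (A {D} *ᵥ_) 𝐢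
    A*-Aᵋ-A = rotate A-A*-Aᵋ

    Aᵋ-A-A* : Triple (ρ σᵋ) (A {D} *ᵥ_) (A* *ᵥ_) 𝐢
    Aᵋ-A-A* = rotate A*-Aᵋ-A

    E*-vanishes : VanishesBelow (λ i → E* i *ᵥ_)
    E*-vanishes {w} w∈W i i<r y = #-tight λ E*w#0 → ℕ.<⇒≱ i<r
      (least i (ℕ.≤-trans (ℕ.<⇒≤ i<r) inRange) (E* i *ᵥ w , (w , w∈W , λ _ → ≈-refl) , y , E*w#0))

    basis-A*-Aᵋ : ∀ u → u ∈ E* r ⟪ W ⟫ → Nonzero u →
      IsBasis W (λ (k : Fin (suc d)) → Eᵋ (r ℕ.+ toℕ k) *ᵥ u) × VanishesBelow (λ i → Eᵋ i *ᵥ_)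
    basis-A*-Aᵋ = basis-of-components A*-Aᵋ-A E*-axis Eᵋ-axis A*-stable Aᵋ-stable A-stable
      (λ sub s* sᵋ s → stable⇒TModule sub s s*) E*-vanishes

    -- The order A*, A, A^ε is an odd permutation of A, A*, A^ε, hence `reflect` and the scalar -i.
    basis-A*-A : ∀ u → u ∈ E* r ⟪ W ⟫ → Nonzero u →
      IsBasis W (λ (k : Fin (suc d)) → E (r ℕ.+ toℕ k) *ᵥ u) × VanishesBelow (λ i → E i *ᵥ_)
    basis-A*-A = basis-of-components (reflect A-A*-Aᵋ) E*-axis E-axis A*-stable A-stable Aᵋ-stable
      (λ sub s* s sᵋ → stable⇒TModule sub s s*) E*-vanishes

    -- The endpoint is defined by E* alone; the two bases above, for one nonzero
    -- vector of E*_r W, show that it also bounds E and Eᵋ.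
    E-vanishes : VanishesBelow (λ i → E i *ᵥ_)
    E-vanishes = let v , v∈ , v≢0 = E*W≢0 in proj₂ (basis-A*-A v v∈ v≢0)

    Eᵋ-vanishes : VanishesBelow (λ i → Eᵋ i *ᵥ_)
    Eᵋ-vanishes = let v , v∈ , v≢0 = E*W≢0 in proj₂ (basis-A*-Aᵋ v v∈ v≢0)

    basis-A-A* : ∀ u → u ∈ E r ⟪ W ⟫ → Nonzero u →
      IsBasis W (λ (k : Fin (suc d)) → E* (r ℕ.+ toℕ k) *ᵥ u) × VanishesBelow (λ i → E* i *ᵥ_)
    basis-A-A* = basis-of-components A-A*-Aᵋ E-axis E*-axis A-stable A*-stable Aᵋ-stable
      (λ sub s s* sᵋ → stable⇒TModule sub s s*) E-vanishes

    basis-A-Aᵋ : ∀ u → u ∈ E r ⟪ W ⟫ → Nonzero u →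
      IsBasis W (λ (k : Fin (suc d)) → Eᵋ (r ℕ.+ toℕ k) *ᵥ u) × VanishesBelow (λ i → Eᵋ i *ᵥ_)
    basis-A-Aᵋ = basis-of-components (reflect Aᵋ-A-A*) E-axis Eᵋ-axis A-stable Aᵋ-stable A*-stable
      (λ sub s sᵋ s* → stable⇒TModule sub s s*) E-vanishes

    basis-Aᵋ-A : ∀ u → u ∈ Eᵋ r ⟪ W ⟫ → Nonzero u →
      IsBasis W (λ (k : Fin (suc d)) → E (r ℕ.+ toℕ k) *ᵥ u) × VanishesBelow (λ i → E i *ᵥ_)
    basis-Aᵋ-A = basis-of-components Aᵋ-A-A* Eᵋ-axis E-axis Aᵋ-stable A-stable A*-stable
      (λ sub sᵋ s s* → stable⇒TModule sub s s*) Eᵋ-vanishes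

    basis-Aᵋ-A* : ∀ u → u ∈ Eᵋ r ⟪ W ⟫ → Nonzero u →
      IsBasis W (λ (k : Fin (suc d)) → E* (r ℕ.+ toℕ k) *ᵥ u) × VanishesBelow (λ i → E* i *ᵥ_)
    basis-Aᵋ-A* = basis-of-components (reflect A*-Aᵋ-A) Eᵋ-axis E*-axis Aᵋ-stable A*-stable A-stable
      (λ sub sᵋ s* s → stable⇒TModule sub s s*) Eᵋ-vanishes

open import Data.Nat.Base using (_+_; _*_; _<_)

lemma9p1 : (D : ℕ) → 0 < D →
    (W : Pred (V D) 0ℓ) → IsIrreducible W →
    (r d : ℕ) → IsEndpoint W r → IsDiameter W d → d + 2 * r ≡ D →
    ((u : V D) → u ∈ E r ⟪ W ⟫ → Nonzero u →
    IsBasis W (λ (k : Fin (suc d)) → E* (r + toℕ k) *ᵥ u) ×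
    IsBasis W (λ (k : Fin (suc d)) → Eᵋ (r + toℕ k) *ᵥ u)) ×
    ((u* : V D) → u* ∈ E* r ⟪ W ⟫ → Nonzero u* →
    IsBasis W (λ (k : Fin (suc d)) → Eᵋ (r + toℕ k) *ᵥ u*) ×
    IsBasis W (λ (k : Fin (suc d)) → E (r + toℕ k) *ᵥ u*)) ×
    ((uᵋ : V D) → uᵋ ∈ Eᵋ r ⟪ W ⟫ → Nonzero uᵋ →
    IsBasis W (λ (k : Fin (suc d)) → E (r + toℕ k) *ᵥ uᵋ) ×
    IsBasis W (λ (k : Fin (suc d)) → E* (r + toℕ k) *ᵥ uᵋ))
lemma9p1 D _ W irreducible r d endpoint _ d+2r≡D =
  (λ u u∈ u≢0 → proj₁ (basis-A-A* u u∈ u≢0) , proj₁ (basis-A-Aᵋ u u∈ u≢0)) ,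
  (λ u u∈ u≢0 → proj₁ (basis-A*-Aᵋ u u∈ u≢0) , proj₁ (basis-A*-A u u∈ u≢0)) ,
  (λ u u∈ u≢0 → proj₁ (basis-Aᵋ-A u u∈ u≢0) , proj₁ (basis-Aᵋ-A* u u∈ u≢0))
  where open Main.Bases irreducible {r} {d} d+2r≡D endpoint
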